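{- Let $V=[n]$ and let $\chi\colon V^2\to C$ be a coloring that assigns loops colors different from those of non-loops and respects converse equivalence. Then walk refinement stabilizes in $2n$ iterations: the smallest $m$ with $\chi_{\mathcal{W}}^m\equiv\chi_{\mathcal{W}}^{m+1}$ satisfies $m\le 2n$.
   Context: $\chi$ respects converse equivalence if $\chi(u_1,v_1)=\chi(u_2,v_2)$ implies $\chi(v_1,u_1)=\chi(v_2,u_2)$. With $\overline{\chi}(v_1,\dots,v_m)=(\chi(v_1,v_2),\dots,\chi(v_{m-1},v_m))$, the $k$-walk refinement ($k\ge2$) is $\chi_{\mathcal{W}[k]}(u,v)=\{\!\{\overline\chi(u,w_1,\dots,w_{k-1},v): w_i\in V\}\!\}$; the walk refinement $\chi_{\mathcal{W}}$ is $\chi_{\mathcal{W}[k]}$ for the smallest $k$ for which it induces the finest partition of $V^2$ among all $k$-walk refinements. $\chi_{\mathcal{W}}^m$ denotes $m$-fold iterated application (each time applied to the current coloring). $\chi\equiv\chi'$ means both colorings induce the same partition of $V^2$. -}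

module Defs where

open import Data.Nat using (ℕ; zero; suc; _≤_; _<_; _∸_; _*_)
open import Data.Fin using (Fin)
open import Data.Vec using (Vec; _∷_; []; _++_; [_])
open import Data.Product using (Σ; _×_; _,_)
open import Data.Unit using (⊤)
open import Data.Empty using (⊥)
open import Function.Bundles using (_↔_; Inverse)
open import Relation.Nullary using (¬_)
open import Relation.Binary.PropositionalEquality using (_≡_; _≢_)

-- A coloring of V² (V = Fin n) is represented by the partition of V² it
-- induces, i.e. by its "same colour" relation:
--   Col n u₁ v₁ u₂ v₂  means  χ(u₁,v₁) = χ(u₂,v₂).
Col : ℕ → Set₁
Col n = Fin n → Fin n → Fin n → Fin n → Set

kernel : ∀ {n} {C : Set} → (Fin n → Fin n → C) → Col n
kernel χ u₁ v₁ u₂ v₂ = χ u₁ v₁ ≡ χ u₂ v₂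

_≡ᶜ_ : ∀ {n} → Col n → Col n → Set
_≡ᶜ_ {n} R S = (u₁ v₁ u₂ v₂ : Fin n) → (R u₁ v₁ u₂ v₂ → S u₁ v₁ u₂ v₂) × (S u₁ v₁ u₂ v₂ → R u₁ v₁ u₂ v₂)

_⊑_ : ∀ {n} → Col n → Col n → Set
_⊑_ {n} R S = (u₁ v₁ u₂ v₂ : Fin n) → R u₁ v₁ u₂ v₂ → S u₁ v₁ u₂ v₂

SameSeq : ∀ {n m} → Col n → Vec (Fin n) m → Vec (Fin n) m → Set
SameSeq R [] [] = ⊤
SameSeq R (x ∷ []) (y ∷ []) = ⊤
SameSeq R (x ∷ x' ∷ xs) (y ∷ y' ∷ ys) = R x x' y y' × SameSeq R (x' ∷ xs) (y' ∷ ys)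

-- k-walk refinement (k ≥ 2), as a partition:
-- χ_W[k](u₁,v₁) = χ_W[k](u₂,v₂) iff the multisets
-- {{ χ̄(u₁,w,v₁) : w ∈ V^{k-1} }} and {{ χ̄(u₂,w,v₂) : w ∈ V^{k-1} }} agree,
-- i.e. there is a bijection π of V^{k-1} with χ̄(u₁,w,v₁) = χ̄(u₂,π w,v₂).
WalkRef : ∀ {n} → ℕ → Col n → Col n
WalkRef {n} k R u₁ v₁ u₂ v₂ =
  Σ (Vec (Fin n) (k ∸ 1) ↔ Vec (Fin n) (k ∸ 1)) λ π →
    (ws : Vec (Fin n) (k ∸ 1)) →
      SameSeq R ((u₁ ∷ ws) ++ [ v₁ ]) ((u₂ ∷ Inverse.to π ws) ++ [ v₂ ])

IsFinestK : ∀ {n} → Col n → ℕ → Set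
IsFinestK R k = (k' : ℕ) → 2 ≤ k' → WalkRef k R ⊑ WalkRef k' R

IsWalkRefinement : ∀ {n} → Col n → Col n → Set
IsWalkRefinement R S =
  Σ ℕ λ k → 2 ≤ k × IsFinestK R k × (S ≡ᶜ WalkRef k R)
    × ((k' : ℕ) → 2 ≤ k' → k' < k → ¬ IsFinestK R k')

IsWalkIteration : ∀ {n} → Col n → (ℕ → Col n) → Set
IsWalkIteration R Rs = (Rs 0 ≡ᶜ R) × ((m : ℕ) → IsWalkRefinement (Rs m) (Rs (suc m)))

LoopsDistinct : ∀ {n} {C : Set} → (Fin n → Fin n → C) → Set
LoopsDistinct {n} χ = (u v w : Fin n) → v ≢ w → χ u u ≢ χ v w

RespectsConverse : ∀ {n} {C : Set} → (Fin n → Fin n → C) → Set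
RespectsConverse {n} χ = (u₁ v₁ u₂ v₂ : Fin n) → χ u₁ v₁ ≡ χ u₂ v₂ → χ v₁ u₁ ≡ χ v₂ u₂

{-# OPTIONS --safe #-}
module Submission where

-- Let Rᵢ be the colouring after i steps, all refinements being taken with one long walk length.
-- The matrices constant on the colour classes of Rᵢ generate a star algebra Aᵢ ⊆ Mₙ(ℚ), and
-- counting coloured walks shows that Aᵢ consists of matrices constant on the classes of Rᵢ₊₁.
-- So A₀ ⊆ A₁ ⊆ …, and Aᵢ = Aᵢ₊₁ forces Rᵢ₊₁ to be stable.  Along this chain choose increasing
-- maximal commutative star subalgebras Tᵢ ⊆ Aᵢ, and decreasing ones Sᵢ in the commutants Aᵢ′;
-- a separating vector bounds their dimensions by n, so among 2n steps there is one where neither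
-- changes.  There the relative commutant of Aᵢ in Aᵢ₊₁ lies in Tᵢ₊₁ = Tᵢ ⊆ Aᵢ and is central in
-- Aᵢ₊₁, and averaging with the Casimir element of Aᵢ then gives Aᵢ = Aᵢ₊₁.
--
-- This needs a decidable colouring, and is then free to use double negation.  In general,
-- iterated refinement is positive in the colouring, so finitely many coincidences of colours
-- suffice for a given coincidence after 2n steps, and these generate a decidable colouring.

open import Defs
open import Algebra.Bundles using (CommutativeMonoid; CommutativeRing)
import Algebra.Properties.CommutativeMonoid.Sum
import Algebra.Properties.Semiring.Sum
open import Algebra.Structures using (IsCommutativeRing)
open import Data.Empty using (⊥-elim)
open import Data.Fin as Fin using (Fin; zero; suc; combine; remQuot; _↑ˡ_; _↑ʳ_)
open import Data.Fin.Permutation as Perm using (Permutation; _⟨$⟩ʳ_)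
import Data.Fin.Properties as Fin
open import Data.List as List using (List)
open import Data.List.Relation.Unary.All as All using (All)
import Data.List.Relation.Unary.All.Properties as All
open import Data.Nat as ℕ using (ℕ; zero; suc)
import Data.Nat.Properties as ℕ
open import Data.Product using (Σ; ∃; _×_; _,_; proj₁; proj₂; uncurry)
import Data.Product.Properties as Product
open import Data.Rational as ℚ using (ℚ; 0ℚ; 1ℚ)
import Data.Rational.Properties as ℚ
open import Data.Rational.Solver using (module +-*-Solver)
open import Data.Sum using (_⊎_; inj₁; inj₂)
open import Data.Unit using (⊤; tt)
open import Data.Vec as Vec using (Vec; []; _∷_; _++_; [_]; lookup; tabulate)
open import Data.Vec.Functional using () renaming (_∷_ to _◂_)
open import Data.Vec.Properties using (lookup∘tabulate; tabulate∘lookup; tabulate-cong)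
open import Function using (_∘_; id)
open import Function.Bundles using (_↔_; Inverse; mk↔ₛ′)
open import Function.Construct.Composition using (_↔-∘_)
open import Function.Construct.Symmetry using (↔-sym)
open import Level using (Level; 0ℓ)
open import Relation.Binary.PropositionalEquality using (_≡_; _≢_; refl; sym; trans; cong; cong₂; subst; subst₂; isEquivalence; module ≡-Reasoning)
open import Relation.Nullary using (¬_; Dec; yes; no)
open import Relation.Nullary.Decidable using (decidable-stable; map′; _×-dec_)

-- Each of the two chains supplies one half of the final step. Let `X` lie in the next algebra and
-- commute with the current one. Where the first chain does not change, `X` already lies in the
-- current algebra; where the second does not change, `X` also commutes with the whole next algebra.
-- Each dimension is at most n and the first one is at least 1 from the start, so a surplus of 1
-- remains that 2n steps without a coincidence cannot absorb. The scalars are rational because the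
-- argument rests on order and decidable equality: sums of squares are positive, orthogonal families
-- stay unnormalised, and invertibility appears as injectivity of a multiplication. Membership in
-- the algebras comes without a decision procedure, so bases and maximal families exist only up to
-- double negation. The facts finally read off, equations in `F` and coincidences of a decidable
-- colouring, are decidable, which removes the negation.

infixl 6 _+_
infixl 7 _*_
infix 4 _≤_ _≟_

-- A sealed copy of ℚ: unification gets stuck when the operations of ℚ unfold.
abstract
  F : Set
  F = ℚ

  0F 1F -1F : F
  0F = 0ℚ
  1F = 1ℚ
  -1F = ℚ.- 1ℚ

  _+_ _*_ : F → F → F
  _+_ = ℚ._+_
  _*_ = ℚ._*_

  -_ inv : F → F
  -_ = ℚ.-_
  inv p with p ℚ.≟ 0ℚ
  ... | yes _ = 0ℚ
  ... | no p≢0 = ℚ.1/_ p {{ℚ.≢-nonZero p≢0}}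

  _≤_ : F → F → Set
  _≤_ = ℚ._≤_

  _≟_ : (p q : F) → Dec (p ≡ q)
  _≟_ = ℚ._≟_

  F-isCommutativeRing : IsCommutativeRing _≡_ _+_ _*_ -_ 0F 1F
  F-isCommutativeRing = CommutativeRing.isCommutativeRing ℚ.+-*-commutativeRing

  1≢0 : 1F ≢ 0F
  1≢0 ()

  inv-* : ∀ {p} → p ≢ 0F → inv p * p ≡ 1F
  inv-* {p} p≢0 with p ℚ.≟ 0ℚ
  ... | yes e = ⊥-elim (p≢0 e)
  ... | no p≢0 = ℚ.*-inverseˡ p {{ℚ.≢-nonZero p≢0}}

  inv-0 : inv 0F ≡ 0F
  inv-0 = refl

  ≤-refl : ∀ {p} → p ≤ p
  ≤-refl = ℚ.≤-refl

  ≤-trans : ∀ {p q r} → p ≤ q → q ≤ r → p ≤ r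
  ≤-trans = ℚ.≤-trans

  ≤-antisym : ∀ {p q} → p ≤ q → q ≤ p → p ≡ q
  ≤-antisym = ℚ.≤-antisym

  +-mono-≤ : ∀ {p q r s} → p ≤ q → r ≤ s → p + r ≤ q + s
  +-mono-≤ = ℚ.+-mono-≤

  *-nonneg : ∀ {p q} → 0F ≤ p → 0F ≤ q → 0F ≤ p * q
  *-nonneg {p} {q} a b = ℚ.nonNegative⁻¹ (p ℚ.* q) {{ℚ.nonNeg*nonNeg⇒nonNeg p {{ℚ.nonNegative a}} q {{ℚ.nonNegative b}}}}

  square-nonneg : ∀ p → 0F ≤ p * p
  square-nonneg p with ℚ.≤-total 0ℚ p
  ... | inj₁ h = *-nonneg h h
  ... | inj₂ h = ℚ.nonNegative⁻¹ (p ℚ.* p) {{ℚ.nonPos*nonPos⇒nonPos p {{ℚ.nonPositive h}} p {{ℚ.nonPositive h}}}}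

  1≰0 : ¬ (1F ≤ 0F)
  1≰0 h = ℚ.<-irrefl refl (ℚ.<-≤-trans (ℚ.positive⁻¹ 1ℚ) h)

  -1*-cancelʳ : ∀ p → p + -1F * p ≡ 0F
  -1*-cancelʳ p = solve 1 (λ a → a :+ con -1F :* a := con 0ℚ) refl p
    where open +-*-Solver

F-commutativeRing : CommutativeRing 0ℓ 0ℓ
F-commutativeRing = record { isCommutativeRing = F-isCommutativeRing }

open IsCommutativeRing F-isCommutativeRing
  using (+-assoc; +-comm; +-identityˡ; +-identityʳ; *-assoc; *-comm; *-identityˡ; *-identityʳ; zeroˡ; zeroʳ)
  renaming (distribˡ to *-distribˡ-+; distribʳ to *-distribʳ-+)

-- Finite sums of scalars

private
  module ΣF = Algebra.Properties.Semiring.Sum (CommutativeRing.semiring F-commutativeRing)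

abstract
  Σꟳ : ∀ {k} → (Fin k → F) → F
  Σꟳ = ΣF.sum

  Σ-nil : (f : Fin 0 → F) → Σꟳ f ≡ 0F
  Σ-nil f = refl

  Σ-suc : ∀ {k} (f : Fin (suc k) → F) → Σꟳ f ≡ f zero + Σꟳ (λ i → f (suc i))
  Σ-suc f = refl

  Σ-cong : ∀ {k} {f g : Fin k → F} → (∀ i → f i ≡ g i) → Σꟳ f ≡ Σꟳ g
  Σ-cong = ΣF.sum-cong-≗

  Σ-swap : ∀ {m k} (f : Fin m → Fin k → F) → Σꟳ (λ i → Σꟳ (λ j → f i j)) ≡ Σꟳ (λ j → Σꟳ (λ i → f i j))
  Σ-swap = ΣF.∑-comm

  Σ-+ : ∀ {k} (f g : Fin k → F) → Σꟳ (λ i → f i + g i) ≡ Σꟳ f + Σꟳ g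
  Σ-+ = ΣF.∑-distrib-+

  *-Σ : ∀ {k} p (f : Fin k → F) → p * Σꟳ f ≡ Σꟳ (λ i → p * f i)
  *-Σ = ΣF.*-distribˡ-sum

  Σ-* : ∀ {k} p (f : Fin k → F) → Σꟳ f * p ≡ Σꟳ (λ i → f i * p)
  Σ-* = ΣF.*-distribʳ-sum

  Σ-punchIn : ∀ {k} (i : Fin (suc k)) (f : Fin (suc k) → F) → Σꟳ f ≡ f i + Σꟳ (λ j → f (Fin.punchIn i j))
  Σ-punchIn i f = ΣF.sum-remove {i = i} f

  Σ-permute : ∀ {k} (f : Fin k → F) (π : Permutation k k) → Σꟳ f ≡ Σꟳ (λ i → f (π ⟨$⟩ʳ i))
  Σ-permute = ΣF.sum-permute

  Σ-zero : ∀ {k} {f : Fin k → F} → (∀ i → f i ≡ 0F) → Σꟳ f ≡ 0F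
  Σ-zero {k} {f} h = trans (ΣF.sum-cong-≗ {k} {f} {λ _ → 0F} h) (ΣF.sum-replicate-zero k)

+-congˡ : ∀ {p q r} → q ≡ r → p + q ≡ p + r
+-congˡ = cong₂ _+_ refl

*-congˡ : ∀ {p q r} → q ≡ r → p * q ≡ p * r
*-congˡ = cong₂ _*_ refl

+-congʳ : ∀ {p q r} → q ≡ r → q + p ≡ r + p
+-congʳ e = cong₂ _+_ e refl

*-congʳ : ∀ {p q r} → q ≡ r → q * p ≡ r * p
*-congʳ e = cong₂ _*_ e refl

Σ-mono : ∀ {k} {f g : Fin k → F} → (∀ i → f i ≤ g i) → Σꟳ f ≤ Σꟳ g
Σ-mono {zero}  h = subst₂ _≤_ (sym (Σ-nil _)) (sym (Σ-nil _)) ≤-refl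
Σ-mono {suc k} h = subst₂ _≤_ (sym (Σ-suc _)) (sym (Σ-suc _)) (+-mono-≤ (h zero) (Σ-mono (h ∘ suc)))

Σ-nonneg : ∀ {k} {f : Fin k → F} → (∀ i → 0F ≤ f i) → 0F ≤ Σꟳ f
Σ-nonneg {k} {f} h = subst (_≤ Σꟳ f) (Σ-zero {k} λ _ → refl) (Σ-mono h)

+≡0⇒≡0 : ∀ {p q} → 0F ≤ p → 0F ≤ q → p + q ≡ 0F → p ≡ 0F
+≡0⇒≡0 {p} {q} 0≤p 0≤q e = ≤-antisym
  (subst (p ≤_) e (subst (_≤ p + q) (+-identityʳ p) (+-mono-≤ ≤-refl 0≤q))) 0≤p

Σ≡0⇒≡0 : ∀ {k} {f : Fin k → F} → (∀ i → 0F ≤ f i) → Σꟳ f ≡ 0F → ∀ i → f i ≡ 0F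
Σ≡0⇒≡0 {suc k} h e zero = +≡0⇒≡0 (h zero) (Σ-nonneg (h ∘ suc)) (trans (sym (Σ-suc _)) e)
Σ≡0⇒≡0 {suc k} {f} h e (suc i) =
  Σ≡0⇒≡0 (h ∘ suc) (+≡0⇒≡0 (Σ-nonneg (h ∘ suc)) (h zero) (trans (+-comm _ (f zero)) (trans (sym (Σ-suc f)) e))) i

Σ-↑ : ∀ m {k} (f : Fin (m ℕ.+ k) → F) → Σꟳ f ≡ Σꟳ (λ i → f (i ↑ˡ k)) + Σꟳ (λ j → f (m ↑ʳ j))
Σ-↑ zero f = sym (trans (+-congʳ (Σ-nil _)) (+-identityˡ _))
Σ-↑ (suc m) {k} f = begin
  Σꟳ f ≡⟨ Σ-suc f ⟩
  f zero + Σꟳ (f ∘ suc) ≡⟨ +-congˡ (Σ-↑ m (f ∘ suc)) ⟩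
  f zero + (Σꟳ (λ i → f (suc (i ↑ˡ k))) + Σꟳ (λ j → f (suc (m ↑ʳ j)))) ≡⟨ +-assoc _ _ _ ⟨
  f zero + Σꟳ (λ i → f (suc (i ↑ˡ k))) + Σꟳ (λ j → f (suc (m ↑ʳ j))) ≡⟨ +-congʳ (Σ-suc (λ i → f (i ↑ˡ k))) ⟨
  Σꟳ (λ i → f (i ↑ˡ k)) + Σꟳ (λ j → f (suc m ↑ʳ j)) ∎
  where open ≡-Reasoning

Σ-combine : ∀ m {k} (f : Fin (m ℕ.* k) → F) → Σꟳ f ≡ Σꟳ (λ i → Σꟳ (λ j → f (combine {m} {k} i j)))
Σ-combine zero f = trans (Σ-nil f) (sym (Σ-nil _))
Σ-combine (suc m) {k} f = trans (Σ-↑ k f) (trans (+-congˡ (Σ-combine m (λ j → f (k ↑ʳ j)))) (sym (Σ-suc _)))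

*-cancelˡ-0 : ∀ {p q} → p ≢ 0F → p * q ≡ 0F → q ≡ 0F
*-cancelˡ-0 {p} {q} p≢0 e = begin
  q ≡⟨ sym (*-identityˡ q) ⟩
  1F * q ≡⟨ cong (_* q) (sym (inv-* p≢0)) ⟩
  inv p * p * q ≡⟨ *-assoc (inv p) p q ⟩
  inv p * (p * q) ≡⟨ cong (inv p *_) e ⟩
  inv p * 0F ≡⟨ zeroʳ (inv p) ⟩
  0F ∎
  where open ≡-Reasoning

square≡0⇒≡0 : ∀ {p} → p * p ≡ 0F → p ≡ 0F
square≡0⇒≡0 {p} e with p ≟ 0F
... | yes h = h
... | no h = *-cancelˡ-0 h e

inv-nonneg : ∀ {p} → 0F ≤ p → 0F ≤ inv p
inv-nonneg {p} 0≤p with p ≟ 0F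
... | yes refl = subst (0F ≤_) (sym inv-0) ≤-refl
... | no p≢0 = subst (0F ≤_) e (*-nonneg (square-nonneg (inv p)) 0≤p)
  where
  e : inv p * inv p * p ≡ inv p
  e = trans (*-assoc (inv p) (inv p) p) (trans (cong (inv p *_) (inv-* p≢0)) (*-identityʳ (inv p)))

inv≢0 : ∀ {p} → p ≢ 0F → inv p ≢ 0F
inv≢0 {p} p≢0 e = 1≢0 (trans (sym (inv-* p≢0)) (trans (cong (_* p) e) (zeroˡ p)))

-1*-cancelˡ : ∀ p → -1F * p + p ≡ 0F
-1*-cancelˡ p = trans (+-comm _ p) (-1*-cancelʳ p)

-1-cancel : ∀ p → -1F + (1F + p) ≡ p
-1-cancel p = trans (sym (+-assoc -1F 1F p)) (trans (cong (_+ p)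
  (trans (cong (_+ 1F) (sym (*-identityʳ -1F))) (-1*-cancelˡ 1F))) (+-identityˡ p))

-- Dimensions are compared as sums of ones in `F`; this brings the comparison back to natural
-- numbers.
Σ1-cancel-≤ : ∀ k l → Σꟳ {k} (λ _ → 1F) ≤ Σꟳ {l} (λ _ → 1F) → k ℕ.≤ l
Σ1-cancel-≤ zero l h = ℕ.z≤n
Σ1-cancel-≤ (suc k) (suc l) h = ℕ.s≤s (Σ1-cancel-≤ k l (subst₂ _≤_ (-1-cancel _) (-1-cancel _)
  (+-mono-≤ ≤-refl (subst₂ _≤_ (Σ-suc _) (Σ-suc _) h))))
Σ1-cancel-≤ (suc k) zero h = ⊥-elim (1≰0 (≤-trans
  (subst (_≤ 1F + Σꟳ {k} (λ _ → 1F)) (+-identityʳ 1F) (+-mono-≤ ≤-refl (Σ-nonneg {k} (λ _ → 0≤1))))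
  (subst₂ _≤_ (Σ-suc _) (Σ-nil _) h)))
  where
  0≤1 : 0F ≤ 1F
  0≤1 = subst (0F ≤_) (*-identityˡ 1F) (square-nonneg 1F)

-- Rational vectors and their inner product

infixl 9 _!_
infixl 6 _⊕_ _⊖_
infixr 8 _∙_

abstract
  E : ℕ → Set
  E = Vec F

  _!_ : ∀ {N} → E N → Fin N → F
  _!_ = lookup

  mk : ∀ {N} → (Fin N → F) → E N
  mk = tabulate

  mk-! : ∀ {N} (f : Fin N → F) i → mk f ! i ≡ f i
  mk-! = lookup∘tabulate

  ext : ∀ {N} {x y : E N} → (∀ i → x ! i ≡ y ! i) → x ≡ y
  ext {x = x} {y} h = trans (sym (tabulate∘lookup x)) (trans (tabulate-cong h) (tabulate∘lookup y))

  0ᴱ : ∀ {N} → E N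
  0ᴱ = mk (λ _ → 0F)

  _⊕_ : ∀ {N} → E N → E N → E N
  x ⊕ y = mk (λ i → x ! i + y ! i)

  _∙_ : ∀ {N} → F → E N → E N
  c ∙ x = mk (λ i → c * x ! i)

  ⟨_,_⟩ : ∀ {N} → E N → E N → F
  ⟨ x , y ⟩ = Σꟳ (λ i → x ! i * y ! i)

  0-! : ∀ {N} (i : Fin N) → 0ᴱ ! i ≡ 0F
  0-! = mk-! _

  ⊕-! : ∀ {N} (x y : E N) i → (x ⊕ y) ! i ≡ x ! i + y ! i
  ⊕-! x y = mk-! _

  ∙-! : ∀ {N} c (x : E N) i → (c ∙ x) ! i ≡ c * x ! i
  ∙-! c x = mk-! _

  ⟨⟩-Σ : ∀ {N} (x y : E N) → ⟨ x , y ⟩ ≡ Σꟳ (λ i → x ! i * y ! i)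
  ⟨⟩-Σ x y = refl

_⊖_ : ∀ {N} → E N → E N → E N
x ⊖ y = x ⊕ -1F ∙ y

module _ {N : ℕ} where
  ⊕-assoc : (x y z : E N) → (x ⊕ y) ⊕ z ≡ x ⊕ (y ⊕ z)
  ⊕-assoc x y z = ext λ i → begin
    ((x ⊕ y) ⊕ z) ! i ≡⟨ ⊕-! _ _ i ⟩
    (x ⊕ y) ! i + z ! i ≡⟨ +-congʳ (⊕-! _ _ i) ⟩
    x ! i + y ! i + z ! i ≡⟨ +-assoc (x ! i) _ _ ⟩
    x ! i + (y ! i + z ! i) ≡⟨ +-congˡ (⊕-! _ _ i) ⟨
    x ! i + (y ⊕ z) ! i ≡⟨ ⊕-! _ _ i ⟨
    (x ⊕ (y ⊕ z)) ! i ∎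
    where open ≡-Reasoning

  ⊕-comm : (x y : E N) → x ⊕ y ≡ y ⊕ x
  ⊕-comm x y = ext λ i → trans (⊕-! _ _ i) (trans (+-comm (x ! i) _) (sym (⊕-! _ _ i)))

  ⊕-identityˡ : (x : E N) → 0ᴱ ⊕ x ≡ x
  ⊕-identityˡ x = ext λ i → trans (⊕-! _ _ i) (trans (+-congʳ (0-! i)) (+-identityˡ _))

  ⊕-identityʳ : (x : E N) → x ⊕ 0ᴱ ≡ x
  ⊕-identityʳ x = trans (⊕-comm x 0ᴱ) (⊕-identityˡ x)

  ⊕-commutativeMonoid : CommutativeMonoid 0ℓ 0ℓ
  ⊕-commutativeMonoid = record
    { Carrier = E N ; _≈_ = _≡_ ; _∙_ = _⊕_ ; ε = 0ᴱ
    ; isCommutativeMonoid = record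
      { isMonoid = record
        { isSemigroup = record
          { isMagma = record { isEquivalence = isEquivalence ; ∙-cong = cong₂ _⊕_ }
          ; assoc = ⊕-assoc }
        ; identity = ⊕-identityˡ , ⊕-identityʳ }
      ; comm = ⊕-comm } }

  private
    module ΣE = Algebra.Properties.CommutativeMonoid.Sum ⊕-commutativeMonoid

  abstract
    Σᴱ : ∀ {k} → (Fin k → E N) → E N
    Σᴱ = ΣE.sum

    Σᴱ-nil : (f : Fin 0 → E N) → Σᴱ f ≡ 0ᴱ
    Σᴱ-nil f = refl

    Σᴱ-suc : ∀ {k} (f : Fin (suc k) → E N) → Σᴱ f ≡ f zero ⊕ Σᴱ (λ i → f (suc i))
    Σᴱ-suc f = refl

    Σᴱ-cong : ∀ {k} {f g : Fin k → E N} → (∀ i → f i ≡ g i) → Σᴱ f ≡ Σᴱ g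
    Σᴱ-cong = ΣE.sum-cong-≗

    Σᴱ-swap : ∀ {m k} (f : Fin m → Fin k → E N) → Σᴱ (λ i → Σᴱ (λ j → f i j)) ≡ Σᴱ (λ j → Σᴱ (λ i → f i j))
    Σᴱ-swap = ΣE.∑-comm

    Σᴱ-zero : ∀ {k} {f : Fin k → E N} → (∀ i → f i ≡ 0ᴱ) → Σᴱ f ≡ 0ᴱ
    Σᴱ-zero {k} {f} h = trans (ΣE.sum-cong-≗ {k} {f} {λ _ → 0ᴱ} h) (ΣE.sum-replicate-zero k)

  ∙-distribˡ : ∀ c (x y : E N) → c ∙ (x ⊕ y) ≡ c ∙ x ⊕ c ∙ y
  ∙-distribˡ c x y = ext λ i → begin
    (c ∙ (x ⊕ y)) ! i ≡⟨ ∙-! _ _ i ⟩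
    c * (x ⊕ y) ! i ≡⟨ *-congˡ (⊕-! _ _ i) ⟩
    c * (x ! i + y ! i) ≡⟨ *-distribˡ-+ c _ _ ⟩
    c * x ! i + c * y ! i ≡⟨ cong₂ _+_ (∙-! _ _ i) (∙-! _ _ i) ⟨
    (c ∙ x) ! i + (c ∙ y) ! i ≡⟨ ⊕-! _ _ i ⟨
    (c ∙ x ⊕ c ∙ y) ! i ∎
    where open ≡-Reasoning

  ∙-zeroˡ : (x : E N) → 0F ∙ x ≡ 0ᴱ
  ∙-zeroˡ x = ext λ i → trans (∙-! _ _ i) (trans (zeroˡ (x ! i)) (sym (0-! i)))

  ∙-zeroʳ : ∀ c → c ∙ 0ᴱ {N} ≡ 0ᴱ
  ∙-zeroʳ c = ext λ i → trans (∙-! _ _ i) (trans (*-congˡ (0-! i)) (trans (zeroʳ c) (sym (0-! i))))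

  ∙-assoc : ∀ c d (x : E N) → c ∙ d ∙ x ≡ (c * d) ∙ x
  ∙-assoc c d x = ext λ i → begin
    (c ∙ d ∙ x) ! i ≡⟨ ∙-! _ _ i ⟩
    c * (d ∙ x) ! i ≡⟨ *-congˡ (∙-! _ _ i) ⟩
    c * (d * x ! i) ≡⟨ *-assoc c d _ ⟨
    c * d * x ! i ≡⟨ ∙-! _ _ i ⟨
    ((c * d) ∙ x) ! i ∎
    where open ≡-Reasoning

  ⊖-! : (x y : E N) → ∀ i → (x ⊖ y) ! i ≡ x ! i + -1F * y ! i
  ⊖-! x y i = trans (⊕-! x _ i) (+-congˡ (∙-! _ _ i))

  ⊖-self : (x : E N) → x ⊖ x ≡ 0ᴱ
  ⊖-self x = ext λ i → trans (⊖-! x x i) (trans (-1*-cancelʳ _) (sym (0-! i)))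

  ⊖-⊕ : (x y : E N) → (x ⊖ y) ⊕ y ≡ x
  ⊖-⊕ x y = ext λ i → begin
    ((x ⊖ y) ⊕ y) ! i ≡⟨ ⊕-! _ _ i ⟩
    (x ⊖ y) ! i + y ! i ≡⟨ +-congʳ (⊖-! x y i) ⟩
    x ! i + -1F * y ! i + y ! i ≡⟨ +-assoc _ _ _ ⟩
    x ! i + (-1F * y ! i + y ! i) ≡⟨ +-congˡ (-1*-cancelˡ (y ! i)) ⟩
    x ! i + 0F ≡⟨ +-identityʳ _ ⟩
    x ! i ∎
    where open ≡-Reasoning

  ⊖≡0⇒≡ : {x y : E N} → x ⊖ y ≡ 0ᴱ → x ≡ y
  ⊖≡0⇒≡ {x} {y} e = trans (sym (⊖-⊕ x y)) (trans (cong (_⊕ y) e) (⊕-identityˡ y))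

  ⟨⟩-comm : (x y : E N) → ⟨ x , y ⟩ ≡ ⟨ y , x ⟩
  ⟨⟩-comm x y = trans (⟨⟩-Σ x y) (trans (Σ-cong λ i → *-comm (x ! i) (y ! i)) (sym (⟨⟩-Σ y x)))

  ⟨⟩-⊕ˡ : (x y z : E N) → ⟨ x ⊕ y , z ⟩ ≡ ⟨ x , z ⟩ + ⟨ y , z ⟩
  ⟨⟩-⊕ˡ x y z = begin
    ⟨ x ⊕ y , z ⟩ ≡⟨ ⟨⟩-Σ _ _ ⟩
    Σꟳ (λ i → (x ⊕ y) ! i * z ! i) ≡⟨ (Σ-cong λ i → trans (*-congʳ (⊕-! x y i)) (*-distribʳ-+ (z ! i) (x ! i) (y ! i))) ⟩
    Σꟳ (λ i → x ! i * z ! i + y ! i * z ! i) ≡⟨ Σ-+ (λ i → x ! i * z ! i) (λ i → y ! i * z ! i) ⟩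
    Σꟳ (λ i → x ! i * z ! i) + Σꟳ (λ i → y ! i * z ! i) ≡⟨ cong₂ _+_ (⟨⟩-Σ _ _) (⟨⟩-Σ _ _) ⟨
    ⟨ x , z ⟩ + ⟨ y , z ⟩ ∎
    where open ≡-Reasoning

  ⟨⟩-∙ˡ : ∀ c (x y : E N) → ⟨ c ∙ x , y ⟩ ≡ c * ⟨ x , y ⟩
  ⟨⟩-∙ˡ c x y = begin
    ⟨ c ∙ x , y ⟩ ≡⟨ ⟨⟩-Σ _ _ ⟩
    Σꟳ (λ i → (c ∙ x) ! i * y ! i) ≡⟨ (Σ-cong λ i → trans (*-congʳ (∙-! c x i)) (*-assoc c (x ! i) (y ! i))) ⟩
    Σꟳ (λ i → c * (x ! i * y ! i)) ≡⟨ *-Σ c (λ i → x ! i * y ! i) ⟨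
    c * Σꟳ (λ i → x ! i * y ! i) ≡⟨ *-congˡ (⟨⟩-Σ _ _) ⟨
    c * ⟨ x , y ⟩ ∎
    where open ≡-Reasoning

  ⟨⟩-⊕ʳ : (x y z : E N) → ⟨ x , y ⊕ z ⟩ ≡ ⟨ x , y ⟩ + ⟨ x , z ⟩
  ⟨⟩-⊕ʳ x y z = trans (⟨⟩-comm x _) (trans (⟨⟩-⊕ˡ y z x) (cong₂ _+_ (⟨⟩-comm y x) (⟨⟩-comm z x)))

  ⟨⟩-∙ʳ : ∀ c (x y : E N) → ⟨ x , c ∙ y ⟩ ≡ c * ⟨ x , y ⟩
  ⟨⟩-∙ʳ c x y = trans (⟨⟩-comm x _) (trans (⟨⟩-∙ˡ c y x) (cong (c *_) (⟨⟩-comm y x)))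

  ⟨⟩-0ˡ : (x : E N) → ⟨ 0ᴱ , x ⟩ ≡ 0F
  ⟨⟩-0ˡ x = trans (⟨⟩-Σ _ _) (Σ-zero λ i → trans (*-congʳ (0-! i)) (zeroˡ _))

  ⟨⟩-0ʳ : (x : E N) → ⟨ x , 0ᴱ ⟩ ≡ 0F
  ⟨⟩-0ʳ x = trans (⟨⟩-comm x 0ᴱ) (⟨⟩-0ˡ x)

  ⟨⟩-nonneg : (x : E N) → 0F ≤ ⟨ x , x ⟩
  ⟨⟩-nonneg x = subst (0F ≤_) (sym (⟨⟩-Σ x x)) (Σ-nonneg λ i → square-nonneg (x ! i))

  ⟨⟩≡0⇒≡0 : {x : E N} → ⟨ x , x ⟩ ≡ 0F → x ≡ 0ᴱ
  ⟨⟩≡0⇒≡0 {x} e = ext λ i → trans (square≡0⇒≡0 (Σ≡0⇒≡0 (λ i → square-nonneg (x ! i)) (trans (sym (⟨⟩-Σ x x)) e) i)) (sym (0-! i))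

  ⟨⟩-Σˡ : ∀ {k} (f : Fin k → E N) y → ⟨ Σᴱ f , y ⟩ ≡ Σꟳ (λ i → ⟨ f i , y ⟩)
  ⟨⟩-Σˡ {zero} f y = trans (cong (λ z → ⟨ z , y ⟩) (Σᴱ-nil f)) (trans (⟨⟩-0ˡ y) (sym (Σ-nil _)))
  ⟨⟩-Σˡ {suc k} f y = begin
    ⟨ Σᴱ f , y ⟩ ≡⟨ cong (λ z → ⟨ z , y ⟩) (Σᴱ-suc f) ⟩
    ⟨ f zero ⊕ Σᴱ (f ∘ suc) , y ⟩ ≡⟨ ⟨⟩-⊕ˡ _ _ y ⟩
    ⟨ f zero , y ⟩ + ⟨ Σᴱ (f ∘ suc) , y ⟩ ≡⟨ +-congˡ (⟨⟩-Σˡ (f ∘ suc) y) ⟩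
    ⟨ f zero , y ⟩ + Σꟳ (λ i → ⟨ f (suc i) , y ⟩) ≡⟨ Σ-suc _ ⟨
    Σꟳ (λ i → ⟨ f i , y ⟩) ∎
    where open ≡-Reasoning

  ⟨⟩-Σʳ : ∀ {k} x (f : Fin k → E N) → ⟨ x , Σᴱ f ⟩ ≡ Σꟳ (λ i → ⟨ x , f i ⟩)
  ⟨⟩-Σʳ x f = trans (⟨⟩-comm x _) (trans (⟨⟩-Σˡ f x) (Σ-cong λ i → ⟨⟩-comm (f i) x))

additive-Σ : ∀ {M N k} (L : E M → E N) → L 0ᴱ ≡ 0ᴱ → (∀ x y → L (x ⊕ y) ≡ L x ⊕ L y) →
  (f : Fin k → E M) → L (Σᴱ f) ≡ Σᴱ (λ i → L (f i))
additive-Σ {k = zero}  L L0 L+ f = trans (cong L (Σᴱ-nil f)) (trans L0 (sym (Σᴱ-nil _)))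
additive-Σ {k = suc k} L L0 L+ f = begin
  L (Σᴱ f) ≡⟨ cong L (Σᴱ-suc f) ⟩
  L (f zero ⊕ Σᴱ (f ∘ suc)) ≡⟨ L+ _ _ ⟩
  L (f zero) ⊕ L (Σᴱ (f ∘ suc)) ≡⟨ cong (L (f zero) ⊕_) (additive-Σ L L0 L+ (f ∘ suc)) ⟩
  L (f zero) ⊕ Σᴱ (λ i → L (f (suc i))) ≡⟨ Σᴱ-suc _ ⟨
  Σᴱ (λ i → L (f i)) ∎
  where open ≡-Reasoning

-- Orthogonal families and bases

private variable
  ℓ : Level
  N : ℕ

infixl 1 _>>=_
_>>=_ : ∀ {a b} {A : Set a} {B : Set b} → ¬ ¬ A → (A → ¬ ¬ B) → ¬ ¬ B
(m >>= f) k = m λ a → f a k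

return : ∀ {a} {A : Set a} → A → ¬ ¬ A
return a k = k a

Family : ℕ → ℕ → Set
Family N k = Fin k → E N

record IsOrthogonal {N k} (c : Family N k) : Set where
  field
    orthogonal : ∀ i j → i ≢ j → ⟨ c i , c j ⟩ ≡ 0F
    nonzero : ∀ i → ⟨ c i , c i ⟩ ≢ 0F
open IsOrthogonal

-- Normalising would take square roots, so families stay merely orthogonal and every projection
-- carries this factor. At the zero vector the totalised `inv` yields 0, which is still nonnegative.
norm⁻¹ : E N → F
norm⁻¹ x = inv ⟨ x , x ⟩

norm⁻¹-nonneg : (x : E N) → 0F ≤ norm⁻¹ x
norm⁻¹-nonneg x = inv-nonneg (⟨⟩-nonneg x)

Σ-single : ∀ {k} (f : Fin k → F) i → (∀ j → j ≢ i → f j ≡ 0F) → Σꟳ f ≡ f i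
Σ-single {suc k} f i h = trans (Σ-punchIn i f) (trans (+-congˡ (Σ-zero λ j → h _ (Fin.punchInᵢ≢i i j))) (+-identityʳ _))

proj : ∀ {k} → Family N k → E N → E N
proj c x = Σᴱ λ i → (norm⁻¹ (c i) * ⟨ x , c i ⟩) ∙ c i

⟨⟩-projˡ : ∀ {k} (c : Family N k) x y → ⟨ proj c x , y ⟩ ≡ Σꟳ (λ i → norm⁻¹ (c i) * ⟨ x , c i ⟩ * ⟨ c i , y ⟩)
⟨⟩-projˡ c x y = trans (⟨⟩-Σˡ _ y) (Σ-cong λ i → ⟨⟩-∙ˡ _ (c i) y)

module _ {k} {c : Family N k} (o : IsOrthogonal c) where
  ⟨⟩-proj : ∀ x j → ⟨ proj c x , c j ⟩ ≡ ⟨ x , c j ⟩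
  ⟨⟩-proj x j = begin
    ⟨ proj c x , c j ⟩ ≡⟨ ⟨⟩-projˡ c x (c j) ⟩
    Σꟳ (λ i → norm⁻¹ (c i) * ⟨ x , c i ⟩ * ⟨ c i , c j ⟩)
      ≡⟨ Σ-single _ j (λ i i≢j → trans (*-congˡ (orthogonal o i j i≢j)) (zeroʳ _)) ⟩
    norm⁻¹ (c j) * ⟨ x , c j ⟩ * ⟨ c j , c j ⟩ ≡⟨ *-congʳ (*-comm _ _) ⟩
    ⟨ x , c j ⟩ * norm⁻¹ (c j) * ⟨ c j , c j ⟩ ≡⟨ *-assoc _ _ _ ⟩
    ⟨ x , c j ⟩ * (norm⁻¹ (c j) * ⟨ c j , c j ⟩) ≡⟨ *-congˡ (inv-* (nonzero o j)) ⟩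
    ⟨ x , c j ⟩ * 1F ≡⟨ *-identityʳ _ ⟩
    ⟨ x , c j ⟩ ∎
    where open ≡-Reasoning

  ⟨⟩-⊖-proj : ∀ x j → ⟨ x ⊖ proj c x , c j ⟩ ≡ 0F
  ⟨⟩-⊖-proj x j = begin
    ⟨ x ⊖ proj c x , c j ⟩ ≡⟨ ⟨⟩-⊕ˡ _ _ _ ⟩
    ⟨ x , c j ⟩ + ⟨ -1F ∙ proj c x , c j ⟩ ≡⟨ +-congˡ (trans (⟨⟩-∙ˡ _ _ _) (*-congˡ (⟨⟩-proj x j))) ⟩
    ⟨ x , c j ⟩ + -1F * ⟨ x , c j ⟩ ≡⟨ -1*-cancelʳ _ ⟩
    0F ∎
    where open ≡-Reasoning

⊥-proj : ∀ {k} (c : Family N k) x y → (∀ j → ⟨ y , c j ⟩ ≡ 0F) → ⟨ proj c x , y ⟩ ≡ 0F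
⊥-proj c x y h = trans (⟨⟩-projˡ c x y) (Σ-zero λ i → trans (*-congˡ (trans (⟨⟩-comm _ y) (h i))) (zeroʳ _))

-- Pythagoras: `x` is its projection plus a residual orthogonal to it, and the squared norm of the
-- residual is dropped.
bessel : ∀ {k} {c : Family N k} → IsOrthogonal c → ∀ x → ⟨ proj c x , x ⟩ ≤ ⟨ x , x ⟩
bessel {c = c} o x = subst₂ _≤_ (+-identityʳ _) (sym split) (+-mono-≤ ≤-refl (⟨⟩-nonneg r))
  where
  open ≡-Reasoning
  p = proj c x
  r = x ⊖ p
  split : ⟨ x , x ⟩ ≡ ⟨ p , x ⟩ + ⟨ r , r ⟩
  split = begin
    ⟨ x , x ⟩ ≡⟨ cong (λ z → ⟨ z , x ⟩) (trans (sym (⊖-⊕ x p)) (⊕-comm r p)) ⟩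
    ⟨ p ⊕ r , x ⟩ ≡⟨ ⟨⟩-⊕ˡ _ _ _ ⟩
    ⟨ p , x ⟩ + ⟨ r , x ⟩ ≡⟨ +-congˡ (cong (λ z → ⟨ r , z ⟩) (⊖-⊕ x p)) ⟨
    ⟨ p , x ⟩ + ⟨ r , r ⊕ p ⟩ ≡⟨ +-congˡ (⟨⟩-⊕ʳ r r p) ⟩
    ⟨ p , x ⟩ + (⟨ r , r ⟩ + ⟨ r , p ⟩) ≡⟨ +-congˡ (+-congˡ (trans (⟨⟩-comm r p) (⊥-proj c x r (⟨⟩-⊖-proj o x)))) ⟩
    ⟨ p , x ⟩ + (⟨ r , r ⟩ + 0F) ≡⟨ +-congˡ (+-identityʳ _) ⟩
    ⟨ p , x ⟩ + ⟨ r , r ⟩ ∎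

interchange : ∀ a b x → a * (b * x * x) ≡ b * (a * x * x)
interchange a b x = begin
  a * (b * x * x) ≡⟨ *-assoc a (b * x) x ⟨
  a * (b * x) * x ≡⟨ *-congʳ (trans (sym (*-assoc a b x)) (trans (*-congʳ (*-comm a b)) (*-assoc b a x))) ⟩
  b * (a * x) * x ≡⟨ *-assoc b (a * x) x ⟩
  b * (a * x * x) ∎
  where open ≡-Reasoning

*-monoˡ-≤ : ∀ {p q r} → 0F ≤ p → q ≤ r → p * q ≤ p * r
*-monoˡ-≤ {p} {q} {r} 0≤p q≤r = subst₂ _≤_ (+-identityˡ _) e (+-mono-≤ (*-nonneg 0≤p 0≤r-q) (≤-refl {p * q}))
  where
  open ≡-Reasoning
  0≤r-q : 0F ≤ r + -1F * q
  0≤r-q = subst (_≤ r + -1F * q) (-1*-cancelʳ q) (+-mono-≤ q≤r ≤-refl)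
  e : p * (r + -1F * q) + p * q ≡ p * r
  e = begin
    p * (r + -1F * q) + p * q ≡⟨ *-distribˡ-+ p _ q ⟨
    p * (r + -1F * q + q) ≡⟨ *-congˡ (trans (+-assoc r _ q) (trans (+-congˡ (-1*-cancelˡ q)) (+-identityʳ r))) ⟩
    p * r ∎

-- Count b by Σᵢⱼ ⟨bᵢ,cⱼ⟩² / (|bᵢ|²|cⱼ|²): summing over j first gives k by Parseval, summing over i first at most l by Bessel.
orthogonal-≤ : ∀ {k l} {b : Family N k} {c : Family N l} → IsOrthogonal b → IsOrthogonal c →
  (∀ i → b i ≡ proj c (b i)) → k ℕ.≤ l
orthogonal-≤ {k = k} {l} {b} {c} ob oc h = Σ1-cancel-≤ k l (subst (_≤ Σꟳ {l} (λ _ → 1F)) (sym count) (Σ-mono bound))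
  where
  open ≡-Reasoning
  term : Fin k → Fin l → F
  term i j = norm⁻¹ (b i) * (norm⁻¹ (c j) * ⟨ b i , c j ⟩ * ⟨ b i , c j ⟩)
  row : ∀ i → 1F ≡ Σꟳ (term i)
  row i = begin
    1F ≡⟨ inv-* (nonzero ob i) ⟨
    norm⁻¹ (b i) * ⟨ b i , b i ⟩ ≡⟨ *-congˡ (cong (λ z → ⟨ z , b i ⟩) (h i)) ⟩
    norm⁻¹ (b i) * ⟨ proj c (b i) , b i ⟩ ≡⟨ *-congˡ (⟨⟩-projˡ c (b i) (b i)) ⟩
    norm⁻¹ (b i) * Σꟳ (λ j → norm⁻¹ (c j) * ⟨ b i , c j ⟩ * ⟨ c j , b i ⟩) ≡⟨ *-Σ _ _ ⟩
    Σꟳ (λ j → norm⁻¹ (b i) * (norm⁻¹ (c j) * ⟨ b i , c j ⟩ * ⟨ c j , b i ⟩))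
      ≡⟨ (Σ-cong λ j → *-congˡ (*-congˡ (⟨⟩-comm (c j) (b i)))) ⟩
    Σꟳ (term i) ∎
  col : ∀ j → Σꟳ (λ i → term i j) ≡ norm⁻¹ (c j) * ⟨ proj b (c j) , c j ⟩
  col j = begin
    Σꟳ (λ i → term i j) ≡⟨ (Σ-cong λ i → trans (interchange _ _ _) (*-congˡ (*-congʳ (*-congˡ (⟨⟩-comm (b i) (c j)))))) ⟩
    Σꟳ (λ i → norm⁻¹ (c j) * (norm⁻¹ (b i) * ⟨ c j , b i ⟩ * ⟨ b i , c j ⟩)) ≡⟨ *-Σ _ _ ⟨
    norm⁻¹ (c j) * Σꟳ (λ i → norm⁻¹ (b i) * ⟨ c j , b i ⟩ * ⟨ b i , c j ⟩) ≡⟨ *-congˡ (⟨⟩-projˡ b (c j) (c j)) ⟨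
    norm⁻¹ (c j) * ⟨ proj b (c j) , c j ⟩ ∎
  count : Σꟳ {k} (λ _ → 1F) ≡ Σꟳ (λ j → norm⁻¹ (c j) * ⟨ proj b (c j) , c j ⟩)
  count = trans (Σ-cong row) (trans (Σ-swap term) (Σ-cong col))
  bound : ∀ j → norm⁻¹ (c j) * ⟨ proj b (c j) , c j ⟩ ≤ 1F
  bound j = subst (norm⁻¹ (c j) * ⟨ proj b (c j) , c j ⟩ ≤_) (inv-* (nonzero oc j))
    (*-monoˡ-≤ (norm⁻¹-nonneg (c j)) (bessel ob (c j)))

δ : ∀ {k} → Fin k → Fin k → F
δ i j with i Fin.≟ j
... | yes _ = 1F
... | no _ = 0F

δ-refl : ∀ {k} (i : Fin k) → δ i i ≡ 1F
δ-refl i with i Fin.≟ i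
... | yes _ = refl
... | no i≢i = ⊥-elim (i≢i refl)

δ-≢ : ∀ {k} {i j : Fin k} → i ≢ j → δ i j ≡ 0F
δ-≢ {i = i} {j} h with i Fin.≟ j
... | yes e = ⊥-elim (h e)
... | no _ = refl

unit : Fin N → E N
unit i = mk (δ i)

⟨⟩-unit : (x : E N) → ∀ i → ⟨ x , unit i ⟩ ≡ x ! i
⟨⟩-unit x i = begin
  ⟨ x , unit i ⟩ ≡⟨ ⟨⟩-Σ _ _ ⟩
  Σꟳ (λ j → x ! j * unit i ! j) ≡⟨ (Σ-cong λ j → *-congˡ (mk-! (δ i) j)) ⟩
  Σꟳ (λ j → x ! j * δ i j) ≡⟨ Σ-single _ i (λ j j≢i → trans (*-congˡ (δ-≢ (j≢i ∘ sym))) (zeroʳ _)) ⟩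
  x ! i * δ i i ≡⟨ *-congˡ (δ-refl i) ⟩
  x ! i * 1F ≡⟨ *-identityʳ _ ⟩
  x ! i ∎
  where open ≡-Reasoning

⟨unit⟩ : (i j : Fin N) → ⟨ unit i , unit j ⟩ ≡ δ i j
⟨unit⟩ i j = trans (⟨⟩-unit (unit i) j) (mk-! (δ i) j)

unit-orthogonal : IsOrthogonal (unit {N})
unit-orthogonal = record
  { orthogonal = λ i j i≢j → trans (⟨unit⟩ i j) (δ-≢ i≢j)
  ; nonzero = λ i e → 1≢0 (trans (sym (δ-refl i)) (trans (sym (⟨unit⟩ i i)) e)) }

⟨⟩-ext : {x y : E N} → (∀ i → ⟨ x , unit i ⟩ ≡ ⟨ y , unit i ⟩) → x ≡ y
⟨⟩-ext {x = x} {y} h = ext λ i → trans (sym (⟨⟩-unit x i)) (trans (h i) (⟨⟩-unit y i))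

orthogonal-≤N : ∀ {k} {b : Family N k} → IsOrthogonal b → k ℕ.≤ N
orthogonal-≤N {b = b} o = orthogonal-≤ o unit-orthogonal (λ i → ⟨⟩-ext (λ j → sym (⟨⟩-proj unit-orthogonal (b i) j)))

Maximal : (ℕ → Set ℓ) → ℕ → Set ℓ
Maximal P k = P k × ¬ P (suc k)

-- `P` need not be decidable, so the search runs under double negation: maximality at `k` can only
-- be refuted by `P (suc k)`, from which the search goes on. The fuel `f` is the room left up to the
-- bound.
maximal : (P : ℕ → Set ℓ) → ∀ {B} → (∀ k → P k → k ℕ.≤ B) → ∀ {k} → P k → ¬ ¬ ∃ (Maximal P)
maximal P {B} bound {k} p = go (suc B) k p (ℕ.m≤n+m (suc B) k)
  where
  go : ∀ f k → P k → suc B ℕ.≤ k ℕ.+ f → ¬ ¬ ∃ (Maximal P)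
  go zero k p B<k _ = ℕ.<⇒≱ (subst (suc B ℕ.≤_) (ℕ.+-identityʳ k) B<k) (bound k p)
  go (suc f) k p B<k no-max = no-max (k , p , λ p′ → go f (suc k) p′ (subst (suc B ℕ.≤_) (ℕ.+-suc k f) B<k) no-max)

◂-orthogonal : ∀ {k x} {c : Family N k} → IsOrthogonal c → ⟨ x , x ⟩ ≢ 0F → (∀ i → ⟨ x , c i ⟩ ≡ 0F) → IsOrthogonal (x ◂ c)
◂-orthogonal {x = x} {c} o x≢0 h = record { orthogonal = orth ; nonzero = nz }
  where
  orth : ∀ i j → i ≢ j → ⟨ (x ◂ c) i , (x ◂ c) j ⟩ ≡ 0F
  orth zero zero i≢j = ⊥-elim (i≢j refl)
  orth zero (suc j) _ = h j
  orth (suc i) zero _ = trans (⟨⟩-comm _ _) (h i)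
  orth (suc i) (suc j) i≢j = orthogonal o i j (i≢j ∘ cong suc)
  nz : ∀ i → ⟨ (x ◂ c) i , (x ◂ c) i ⟩ ≢ 0F
  nz zero = x≢0
  nz (suc i) = nonzero o i

record IsSubspace {N} (P : E N → Set) : Set where
  field
    0∈ : P 0ᴱ
    ⊕∈ : ∀ {x y} → P x → P y → P (x ⊕ y)
    ∙∈ : ∀ c {x} → P x → P (c ∙ x)
  ⊖∈ : ∀ {x y} → P x → P y → P (x ⊖ y)
  ⊖∈ x∈ y∈ = ⊕∈ x∈ (∙∈ -1F y∈)
  Σ∈ : ∀ {k} {f : Fin k → E N} → (∀ i → P (f i)) → P (Σᴱ f)
  Σ∈ {zero} {f} h = subst P (sym (Σᴱ-nil f)) 0∈
  Σ∈ {suc k} {f} h = subst P (sym (Σᴱ-suc f)) (⊕∈ (h zero) (Σ∈ (h ∘ suc)))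
  proj∈ : ∀ {k} {c : Family N k} → (∀ i → P (c i)) → ∀ x → P (proj c x)
  proj∈ h x = Σ∈ (λ i → ∙∈ _ (h i))

record Basis {N} (P : E N → Set) (k : ℕ) : Set where
  field
    vec : Family N k
    vec∈ : ∀ i → P (vec i)
    vec-orthogonal : IsOrthogonal vec
    expand : ∀ {x} → P x → x ≡ proj vec x
open Basis

-- An orthogonal family in `P` of maximal size is a basis, because a nonzero residual of a
-- projection could be added to it. Whether a residual vanishes is decidable by its norm.
basis : {P : E N → Set} → IsSubspace P → ¬ ¬ ∃ (Basis P)
basis {N} {P} sub = maximal Q (λ k q → orthogonal-≤N (proj₂ (proj₂ q))) empty >>= λ { (k , (c , c∈ , o) , max) → return (k , record
  { vec = c ; vec∈ = c∈ ; vec-orthogonal = o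
  ; expand = λ {x} x∈ → decidable-stable-≡ λ x≢ → max (_ , ◂∈ (⊖∈ x∈ (proj∈ c∈ x)) c∈ ,
      ◂-orthogonal o (λ e → x≢ (⊖≡0⇒≡ (⟨⟩≡0⇒≡0 e))) (⟨⟩-⊖-proj o x)) }) }
  where
  open IsSubspace sub
  Q : ℕ → Set
  Q k = Σ (Family N k) λ c → (∀ i → P (c i)) × IsOrthogonal c
  empty : Q 0
  empty = (λ ()) , (λ ()) , record { orthogonal = λ () ; nonzero = λ () }
  ◂∈ : ∀ {k x} {c : Family N k} → P x → (∀ i → P (c i)) → ∀ i → P ((x ◂ c) i)
  ◂∈ x∈ c∈ zero = x∈
  ◂∈ x∈ c∈ (suc i) = c∈ i
  decidable-stable-≡ : {x y : E N} → ¬ (x ≢ y) → x ≡ y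
  decidable-stable-≡ {x} {y} h with ⟨ x ⊖ y , x ⊖ y ⟩ ≟ 0F
  ... | yes e = ⊖≡0⇒≡ (⟨⟩≡0⇒≡0 e)
  ... | no n = ⊥-elim (h λ { refl → n (trans (cong (λ z → ⟨ z , z ⟩) (⊖-self x)) (⟨⟩-0ˡ _)) })

basis-≤ : ∀ {P Q : E N → Set} {k l} → (∀ x → P x → Q x) → Basis P k → Basis Q l → k ℕ.≤ l
basis-≤ P⊆Q b c = orthogonal-≤ (vec-orthogonal b) (vec-orthogonal c) (λ i → expand c (P⊆Q _ (vec∈ b i)))

-- A nonzero residual of a vector of `Q` would give `suc k` orthogonal vectors in a space of
-- dimension `k`.
basis-≡ : ∀ {P Q : E N → Set} {k} → IsSubspace P → IsSubspace Q →
  (∀ x → P x → Q x) → Basis P k → Basis Q k → ∀ x → Q x → P x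
basis-≡ {P = P} {Q} {k} subP subQ P⊆Q b c x x∈ with ⟨ r , r ⟩ ≟ 0F
  where r = x ⊖ proj (vec b) x
... | yes e = subst P (sym (⊖≡0⇒≡ (⟨⟩≡0⇒≡0 e))) (IsSubspace.proj∈ subP (vec∈ b) x)
... | no n = ⊥-elim (ℕ.1+n≰n (orthogonal-≤ (◂-orthogonal (vec-orthogonal b) n (⟨⟩-⊖-proj (vec-orthogonal b) x))
    (vec-orthogonal c) λ { zero → expand c (IsSubspace.⊖∈ subQ x∈ (IsSubspace.proj∈ subQ (λ i → P⊆Q _ (vec∈ b i)) x))
                         ; (suc i) → expand c (P⊆Q _ (vec∈ b i)) }))

-- Matrices and star algebras

Σ-assoc : ∀ {p q} (a : Fin p → F) (b : Fin p → Fin q → F) (c : Fin q → F) →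
  Σꟳ (λ k → Σꟳ (λ l → a l * b l k) * c k) ≡ Σꟳ (λ l → a l * Σꟳ (λ k → b l k * c k))
Σ-assoc a b c = begin
  Σꟳ (λ k → Σꟳ (λ l → a l * b l k) * c k) ≡⟨ (Σ-cong λ k → Σ-* (c k) _) ⟩
  Σꟳ (λ k → Σꟳ (λ l → a l * b l k * c k)) ≡⟨ Σ-swap _ ⟩
  Σꟳ (λ l → Σꟳ (λ k → a l * b l k * c k)) ≡⟨ (Σ-cong λ l → trans (Σ-cong λ k → *-assoc (a l) _ _) (sym (*-Σ (a l) _))) ⟩
  Σꟳ (λ l → a l * Σꟳ (λ k → b l k * c k)) ∎
  where open ≡-Reasoning

neg-unique : ∀ {N} {x y : E N} → x ⊕ y ≡ 0ᴱ → y ≡ -1F ∙ x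
neg-unique {x = x} {y} e = begin
  y ≡⟨ ⊕-identityʳ y ⟨
  y ⊕ 0ᴱ ≡⟨ cong (y ⊕_) (⊖-self x) ⟨
  y ⊕ (x ⊕ -1F ∙ x) ≡⟨ ⊕-assoc y x _ ⟨
  (y ⊕ x) ⊕ -1F ∙ x ≡⟨ cong (_⊕ -1F ∙ x) (trans (⊕-comm y x) e) ⟩
  0ᴱ ⊕ -1F ∙ x ≡⟨ ⊕-identityˡ _ ⟩
  -1F ∙ x ∎
  where open ≡-Reasoning

∙-Σᴱ : ∀ {N k} c (f : Fin k → E N) → c ∙ Σᴱ f ≡ Σᴱ (λ i → c ∙ f i)
∙-Σᴱ c = additive-Σ (c ∙_) (∙-zeroʳ c) (∙-distribˡ c)

module Matrices (n : ℕ) where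
  M : Set
  M = E (n ℕ.* n)

  V : Set
  V = E n

  infixl 7 _⊙_
  infix 9 _ᵀ

  abstract
    at : M → Fin n → Fin n → F
    at X i j = X ! combine i j

    mat : (Fin n → Fin n → F) → M
    mat f = mk (λ k → uncurry f (remQuot {n} n k))

    at-mat : ∀ f i j → at (mat f) i j ≡ f i j
    at-mat f i j = trans (mk-! _ (combine i j)) (cong (uncurry f) (Fin.remQuot-combine {n} {n} i j))

    mat-ext : ∀ {X Y} → (∀ i j → at X i j ≡ at Y i j) → X ≡ Y
    mat-ext {X} {Y} h = ext λ k → subst (λ l → X ! l ≡ Y ! l) (Fin.combine-remQuot {n} n k)
      (h (proj₁ (remQuot {n} n k)) (proj₂ (remQuot {n} n k)))

    at-⊕ : ∀ X Y i j → at (X ⊕ Y) i j ≡ at X i j + at Y i j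
    at-⊕ X Y i j = ⊕-! X Y _

    at-∙ : ∀ c X i j → at (c ∙ X) i j ≡ c * at X i j
    at-∙ c X i j = ∙-! c X _

    ⟨⟩-at : (X Y : M) → ⟨ X , Y ⟩ ≡ Σꟳ (λ i → Σꟳ (λ j → at X i j * at Y i j))
    ⟨⟩-at X Y = trans (⟨⟩-Σ X Y) (Σ-combine n (λ k → X ! k * Y ! k))

    _⊙_ : M → M → M
    X ⊙ Y = mat (λ i j → Σꟳ (λ k → at X i k * at Y k j))

    at-⊙ : ∀ X Y i j → at (X ⊙ Y) i j ≡ Σꟳ (λ k → at X i k * at Y k j)
    at-⊙ X Y = at-mat _

    one : M
    one = mat δ

    at-one : ∀ i j → at one i j ≡ δ i j
    at-one = at-mat δ

    _ᵀ : M → M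
    X ᵀ = mat (λ i j → at X j i)

    at-ᵀ : ∀ X i j → at (X ᵀ) i j ≡ at X j i
    at-ᵀ X = at-mat _

    app : M → V → V
    app X v = mk (λ i → Σꟳ (λ j → at X i j * v ! j))

    app-! : ∀ X v i → app X v ! i ≡ Σꟳ (λ j → at X i j * v ! j)
    app-! X v i = mk-! _ i

  ⊙-assoc : ∀ X Y Z → (X ⊙ Y) ⊙ Z ≡ X ⊙ (Y ⊙ Z)
  ⊙-assoc X Y Z = mat-ext λ i j → begin
    at ((X ⊙ Y) ⊙ Z) i j ≡⟨ at-⊙ _ _ i j ⟩
    Σꟳ (λ k → at (X ⊙ Y) i k * at Z k j) ≡⟨ (Σ-cong λ k → *-congʳ (at-⊙ X Y i k)) ⟩
    Σꟳ (λ k → Σꟳ (λ l → at X i l * at Y l k) * at Z k j) ≡⟨ Σ-assoc _ _ _ ⟩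
    Σꟳ (λ l → at X i l * Σꟳ (λ k → at Y l k * at Z k j)) ≡⟨ (Σ-cong λ l → *-congˡ (at-⊙ Y Z l j)) ⟨
    Σꟳ (λ l → at X i l * at (Y ⊙ Z) l j) ≡⟨ at-⊙ _ _ i j ⟨
    at (X ⊙ (Y ⊙ Z)) i j ∎
    where open ≡-Reasoning

  ᵀᵀ : ∀ X → X ᵀ ᵀ ≡ X
  ᵀᵀ X = mat-ext λ i j → trans (at-ᵀ _ i j) (at-ᵀ X j i)

  ᵀ-⊙ : ∀ X Y → (X ⊙ Y) ᵀ ≡ Y ᵀ ⊙ X ᵀ
  ᵀ-⊙ X Y = mat-ext λ i j → begin
    at ((X ⊙ Y) ᵀ) i j ≡⟨ trans (at-ᵀ _ i j) (at-⊙ X Y j i) ⟩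
    Σꟳ (λ k → at X j k * at Y k i) ≡⟨ (Σ-cong λ k → trans (*-comm _ _) (sym (cong₂ _*_ (at-ᵀ Y i k) (at-ᵀ X k j)))) ⟩
    Σꟳ (λ k → at (Y ᵀ) i k * at (X ᵀ) k j) ≡⟨ at-⊙ _ _ i j ⟨
    at (Y ᵀ ⊙ X ᵀ) i j ∎
    where open ≡-Reasoning

  ᵀ-⊕ : ∀ X Y → (X ⊕ Y) ᵀ ≡ X ᵀ ⊕ Y ᵀ
  ᵀ-⊕ X Y = mat-ext λ i j → trans (at-ᵀ _ i j) (trans (at-⊕ X Y j i)
    (sym (trans (at-⊕ _ _ i j) (cong₂ _+_ (at-ᵀ X i j) (at-ᵀ Y i j)))))

  ᵀ-∙ : ∀ c X → (c ∙ X) ᵀ ≡ c ∙ X ᵀ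
  ᵀ-∙ c X = mat-ext λ i j → trans (at-ᵀ _ i j) (trans (at-∙ c X j i)
    (sym (trans (at-∙ _ _ i j) (*-congˡ (at-ᵀ X i j)))))

  δ-sym : ∀ {k} (i j : Fin k) → δ i j ≡ δ j i
  δ-sym i j with i Fin.≟ j
  ... | yes refl = sym (δ-refl i)
  ... | no i≢j = sym (δ-≢ (i≢j ∘ sym))

  ᵀ-one : one ᵀ ≡ one
  ᵀ-one = mat-ext λ i j → trans (at-ᵀ one i j) (trans (at-one j i) (trans (δ-sym j i) (sym (at-one i j))))

  ⊙-distribˡ : ∀ X Y Z → X ⊙ (Y ⊕ Z) ≡ X ⊙ Y ⊕ X ⊙ Z
  ⊙-distribˡ X Y Z = mat-ext λ i j → begin
    at (X ⊙ (Y ⊕ Z)) i j ≡⟨ at-⊙ _ _ i j ⟩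
    Σꟳ (λ k → at X i k * at (Y ⊕ Z) k j) ≡⟨ (Σ-cong λ k → trans (*-congˡ (at-⊕ Y Z k j)) (*-distribˡ-+ _ _ _)) ⟩
    Σꟳ (λ k → at X i k * at Y k j + at X i k * at Z k j) ≡⟨ Σ-+ _ _ ⟩
    Σꟳ (λ k → at X i k * at Y k j) + Σꟳ (λ k → at X i k * at Z k j) ≡⟨ cong₂ _+_ (at-⊙ X Y i j) (at-⊙ X Z i j) ⟨
    at (X ⊙ Y) i j + at (X ⊙ Z) i j ≡⟨ at-⊕ _ _ i j ⟨
    at (X ⊙ Y ⊕ X ⊙ Z) i j ∎
    where open ≡-Reasoning

  ᵀ-injective : ∀ {X Y} → X ᵀ ≡ Y ᵀ → X ≡ Y
  ᵀ-injective {X} {Y} e = trans (sym (ᵀᵀ X)) (trans (cong _ᵀ e) (ᵀᵀ Y))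

  ⊙-distribʳ : ∀ X Y Z → (Y ⊕ Z) ⊙ X ≡ Y ⊙ X ⊕ Z ⊙ X
  ⊙-distribʳ X Y Z = ᵀ-injective (begin
    ((Y ⊕ Z) ⊙ X) ᵀ ≡⟨ ᵀ-⊙ _ X ⟩
    X ᵀ ⊙ (Y ⊕ Z) ᵀ ≡⟨ cong (X ᵀ ⊙_) (ᵀ-⊕ Y Z) ⟩
    X ᵀ ⊙ (Y ᵀ ⊕ Z ᵀ) ≡⟨ ⊙-distribˡ _ _ _ ⟩
    X ᵀ ⊙ Y ᵀ ⊕ X ᵀ ⊙ Z ᵀ ≡⟨ cong₂ _⊕_ (ᵀ-⊙ Y X) (ᵀ-⊙ Z X) ⟨
    (Y ⊙ X) ᵀ ⊕ (Z ⊙ X) ᵀ ≡⟨ ᵀ-⊕ _ _ ⟨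
    (Y ⊙ X ⊕ Z ⊙ X) ᵀ ∎)
    where open ≡-Reasoning

  ⊙-∙ʳ : ∀ c X Y → X ⊙ (c ∙ Y) ≡ c ∙ (X ⊙ Y)
  ⊙-∙ʳ c X Y = mat-ext λ i j → begin
    at (X ⊙ (c ∙ Y)) i j ≡⟨ at-⊙ _ _ i j ⟩
    Σꟳ (λ k → at X i k * at (c ∙ Y) k j) ≡⟨ (Σ-cong λ k → trans (*-congˡ (at-∙ c Y k j))
      (trans (sym (*-assoc _ c _)) (trans (*-congʳ (*-comm _ c)) (*-assoc c _ _)))) ⟩
    Σꟳ (λ k → c * (at X i k * at Y k j)) ≡⟨ *-Σ c _ ⟨
    c * Σꟳ (λ k → at X i k * at Y k j) ≡⟨ *-congˡ (at-⊙ X Y i j) ⟨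
    c * at (X ⊙ Y) i j ≡⟨ at-∙ c _ i j ⟨
    at (c ∙ (X ⊙ Y)) i j ∎
    where open ≡-Reasoning

  ⊙-∙ˡ : ∀ c X Y → (c ∙ X) ⊙ Y ≡ c ∙ (X ⊙ Y)
  ⊙-∙ˡ c X Y = ᵀ-injective (trans (ᵀ-⊙ _ Y) (trans (cong (Y ᵀ ⊙_) (ᵀ-∙ c X)) (trans (⊙-∙ʳ c _ _)
    (trans (cong (c ∙_) (sym (ᵀ-⊙ X Y))) (sym (ᵀ-∙ c _))))))

  one-⊙ : ∀ X → one ⊙ X ≡ X
  one-⊙ X = mat-ext λ i j → begin
    at (one ⊙ X) i j ≡⟨ at-⊙ one X i j ⟩
    Σꟳ (λ k → at one i k * at X k j) ≡⟨ (Σ-cong λ k → *-congʳ (at-one i k)) ⟩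
    Σꟳ (λ k → δ i k * at X k j) ≡⟨ Σ-single _ i (λ k k≢i → trans (*-congʳ (δ-≢ (k≢i ∘ sym))) (zeroˡ _)) ⟩
    δ i i * at X i j ≡⟨ trans (*-congʳ (δ-refl i)) (*-identityˡ _) ⟩
    at X i j ∎
    where open ≡-Reasoning

  ⊙-one : ∀ X → X ⊙ one ≡ X
  ⊙-one X = ᵀ-injective (trans (ᵀ-⊙ X one) (trans (cong (_⊙ X ᵀ) ᵀ-one) (one-⊙ _)))

  ⊙-zeroʳ : ∀ X → X ⊙ 0ᴱ ≡ 0ᴱ
  ⊙-zeroʳ X = trans (cong (X ⊙_) (sym (∙-zeroˡ one))) (trans (⊙-∙ʳ 0F X one) (∙-zeroˡ _))

  ⊙-zeroˡ : ∀ X → 0ᴱ ⊙ X ≡ 0ᴱ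
  ⊙-zeroˡ X = trans (cong (_⊙ X) (sym (∙-zeroˡ one))) (trans (⊙-∙ˡ 0F one X) (∙-zeroˡ _))

  ᵀ-zero : 0ᴱ ᵀ ≡ 0ᴱ
  ᵀ-zero = trans (cong _ᵀ (sym (∙-zeroˡ one))) (trans (ᵀ-∙ 0F one) (∙-zeroˡ _))

  ⊙-Σ : ∀ {k} X (f : Fin k → M) → X ⊙ Σᴱ f ≡ Σᴱ (λ i → X ⊙ f i)
  ⊙-Σ X = additive-Σ (X ⊙_) (⊙-zeroʳ X) (⊙-distribˡ X)

  Σ-⊙ : ∀ {k} X (f : Fin k → M) → Σᴱ f ⊙ X ≡ Σᴱ (λ i → f i ⊙ X)
  Σ-⊙ X = additive-Σ (_⊙ X) (⊙-zeroˡ X) (⊙-distribʳ X)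

  Σ-ᵀ : ∀ {k} (f : Fin k → M) → (Σᴱ f) ᵀ ≡ Σᴱ (λ i → f i ᵀ)
  Σ-ᵀ = additive-Σ _ᵀ ᵀ-zero ᵀ-⊕

  ⟨⟩-ᵀ : ∀ X Y → ⟨ X ᵀ , Y ᵀ ⟩ ≡ ⟨ X , Y ⟩
  ⟨⟩-ᵀ X Y = begin
    ⟨ X ᵀ , Y ᵀ ⟩ ≡⟨ ⟨⟩-at _ _ ⟩
    Σꟳ (λ i → Σꟳ (λ j → at (X ᵀ) i j * at (Y ᵀ) i j)) ≡⟨ (Σ-cong λ i → Σ-cong λ j → cong₂ _*_ (at-ᵀ X i j) (at-ᵀ Y i j)) ⟩
    Σꟳ (λ i → Σꟳ (λ j → at X j i * at Y j i)) ≡⟨ Σ-swap _ ⟩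
    Σꟳ (λ j → Σꟳ (λ i → at X j i * at Y j i)) ≡⟨ ⟨⟩-at X Y ⟨
    ⟨ X , Y ⟩ ∎
    where open ≡-Reasoning

  ⟨⟩-⊙ˡ : ∀ X Y Z → ⟨ X ⊙ Y , Z ⟩ ≡ ⟨ Y , X ᵀ ⊙ Z ⟩
  ⟨⟩-⊙ˡ X Y Z = begin
    ⟨ X ⊙ Y , Z ⟩ ≡⟨ trans (⟨⟩-at _ _) (Σ-swap _) ⟩
    Σꟳ (λ j → Σꟳ (λ i → at (X ⊙ Y) i j * at Z i j)) ≡⟨ Σ-cong step ⟩
    Σꟳ (λ j → Σꟳ (λ k → at Y k j * at (X ᵀ ⊙ Z) k j)) ≡⟨ trans (⟨⟩-at _ _) (Σ-swap _) ⟨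
    ⟨ Y , X ᵀ ⊙ Z ⟩ ∎
    where
    open ≡-Reasoning
    step : ∀ j → Σꟳ (λ i → at (X ⊙ Y) i j * at Z i j) ≡ Σꟳ (λ k → at Y k j * at (X ᵀ ⊙ Z) k j)
    step j = begin
      Σꟳ (λ i → at (X ⊙ Y) i j * at Z i j) ≡⟨ (Σ-cong λ i → *-congʳ (trans (at-⊙ X Y i j) (Σ-cong λ k → *-comm _ _))) ⟩
      Σꟳ (λ i → Σꟳ (λ k → at Y k j * at X i k) * at Z i j) ≡⟨ Σ-assoc (λ k → at Y k j) (λ k i → at X i k) (λ i → at Z i j) ⟩
      Σꟳ (λ k → at Y k j * Σꟳ (λ i → at X i k * at Z i j))
        ≡⟨ (Σ-cong λ k → *-congˡ (trans (at-⊙ (X ᵀ) Z k j) (Σ-cong λ i → *-congʳ (at-ᵀ X k i)))) ⟨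
      Σꟳ (λ k → at Y k j * at (X ᵀ ⊙ Z) k j) ∎

  ⟨⟩-⊙ʳ : ∀ X Y Z → ⟨ X ⊙ Y , Z ⟩ ≡ ⟨ X , Z ⊙ Y ᵀ ⟩
  ⟨⟩-⊙ʳ X Y Z = begin
    ⟨ X ⊙ Y , Z ⟩ ≡⟨ ⟨⟩-ᵀ _ _ ⟨
    ⟨ (X ⊙ Y) ᵀ , Z ᵀ ⟩ ≡⟨ cong (λ W → ⟨ W , Z ᵀ ⟩) (ᵀ-⊙ X Y) ⟩
    ⟨ Y ᵀ ⊙ X ᵀ , Z ᵀ ⟩ ≡⟨ ⟨⟩-⊙ˡ _ _ _ ⟩
    ⟨ X ᵀ , Y ᵀ ᵀ ⊙ Z ᵀ ⟩ ≡⟨ cong (λ W → ⟨ X ᵀ , W ⟩) (ᵀ-⊙ Z (Y ᵀ)) ⟨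
    ⟨ X ᵀ , (Z ⊙ Y ᵀ) ᵀ ⟩ ≡⟨ ⟨⟩-ᵀ _ _ ⟩
    ⟨ X , Z ⊙ Y ᵀ ⟩ ∎
    where open ≡-Reasoning

  app-⊙ : ∀ X Y v → app (X ⊙ Y) v ≡ app X (app Y v)
  app-⊙ X Y v = ext λ i → begin
    app (X ⊙ Y) v ! i ≡⟨ trans (app-! _ v i) (Σ-cong λ k → *-congʳ (at-⊙ X Y i k)) ⟩
    Σꟳ (λ k → Σꟳ (λ l → at X i l * at Y l k) * v ! k) ≡⟨ Σ-assoc _ _ _ ⟩
    Σꟳ (λ l → at X i l * Σꟳ (λ k → at Y l k * v ! k)) ≡⟨ trans (app-! X _ i) (Σ-cong λ l → *-congˡ (app-! Y v l)) ⟨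
    app X (app Y v) ! i ∎
    where open ≡-Reasoning

  ⟨⟩-app : ∀ X v w → ⟨ app X v , w ⟩ ≡ ⟨ v , app (X ᵀ) w ⟩
  ⟨⟩-app X v w = begin
    ⟨ app X v , w ⟩ ≡⟨ trans (⟨⟩-Σ _ _) (Σ-cong λ i → *-congʳ (trans (app-! X v i) (Σ-cong λ k → *-comm _ _))) ⟩
    Σꟳ (λ i → Σꟳ (λ k → v ! k * at X i k) * w ! i) ≡⟨ Σ-assoc _ (λ k i → at X i k) _ ⟩
    Σꟳ (λ k → v ! k * Σꟳ (λ i → at X i k * w ! i))
      ≡⟨ trans (⟨⟩-Σ _ _) (Σ-cong λ k → *-congˡ (trans (app-! (X ᵀ) w k) (Σ-cong λ i → *-congʳ (at-ᵀ X k i)))) ⟨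
    ⟨ v , app (X ᵀ) w ⟩ ∎
    where open ≡-Reasoning

  app-⊕ : ∀ X Y v → app (X ⊕ Y) v ≡ app X v ⊕ app Y v
  app-⊕ X Y v = ext λ i → begin
    app (X ⊕ Y) v ! i ≡⟨ app-! _ v i ⟩
    Σꟳ (λ j → at (X ⊕ Y) i j * v ! j) ≡⟨ (Σ-cong λ j → trans (*-congʳ (at-⊕ X Y i j)) (*-distribʳ-+ _ _ _)) ⟩
    Σꟳ (λ j → at X i j * v ! j + at Y i j * v ! j) ≡⟨ Σ-+ _ _ ⟩
    Σꟳ (λ j → at X i j * v ! j) + Σꟳ (λ j → at Y i j * v ! j) ≡⟨ cong₂ _+_ (app-! X v i) (app-! Y v i) ⟨
    app X v ! i + app Y v ! i ≡⟨ ⊕-! _ _ i ⟨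
    (app X v ⊕ app Y v) ! i ∎
    where open ≡-Reasoning

  app-∙ : ∀ c X v → app (c ∙ X) v ≡ c ∙ app X v
  app-∙ c X v = ext λ i → begin
    app (c ∙ X) v ! i ≡⟨ app-! _ v i ⟩
    Σꟳ (λ j → at (c ∙ X) i j * v ! j) ≡⟨ (Σ-cong λ j → trans (*-congʳ (at-∙ c X i j)) (*-assoc _ _ _)) ⟩
    Σꟳ (λ j → c * (at X i j * v ! j)) ≡⟨ *-Σ c _ ⟨
    c * Σꟳ (λ j → at X i j * v ! j) ≡⟨ *-congˡ (app-! X v i) ⟨
    c * app X v ! i ≡⟨ ∙-! _ _ i ⟨
    (c ∙ app X v) ! i ∎
    where open ≡-Reasoning

  app-zeroˡ : ∀ v → app 0ᴱ v ≡ 0ᴱ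
  app-zeroˡ v = trans (cong (λ X → app X v) (sym (∙-zeroˡ one))) (trans (app-∙ 0F one v) (∙-zeroˡ _))

  app-zeroʳ : ∀ X → app X 0ᴱ ≡ 0ᴱ
  app-zeroʳ X = ⟨⟩-ext λ i → trans (⟨⟩-app X 0ᴱ _) (trans (⟨⟩-0ˡ _) (sym (⟨⟩-0ˡ _)))

  app-⊕ʳ : ∀ X v w → app X (v ⊕ w) ≡ app X v ⊕ app X w
  app-⊕ʳ X v w = ⟨⟩-ext λ i → begin
    ⟨ app X (v ⊕ w) , unit i ⟩ ≡⟨ trans (⟨⟩-app X _ _) (⟨⟩-⊕ˡ v w _) ⟩
    ⟨ v , app (X ᵀ) (unit i) ⟩ + ⟨ w , app (X ᵀ) (unit i) ⟩ ≡⟨ cong₂ _+_ (⟨⟩-app X v _) (⟨⟩-app X w _) ⟨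
    ⟨ app X v , unit i ⟩ + ⟨ app X w , unit i ⟩ ≡⟨ ⟨⟩-⊕ˡ _ _ _ ⟨
    ⟨ app X v ⊕ app X w , unit i ⟩ ∎
    where open ≡-Reasoning

  app-Σ : ∀ {k} X (f : Fin k → V) → app X (Σᴱ f) ≡ Σᴱ (λ i → app X (f i))
  app-Σ X = additive-Σ (app X) (app-zeroʳ X) (app-⊕ʳ X)

  app-one : ∀ v → app one v ≡ v
  app-one v = ext λ i → begin
    app one v ! i ≡⟨ app-! one v i ⟩
    Σꟳ (λ j → at one i j * v ! j) ≡⟨ (Σ-cong λ j → *-congʳ (at-one i j)) ⟩
    Σꟳ (λ j → δ i j * v ! j) ≡⟨ Σ-single _ i (λ j j≢i → trans (*-congʳ (δ-≢ (j≢i ∘ sym))) (zeroˡ _)) ⟩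
    δ i i * v ! i ≡⟨ trans (*-congʳ (δ-refl i)) (*-identityˡ _) ⟩
    v ! i ∎
    where open ≡-Reasoning

  at-app-unit : ∀ X i j → app X (unit j) ! i ≡ at X i j
  at-app-unit X i j = trans (app-! X _ i) (trans (Σ-cong λ k → *-congˡ (mk-! (δ j) k))
    (trans (Σ-single _ j (λ k k≢j → trans (*-congˡ (δ-≢ (k≢j ∘ sym))) (zeroʳ _)))
      (trans (*-congˡ (δ-refl j)) (*-identityʳ _))))

  app-unit≡0⇒≡0 : ∀ {X} → (∀ j → app X (unit j) ≡ 0ᴱ) → X ≡ 0ᴱ
  app-unit≡0⇒≡0 {X} h = mat-ext λ i j → trans (sym (at-app-unit X i j)) (trans
    (cong (_! i) (trans (h j) (sym (app-zeroˡ _)))) (at-app-unit 0ᴱ i j))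

  Commute : M → M → Set
  Commute X Y = X ⊙ Y ≡ Y ⊙ X

  Commute-⊕ : ∀ {X Y Z} → Commute X Y → Commute X Z → Commute X (Y ⊕ Z)
  Commute-⊕ {X} {Y} {Z} p q = trans (⊙-distribˡ X Y Z) (trans (cong₂ _⊕_ p q) (sym (⊙-distribʳ X Y Z)))

  Commute-∙ : ∀ c {X Y} → Commute X Y → Commute X (c ∙ Y)
  Commute-∙ c {X} {Y} p = trans (⊙-∙ʳ c X Y) (trans (cong (c ∙_) p) (sym (⊙-∙ˡ c Y X)))

  Commute-0 : ∀ X → Commute X 0ᴱ
  Commute-0 X = trans (⊙-zeroʳ X) (sym (⊙-zeroˡ X))

  Commute-one : ∀ X → Commute X one
  Commute-one X = trans (⊙-one X) (sym (one-⊙ X))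

  Commute-⊙ : ∀ {X Y Z} → Commute X Y → Commute X Z → Commute X (Y ⊙ Z)
  Commute-⊙ {X} {Y} {Z} p q = begin
    X ⊙ (Y ⊙ Z) ≡⟨ ⊙-assoc X Y Z ⟨
    (X ⊙ Y) ⊙ Z ≡⟨ cong (_⊙ Z) p ⟩
    (Y ⊙ X) ⊙ Z ≡⟨ ⊙-assoc Y X Z ⟩
    Y ⊙ (X ⊙ Z) ≡⟨ cong (Y ⊙_) q ⟩
    Y ⊙ (Z ⊙ X) ≡⟨ ⊙-assoc Y Z X ⟨
    (Y ⊙ Z) ⊙ X ∎
    where open ≡-Reasoning

  Commute-ᵀ : ∀ {X Y} → Commute (X ᵀ) Y → Commute X (Y ᵀ)
  Commute-ᵀ {X} {Y} p = begin
    X ⊙ Y ᵀ ≡⟨ cong (_⊙ Y ᵀ) (ᵀᵀ X) ⟨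
    X ᵀ ᵀ ⊙ Y ᵀ ≡⟨ ᵀ-⊙ Y (X ᵀ) ⟨
    (Y ⊙ X ᵀ) ᵀ ≡⟨ cong _ᵀ p ⟨
    (X ᵀ ⊙ Y) ᵀ ≡⟨ ᵀ-⊙ _ Y ⟩
    Y ᵀ ⊙ X ᵀ ᵀ ≡⟨ cong (Y ᵀ ⊙_) (ᵀᵀ X) ⟩
    Y ᵀ ⊙ X ∎
    where open ≡-Reasoning

  record IsStarAlgebra (A : M → Set) : Set where
    field
      isSubspace : IsSubspace A
      one∈ : A one
      ⊙∈ : ∀ {X Y} → A X → A Y → A (X ⊙ Y)
      ᵀ∈ : ∀ {X} → A X → A (X ᵀ)
    open IsSubspace isSubspace public

  Commutant : (M → Set) → M → Set
  Commutant A Y = ∀ X → A X → Commute X Y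

  commutant-subspace : ∀ A → IsSubspace (Commutant A)
  commutant-subspace A = record
    { 0∈ = λ X _ → Commute-0 X
    ; ⊕∈ = λ p q X X∈ → Commute-⊕ (p X X∈) (q X X∈)
    ; ∙∈ = λ c p X X∈ → Commute-∙ c (p X X∈) }

  commutant-starAlgebra : ∀ {A} → (∀ {X} → A X → A (X ᵀ)) → IsStarAlgebra (Commutant A)
  commutant-starAlgebra {A} ᵀ∈ = record
    { isSubspace = commutant-subspace A
    ; one∈ = λ X _ → Commute-one X
    ; ⊙∈ = λ p q X X∈ → Commute-⊙ (p X X∈) (q X X∈)
    ; ᵀ∈ = λ p X X∈ → Commute-ᵀ (p _ (ᵀ∈ X∈)) }

  ∩-subspace : ∀ {P Q : M → Set} → IsSubspace P → IsSubspace Q → IsSubspace (λ X → P X × Q X)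
  ∩-subspace p q = record
    { 0∈ = P.0∈ , Q.0∈
    ; ⊕∈ = λ x y → P.⊕∈ (proj₁ x) (proj₁ y) , Q.⊕∈ (proj₂ x) (proj₂ y)
    ; ∙∈ = λ c x → P.∙∈ c (proj₁ x) , Q.∙∈ c (proj₂ x) }
    where
    module P = IsSubspace p
    module Q = IsSubspace q

-- The Casimir map

module Casimir (n : ℕ) where
  open Matrices n

  ⊥-basis : ∀ {A : M → Set} {k} (b : Basis A k) {X Y} → (∀ i → ⟨ X , vec b i ⟩ ≡ 0F) → A Y → ⟨ X , Y ⟩ ≡ 0F
  ⊥-basis b {X} {Y} X⊥ Y∈ = trans (⟨⟩-comm X Y) (trans (cong (λ Z → ⟨ Z , X ⟩) (expand b Y∈)) (⊥-proj (vec b) Y X X⊥))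

  gram : ∀ {k} → Family (n ℕ.* n) k → (Fin k → F) → M
  gram u ν = Σᴱ λ j → ν j ∙ (u j ⊙ u j ᵀ)

  gram-ᵀ : ∀ {k} (u : Family (n ℕ.* n) k) ν → gram u ν ᵀ ≡ gram u ν
  gram-ᵀ u ν = trans (Σ-ᵀ _) (Σᴱ-cong λ j → trans (ᵀ-∙ _ _) (cong (ν j ∙_) (trans (ᵀ-⊙ _ _) (cong (_⊙ u j ᵀ) (ᵀᵀ _)))))

  -- Pairing `Y ⊙ gram u ν` with `Y` gives the sum of the terms `ν j * ⟨ Y ⊙ u j , Y ⊙ u j ⟩`, all
  -- nonnegative, so each of them vanishes. This positivity plays the part of an inverse of the Gram
  -- matrix.
  ⊙-gram≡0 : ∀ {k} {u : Family (n ℕ.* n) k} {ν} → (∀ j → 0F ≤ ν j) → (∀ j → ν j ≢ 0F) →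
    ∀ {Y} → Y ⊙ gram u ν ≡ 0ᴱ → ∀ j → Y ⊙ u j ≡ 0ᴱ
  ⊙-gram≡0 {u = u} {ν} 0≤ν ν≢0 {Y} e j =
    ⟨⟩≡0⇒≡0 (*-cancelˡ-0 (ν≢0 j) (Σ≡0⇒≡0 (λ i → *-nonneg (0≤ν i) (⟨⟩-nonneg (Y ⊙ u i))) total j))
    where
    open ≡-Reasoning
    term : ∀ i → ⟨ Y ⊙ (ν i ∙ (u i ⊙ u i ᵀ)) , Y ⟩ ≡ ν i * ⟨ Y ⊙ u i , Y ⊙ u i ⟩
    term i = begin
      ⟨ Y ⊙ (ν i ∙ (u i ⊙ u i ᵀ)) , Y ⟩ ≡⟨ cong (λ Z → ⟨ Z , Y ⟩) (trans (⊙-∙ʳ _ _ _) (cong (ν i ∙_) (sym (⊙-assoc _ _ _)))) ⟩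
      ⟨ ν i ∙ ((Y ⊙ u i) ⊙ u i ᵀ) , Y ⟩ ≡⟨ trans (⟨⟩-∙ˡ _ _ _) (*-congˡ (⟨⟩-⊙ʳ _ _ _)) ⟩
      ν i * ⟨ Y ⊙ u i , Y ⊙ u i ᵀ ᵀ ⟩ ≡⟨ *-congˡ (cong (λ Z → ⟨ Y ⊙ u i , Y ⊙ Z ⟩) (ᵀᵀ _)) ⟩
      ν i * ⟨ Y ⊙ u i , Y ⊙ u i ⟩ ∎
    total : Σꟳ (λ i → ν i * ⟨ Y ⊙ u i , Y ⊙ u i ⟩) ≡ 0F
    total = begin
      Σꟳ (λ i → ν i * ⟨ Y ⊙ u i , Y ⊙ u i ⟩) ≡⟨ Σ-cong term ⟨
      Σꟳ (λ i → ⟨ Y ⊙ (ν i ∙ (u i ⊙ u i ᵀ)) , Y ⟩) ≡⟨ ⟨⟩-Σˡ _ Y ⟨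
      ⟨ Σᴱ (λ i → Y ⊙ (ν i ∙ (u i ⊙ u i ᵀ))) , Y ⟩ ≡⟨ cong (λ Z → ⟨ Z , Y ⟩) (⊙-Σ Y _) ⟨
      ⟨ Y ⊙ gram u ν , Y ⟩ ≡⟨ trans (cong (λ Z → ⟨ Z , Y ⟩) e) (⟨⟩-0ˡ Y) ⟩
      0F ∎

  -- The identity is a combination of the basis, so `Y ⊙ one` vanishes as well.
  ⊙-basis≡0 : ∀ {A : M → Set} {k} (b : Basis A k) → A one → ∀ {Y} → (∀ j → Y ⊙ vec b j ≡ 0ᴱ) → Y ≡ 0ᴱ
  ⊙-basis≡0 b one∈ {Y} h = begin
    Y ≡⟨ ⊙-one Y ⟨
    Y ⊙ one ≡⟨ cong (Y ⊙_) (expand b one∈) ⟩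
    Y ⊙ proj (vec b) one ≡⟨ ⊙-Σ Y _ ⟩
    Σᴱ (λ i → Y ⊙ ((norm⁻¹ (vec b i) * ⟨ one , vec b i ⟩) ∙ vec b i))
      ≡⟨ Σᴱ-zero (λ i → trans (⊙-∙ʳ _ Y _) (trans (cong (_ ∙_) (h i)) (∙-zeroʳ _))) ⟩
    0ᴱ ∎
    where open ≡-Reasoning

  ⊙-transposes≡0 : ∀ {A : M → Set} {k} (b : Basis A k) → A one → ∀ {Y} → (∀ j → Y ⊙ vec b j ᵀ ≡ 0ᴱ) → Y ≡ 0ᴱ
  ⊙-transposes≡0 b one∈ {Y} h = begin
    Y ≡⟨ trans (cong (Y ⊙_) ᵀ-one) (⊙-one Y) ⟨
    Y ⊙ one ᵀ ≡⟨ cong (λ Z → Y ⊙ Z ᵀ) (expand b one∈) ⟩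
    Y ⊙ proj (vec b) one ᵀ ≡⟨ trans (cong (Y ⊙_) (Σ-ᵀ _)) (⊙-Σ Y _) ⟩
    Σᴱ (λ i → Y ⊙ ((norm⁻¹ (vec b i) * ⟨ one , vec b i ⟩) ∙ vec b i) ᵀ)
      ≡⟨ Σᴱ-zero (λ i → trans (cong (Y ⊙_) (ᵀ-∙ _ _)) (trans (⊙-∙ʳ _ Y _) (trans (cong (_ ∙_) (h i)) (∙-zeroʳ _)))) ⟩
    0ᴱ ∎
    where open ≡-Reasoning

  weight-nonneg : ∀ {A : M → Set} {k} (b : Basis A k) j → 0F ≤ norm⁻¹ (vec b j)
  weight-nonneg b j = norm⁻¹-nonneg (vec b j)

  weight≢0 : ∀ {A : M → Set} {k} (b : Basis A k) j → norm⁻¹ (vec b j) ≢ 0F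
  weight≢0 b j = inv≢0 (nonzero (vec-orthogonal b) j)

  -- The Casimir map X ↦ Σᵢ aᵢ X aᵢᵀ / |aᵢ|² of a star algebra A sends everything into the commutant of A.
  module _ {A} (starA : IsStarAlgebra A) {k} (basisA : Basis A k) where
    open IsStarAlgebra starA
    private
      a = vec basisA
      ν : Fin k → F
      ν i = norm⁻¹ (a i)

    casimir : M → M
    casimir X = Σᴱ λ i → ν i ∙ ((a i ⊙ X) ⊙ a i ᵀ)

    -- Expanding `C ⊙ a i` in the basis gives coefficients `⟨ C ⊙ a i , a j ⟩`. Since `C ᵀ` is
    -- adjoint to `C`, they are also the coefficients of `C ᵀ ⊙ a j`, and summing over `i` first
    -- moves `C` to the right-hand side.
    casimir-commutant : ∀ X → Commutant A (casimir X)
    casimir-commutant X C C∈ = begin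
      C ⊙ casimir X ≡⟨ trans (⊙-Σ C _) (Σᴱ-cong left) ⟩
      Σᴱ (λ i → Σᴱ λ j → (ν i * (ν j * ⟨ C ⊙ a i , a j ⟩)) ∙ ((a j ⊙ X) ⊙ a i ᵀ)) ≡⟨ Σᴱ-swap _ ⟩
      Σᴱ (λ j → Σᴱ λ i → (ν i * (ν j * ⟨ C ⊙ a i , a j ⟩)) ∙ ((a j ⊙ X) ⊙ a i ᵀ))
        ≡⟨ (Σᴱ-cong λ j → Σᴱ-cong λ i → cong (_∙ ((a j ⊙ X) ⊙ a i ᵀ)) (coefficient i j)) ⟩
      Σᴱ (λ j → Σᴱ λ i → (ν j * (ν i * ⟨ C ᵀ ⊙ a j , a i ⟩)) ∙ ((a j ⊙ X) ⊙ a i ᵀ)) ≡⟨ trans (Σ-⊙ C _) (Σᴱ-cong right) ⟨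
      casimir X ⊙ C ∎
      where
      open ≡-Reasoning
      coefficient : ∀ i j → ν i * (ν j * ⟨ C ⊙ a i , a j ⟩) ≡ ν j * (ν i * ⟨ C ᵀ ⊙ a j , a i ⟩)
      coefficient i j = begin
        ν i * (ν j * ⟨ C ⊙ a i , a j ⟩) ≡⟨ *-congˡ (*-congˡ (trans (⟨⟩-⊙ˡ C _ _) (⟨⟩-comm _ _))) ⟩
        ν i * (ν j * ⟨ C ᵀ ⊙ a j , a i ⟩) ≡⟨ trans (sym (*-assoc (ν i) (ν j) _)) (trans (*-congʳ (*-comm (ν i) (ν j))) (*-assoc (ν j) (ν i) _)) ⟩
        ν j * (ν i * ⟨ C ᵀ ⊙ a j , a i ⟩) ∎
      left : ∀ i → C ⊙ (ν i ∙ ((a i ⊙ X) ⊙ a i ᵀ)) ≡ Σᴱ λ j → (ν i * (ν j * ⟨ C ⊙ a i , a j ⟩)) ∙ ((a j ⊙ X) ⊙ a i ᵀ)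
      left i = begin
        C ⊙ (ν i ∙ ((a i ⊙ X) ⊙ a i ᵀ)) ≡⟨ ⊙-∙ʳ _ C _ ⟩
        ν i ∙ (C ⊙ ((a i ⊙ X) ⊙ a i ᵀ)) ≡⟨ cong (ν i ∙_) (trans (sym (⊙-assoc C _ _)) (cong (_⊙ a i ᵀ) (sym (⊙-assoc C _ _)))) ⟩
        ν i ∙ (((C ⊙ a i) ⊙ X) ⊙ a i ᵀ) ≡⟨ cong (λ Z → ν i ∙ ((Z ⊙ X) ⊙ a i ᵀ)) (expand basisA (⊙∈ C∈ (vec∈ basisA i))) ⟩
        ν i ∙ ((proj a (C ⊙ a i) ⊙ X) ⊙ a i ᵀ) ≡⟨ cong (ν i ∙_) (trans (cong (_⊙ a i ᵀ) (Σ-⊙ X _)) (Σ-⊙ (a i ᵀ) _)) ⟩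
        ν i ∙ Σᴱ (λ j → (((ν j * ⟨ C ⊙ a i , a j ⟩) ∙ a j) ⊙ X) ⊙ a i ᵀ) ≡⟨ ∙-Σᴱ (ν i) _ ⟩
        Σᴱ (λ j → ν i ∙ ((((ν j * ⟨ C ⊙ a i , a j ⟩) ∙ a j) ⊙ X) ⊙ a i ᵀ))
          ≡⟨ (Σᴱ-cong λ j → trans (cong (ν i ∙_) (trans (cong (_⊙ a i ᵀ) (⊙-∙ˡ _ (a j) X)) (⊙-∙ˡ _ _ _))) (∙-assoc _ _ _)) ⟩
        Σᴱ (λ j → (ν i * (ν j * ⟨ C ⊙ a i , a j ⟩)) ∙ ((a j ⊙ X) ⊙ a i ᵀ)) ∎
      right : ∀ j → (ν j ∙ ((a j ⊙ X) ⊙ a j ᵀ)) ⊙ C ≡ Σᴱ λ i → (ν j * (ν i * ⟨ C ᵀ ⊙ a j , a i ⟩)) ∙ ((a j ⊙ X) ⊙ a i ᵀ)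
      right j = begin
        (ν j ∙ ((a j ⊙ X) ⊙ a j ᵀ)) ⊙ C ≡⟨ trans (⊙-∙ˡ _ _ C) (cong (ν j ∙_) (⊙-assoc _ _ C)) ⟩
        ν j ∙ ((a j ⊙ X) ⊙ (a j ᵀ ⊙ C)) ≡⟨ cong (λ Z → ν j ∙ ((a j ⊙ X) ⊙ Z)) (trans (cong (a j ᵀ ⊙_) (sym (ᵀᵀ C))) (sym (ᵀ-⊙ _ _))) ⟩
        ν j ∙ ((a j ⊙ X) ⊙ (C ᵀ ⊙ a j) ᵀ) ≡⟨ cong (λ Z → ν j ∙ ((a j ⊙ X) ⊙ Z ᵀ)) (expand basisA (⊙∈ (ᵀ∈ C∈) (vec∈ basisA j))) ⟩
        ν j ∙ ((a j ⊙ X) ⊙ proj a (C ᵀ ⊙ a j) ᵀ) ≡⟨ cong (ν j ∙_) (trans (cong ((a j ⊙ X) ⊙_) (Σ-ᵀ _)) (⊙-Σ _ _)) ⟩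
        ν j ∙ Σᴱ (λ i → (a j ⊙ X) ⊙ ((ν i * ⟨ C ᵀ ⊙ a j , a i ⟩) ∙ a i) ᵀ) ≡⟨ ∙-Σᴱ (ν j) _ ⟩
        Σᴱ (λ i → ν j ∙ ((a j ⊙ X) ⊙ ((ν i * ⟨ C ᵀ ⊙ a j , a i ⟩) ∙ a i) ᵀ))
          ≡⟨ (Σᴱ-cong λ i → trans (cong (ν j ∙_) (trans (cong ((a j ⊙ X) ⊙_) (ᵀ-∙ _ (a i))) (⊙-∙ʳ _ _ _))) (∙-assoc _ _ _)) ⟩
        Σᴱ (λ i → (ν j * (ν i * ⟨ C ᵀ ⊙ a j , a i ⟩)) ∙ ((a j ⊙ X) ⊙ a i ᵀ)) ∎

    casimir∈ : ∀ {B} → IsStarAlgebra B → (∀ X → A X → B X) → ∀ {X} → B X → B (casimir X)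
    casimir∈ starB A⊆B X∈ = B.Σ∈ λ i → B.∙∈ _ (B.⊙∈ (B.⊙∈ (A⊆B _ (vec∈ basisA i)) X∈) (B.ᵀ∈ (A⊆B _ (vec∈ basisA i))))
      where module B = IsStarAlgebra starB

    -- Multiplications by elements of `A` have adjoints that map `A` into itself, so orthogonality
    -- to `A` survives in every summand.
    casimir-⊥ : ∀ {X} → (∀ Y → A Y → ⟨ X , Y ⟩ ≡ 0F) → ∀ Y → A Y → ⟨ casimir X , Y ⟩ ≡ 0F
    casimir-⊥ {X} X⊥ Y Y∈ = trans (⟨⟩-Σˡ _ Y) (Σ-zero λ i → trans (⟨⟩-∙ˡ _ _ Y) (trans (*-congˡ (begin
      ⟨ (a i ⊙ X) ⊙ a i ᵀ , Y ⟩ ≡⟨ trans (⟨⟩-⊙ʳ _ _ Y) (⟨⟩-⊙ˡ _ _ _) ⟩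
      ⟨ X , a i ᵀ ⊙ (Y ⊙ a i ᵀ ᵀ) ⟩
        ≡⟨ X⊥ _ (⊙∈ (ᵀ∈ (vec∈ basisA i)) (⊙∈ Y∈ (ᵀ∈ (ᵀ∈ (vec∈ basisA i))))) ⟩
      0F ∎)) (zeroʳ _)))
      where open ≡-Reasoning

    Centre : M → Set
    Centre X = A X × Commutant A X

    -- The factors stand in the opposite order to the conjugation in `casimir`: on the commutant of
    -- `A`, the adjoint of `casimir` is multiplication by this element (`⟨⟩-casimir`).
    dual-gram : M
    dual-gram = gram (λ j → a j ᵀ) ν

    dual-gram∈ : A dual-gram
    dual-gram∈ = Σ∈ λ j → ∙∈ _ (⊙∈ (ᵀ∈ (vec∈ basisA j)) (ᵀ∈ (ᵀ∈ (vec∈ basisA j))))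

    ⟨⟩-casimir : ∀ X {Z} → Commutant A Z → ⟨ casimir X , Z ⟩ ≡ ⟨ X , dual-gram ⊙ Z ⟩
    ⟨⟩-casimir X {Z} Zc = begin
      ⟨ casimir X , Z ⟩ ≡⟨ ⟨⟩-Σˡ _ Z ⟩
      Σꟳ (λ j → ⟨ ν j ∙ ((a j ⊙ X) ⊙ a j ᵀ) , Z ⟩) ≡⟨ Σ-cong term ⟩
      Σꟳ (λ j → ⟨ X , (ν j ∙ (a j ᵀ ⊙ a j ᵀ ᵀ)) ⊙ Z ⟩) ≡⟨ ⟨⟩-Σʳ X _ ⟨
      ⟨ X , Σᴱ (λ j → (ν j ∙ (a j ᵀ ⊙ a j ᵀ ᵀ)) ⊙ Z) ⟩ ≡⟨ cong (λ W → ⟨ X , W ⟩) (Σ-⊙ Z _) ⟨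
      ⟨ X , dual-gram ⊙ Z ⟩ ∎
      where
      open ≡-Reasoning
      term : ∀ j → ⟨ ν j ∙ ((a j ⊙ X) ⊙ a j ᵀ) , Z ⟩ ≡ ⟨ X , (ν j ∙ (a j ᵀ ⊙ a j ᵀ ᵀ)) ⊙ Z ⟩
      term j = begin
        ⟨ ν j ∙ ((a j ⊙ X) ⊙ a j ᵀ) , Z ⟩ ≡⟨ trans (⟨⟩-∙ˡ _ _ Z) (*-congˡ (trans (⟨⟩-⊙ʳ _ _ Z) (⟨⟩-⊙ˡ _ _ _))) ⟩
        ν j * ⟨ X , a j ᵀ ⊙ (Z ⊙ a j ᵀ ᵀ) ⟩ ≡⟨ *-congˡ (cong (λ W → ⟨ X , a j ᵀ ⊙ W ⟩) (Zc _ (ᵀ∈ (ᵀ∈ (vec∈ basisA j))))) ⟨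
        ν j * ⟨ X , a j ᵀ ⊙ (a j ᵀ ᵀ ⊙ Z) ⟩ ≡⟨ trans (sym (⟨⟩-∙ʳ _ X _)) (cong (λ W → ⟨ X , W ⟩)
            (trans (cong (ν j ∙_) (sym (⊙-assoc _ _ Z))) (sym (⊙-∙ˡ _ _ Z)))) ⟩
        ⟨ X , (ν j ∙ (a j ᵀ ⊙ a j ᵀ ᵀ)) ⊙ Z ⟩ ∎

    casimir-trace : M
    casimir-trace = Σᴱ λ i → ν i ∙ (casimir (a i) ⊙ a i ᵀ)

    -- Each `casimir (a i)` is central, so it expands in the basis `ζ` of the centre. Its
    -- coefficients become `⟨ a i , dual-gram ⊙ ζ k ⟩` by `⟨⟩-casimir`, and the sum over `i`
    -- reassembles `dual-gram ⊙ ζ k`.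
    casimir-trace-factor : ∀ {l} (b : Basis Centre l) →
      casimir-trace ≡ gram (vec b) (λ k → norm⁻¹ (vec b k)) ⊙ dual-gram
    casimir-trace-factor b = begin
      casimir-trace ≡⟨ Σᴱ-cong outer ⟩
      Σᴱ (λ i → Σᴱ λ k → μ k ∙ (ζ k ⊙ ((ν i * ⟨ dual-gram ⊙ ζ k , a i ⟩) ∙ a i) ᵀ)) ≡⟨ Σᴱ-swap _ ⟩
      Σᴱ (λ k → Σᴱ λ i → μ k ∙ (ζ k ⊙ ((ν i * ⟨ dual-gram ⊙ ζ k , a i ⟩) ∙ a i) ᵀ)) ≡⟨ Σᴱ-cong inner ⟩
      Σᴱ (λ k → (μ k ∙ (ζ k ⊙ ζ k ᵀ)) ⊙ dual-gram) ≡⟨ Σ-⊙ dual-gram _ ⟨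
      gram ζ μ ⊙ dual-gram ∎
      where
      open ≡-Reasoning
      ζ = vec b
      μ = λ k → norm⁻¹ (ζ k)
      ζ∈ = λ k → proj₁ (vec∈ b k)
      centre : ∀ i → Centre (casimir (a i))
      centre i = casimir∈ starA (λ _ x → x) (vec∈ basisA i) , casimir-commutant (a i)
      term : ∀ i k → ((μ k * ⟨ casimir (a i) , ζ k ⟩) ∙ ζ k) ⊙ (ν i ∙ a i ᵀ) ≡
        μ k ∙ (ζ k ⊙ ((ν i * ⟨ dual-gram ⊙ ζ k , a i ⟩) ∙ a i) ᵀ)
      term i k = begin
        ((μ k * ⟨ casimir (a i) , ζ k ⟩) ∙ ζ k) ⊙ (ν i ∙ a i ᵀ) ≡⟨ trans (⊙-∙ˡ _ _ _) (sym (∙-assoc _ _ _)) ⟩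
        μ k ∙ ⟨ casimir (a i) , ζ k ⟩ ∙ (ζ k ⊙ (ν i ∙ a i ᵀ)) ≡⟨ cong (μ k ∙_) (⊙-∙ʳ _ _ _) ⟨
        μ k ∙ (ζ k ⊙ (⟨ casimir (a i) , ζ k ⟩ ∙ ν i ∙ a i ᵀ)) ≡⟨ cong (λ W → μ k ∙ (ζ k ⊙ W)) (∙-assoc _ _ _) ⟩
        μ k ∙ (ζ k ⊙ ((⟨ casimir (a i) , ζ k ⟩ * ν i) ∙ a i ᵀ)) ≡⟨ cong (λ s → μ k ∙ (ζ k ⊙ (s ∙ a i ᵀ)))
          (trans (*-comm _ (ν i)) (*-congˡ (trans (⟨⟩-casimir (a i) (proj₂ (vec∈ b k))) (⟨⟩-comm _ _)))) ⟩
        μ k ∙ (ζ k ⊙ ((ν i * ⟨ dual-gram ⊙ ζ k , a i ⟩) ∙ a i ᵀ)) ≡⟨ cong (λ W → μ k ∙ (ζ k ⊙ W)) (ᵀ-∙ _ _) ⟨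
        μ k ∙ (ζ k ⊙ ((ν i * ⟨ dual-gram ⊙ ζ k , a i ⟩) ∙ a i) ᵀ) ∎
      outer : ∀ i → ν i ∙ (casimir (a i) ⊙ a i ᵀ) ≡ Σᴱ λ k → μ k ∙ (ζ k ⊙ ((ν i * ⟨ dual-gram ⊙ ζ k , a i ⟩) ∙ a i) ᵀ)
      outer i = begin
        ν i ∙ (casimir (a i) ⊙ a i ᵀ) ≡⟨ ⊙-∙ʳ _ _ _ ⟨
        casimir (a i) ⊙ (ν i ∙ a i ᵀ) ≡⟨ cong (_⊙ (ν i ∙ a i ᵀ)) (expand b (centre i)) ⟩
        proj ζ (casimir (a i)) ⊙ (ν i ∙ a i ᵀ) ≡⟨ trans (Σ-⊙ _ _) (Σᴱ-cong (term i)) ⟩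
        Σᴱ (λ k → μ k ∙ (ζ k ⊙ ((ν i * ⟨ dual-gram ⊙ ζ k , a i ⟩) ∙ a i) ᵀ)) ∎
      inner : ∀ k → Σᴱ (λ i → μ k ∙ (ζ k ⊙ ((ν i * ⟨ dual-gram ⊙ ζ k , a i ⟩) ∙ a i) ᵀ)) ≡ (μ k ∙ (ζ k ⊙ ζ k ᵀ)) ⊙ dual-gram
      inner k = begin
        Σᴱ (λ i → μ k ∙ (ζ k ⊙ ((ν i * ⟨ dual-gram ⊙ ζ k , a i ⟩) ∙ a i) ᵀ)) ≡⟨ trans (cong (λ W → μ k ∙ W)
          (trans (cong (ζ k ⊙_) (Σ-ᵀ _)) (⊙-Σ _ _))) (∙-Σᴱ (μ k) _) ⟨
        μ k ∙ (ζ k ⊙ proj a (dual-gram ⊙ ζ k) ᵀ) ≡⟨ cong (λ W → μ k ∙ (ζ k ⊙ W ᵀ)) (expand basisA (⊙∈ dual-gram∈ (ζ∈ k))) ⟨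
        μ k ∙ (ζ k ⊙ (dual-gram ⊙ ζ k) ᵀ) ≡⟨ cong (λ W → μ k ∙ (ζ k ⊙ W)) (trans (ᵀ-⊙ _ _) (cong (ζ k ᵀ ⊙_) (gram-ᵀ _ _))) ⟩
        μ k ∙ (ζ k ⊙ (ζ k ᵀ ⊙ dual-gram)) ≡⟨ trans (⊙-∙ˡ _ _ _) (cong (μ k ∙_) (⊙-assoc _ _ _)) ⟨
        (μ k ∙ (ζ k ⊙ ζ k ᵀ)) ⊙ dual-gram ∎

    -- Right multiplication by either Gram factor is injective, because the identity lies in the
    -- spans of both families, the basis of the centre and the transposed basis of `A`.
    ⊙-casimir-trace≡0 : ∀ {l} → Basis Centre l → ∀ {X} → X ⊙ casimir-trace ≡ 0ᴱ → X ≡ 0ᴱ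
    ⊙-casimir-trace≡0 b {X} e = ⊙-basis≡0 b (one∈ , λ Y _ → Commute-one Y)
      (⊙-gram≡0 (weight-nonneg b) (weight≢0 b) (⊙-transposes≡0 basisA one∈
        (⊙-gram≡0 (weight-nonneg basisA) (weight≢0 basisA)
          (trans (⊙-assoc X _ _) (trans (cong (X ⊙_) (sym (casimir-trace-factor b))) e)))))

    -- For X ∈ B orthogonal to A the Casimir images of aⱼᵀX vanish, so
    -- 0 = Σⱼ aⱼ casimir(aⱼᵀX) / |aⱼ|² = Σᵢ casimir(aᵢ) X aᵢᵀ / |aᵢ|² = X casimir-trace.
    module _ {l} (basisZ : Basis Centre l) {B} (starB : IsStarAlgebra B) (A⊆B : ∀ X → A X → B X)
      (relative-commutant : ∀ X → B X → Commutant A X → A X × Commutant B X) where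
      private module B = IsStarAlgebra starB

      -- The image lies in `B` and commutes with `A`, hence lies in `A`; being orthogonal to `A`
      -- too, it is orthogonal to itself.
      casimir-⊥-≡0 : ∀ {X} → B X → (∀ Y → A Y → ⟨ X , Y ⟩ ≡ 0F) → casimir X ≡ 0ᴱ
      casimir-⊥-≡0 {X} X∈ X⊥ = ⟨⟩≡0⇒≡0 (casimir-⊥ X⊥ _ (proj₁ (relative-commutant _ (casimir∈ starB A⊆B X∈) (casimir-commutant X))))

      ⊥-⊙-casimir-trace : ∀ {X} → B X → (∀ Y → A Y → ⟨ X , Y ⟩ ≡ 0F) → X ⊙ casimir-trace ≡ 0ᴱ
      ⊥-⊙-casimir-trace {X} X∈ X⊥ = begin
        X ⊙ casimir-trace ≡⟨ trans (⊙-Σ X _) (Σᴱ-cong λ i → ⊙-∙ʳ _ X _) ⟩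
        Σᴱ (λ i → ν i ∙ (X ⊙ (casimir (a i) ⊙ a i ᵀ))) ≡⟨ Σᴱ-cong regroup ⟩
        Σᴱ (λ i → Σᴱ λ j → T j i) ≡⟨ Σᴱ-swap _ ⟩
        Σᴱ (λ j → Σᴱ λ i → T j i) ≡⟨ Σᴱ-cong expand-casimir ⟨
        Σᴱ (λ j → ν j ∙ (a j ⊙ casimir (a j ᵀ ⊙ X))) ≡⟨ Σᴱ-zero (λ j → trans (cong (λ W → ν j ∙ (a j ⊙ W)) (vanish j))
            (trans (cong (ν j ∙_) (⊙-zeroʳ _)) (∙-zeroʳ _))) ⟩
        0ᴱ ∎
        where
        open ≡-Reasoning
        T : Fin k → Fin k → M
        T j i = (ν i * ν j) ∙ ((((a j ⊙ a i) ⊙ a j ᵀ) ⊙ X) ⊙ a i ᵀ)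
        vanish : ∀ j → casimir (a j ᵀ ⊙ X) ≡ 0ᴱ
        vanish j = casimir-⊥-≡0 (B.⊙∈ (B.ᵀ∈ (A⊆B _ (vec∈ basisA j))) X∈)
          (λ Y Y∈ → trans (⟨⟩-⊙ˡ _ X Y) (X⊥ _ (⊙∈ (ᵀ∈ (ᵀ∈ (vec∈ basisA j))) Y∈)))
        regroup : ∀ i → ν i ∙ (X ⊙ (casimir (a i) ⊙ a i ᵀ)) ≡ Σᴱ λ j → T j i
        regroup i = begin
          ν i ∙ (X ⊙ (casimir (a i) ⊙ a i ᵀ)) ≡⟨ cong (ν i ∙_) (⊙-assoc _ _ _) ⟨
          ν i ∙ ((X ⊙ casimir (a i)) ⊙ a i ᵀ) ≡⟨ cong (λ W → ν i ∙ (W ⊙ a i ᵀ))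
            (proj₂ (relative-commutant _ (casimir∈ starB A⊆B (A⊆B _ (vec∈ basisA i))) (casimir-commutant (a i))) X X∈) ⟩
          ν i ∙ ((casimir (a i) ⊙ X) ⊙ a i ᵀ) ≡⟨ cong (ν i ∙_) (trans (cong (_⊙ a i ᵀ) (Σ-⊙ X _)) (Σ-⊙ _ _)) ⟩
          ν i ∙ Σᴱ (λ j → ((ν j ∙ ((a j ⊙ a i) ⊙ a j ᵀ)) ⊙ X) ⊙ a i ᵀ) ≡⟨ ∙-Σᴱ (ν i) _ ⟩
          Σᴱ (λ j → ν i ∙ (((ν j ∙ ((a j ⊙ a i) ⊙ a j ᵀ)) ⊙ X) ⊙ a i ᵀ))
            ≡⟨ (Σᴱ-cong λ j → trans (cong (ν i ∙_) (trans (cong (_⊙ a i ᵀ) (⊙-∙ˡ _ _ X)) (⊙-∙ˡ _ _ _))) (∙-assoc _ _ _)) ⟩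
          Σᴱ (λ j → T j i) ∎
        expand-casimir : ∀ j → ν j ∙ (a j ⊙ casimir (a j ᵀ ⊙ X)) ≡ Σᴱ λ i → T j i
        expand-casimir j = begin
          ν j ∙ (a j ⊙ casimir (a j ᵀ ⊙ X)) ≡⟨ trans (cong (ν j ∙_) (⊙-Σ _ _)) (∙-Σᴱ (ν j) _) ⟩
          Σᴱ (λ i → ν j ∙ (a j ⊙ (ν i ∙ ((a i ⊙ (a j ᵀ ⊙ X)) ⊙ a i ᵀ))))
            ≡⟨ (Σᴱ-cong λ i → trans (cong (ν j ∙_) (⊙-∙ʳ _ _ _)) (trans (∙-assoc _ _ _) (cong₂ _∙_ (*-comm _ _)
              (trans (sym (⊙-assoc _ _ _)) (cong (_⊙ a i ᵀ) (trans (sym (⊙-assoc _ _ _)) (sym (⊙-assoc _ _ _)))))))) ⟩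
          Σᴱ (λ i → T j i) ∎

      relative-commutant⇒⊆ : ∀ X → B X → A X
      relative-commutant⇒⊆ X X∈ = subst A (sym (⊖≡0⇒≡ (⊙-casimir-trace≡0 basisZ (⊥-⊙-casimir-trace R∈ R⊥)))) (proj∈ (vec∈ basisA) X)
        where
        R∈ : B (X ⊖ proj a X)
        R∈ = B.⊖∈ X∈ (B.proj∈ (λ i → A⊆B _ (vec∈ basisA i)) X)
        R⊥ : ∀ Y → A Y → ⟨ X ⊖ proj a X , Y ⟩ ≡ 0F
        R⊥ Y Y∈ = ⊥-basis basisA (⟨⟩-⊖-proj (vec-orthogonal basisA) X) Y∈

-- Finite choice under double negation, and increasing chains

dependent-choice : {X : Set} {P : ℕ → X → Set} {Q : ℕ → X → X → Set} →
  ¬ ¬ Σ X (P 0) → (∀ i x → P i x → ¬ ¬ Σ X λ y → P (suc i) y × Q i x y) →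
  ∀ m → ¬ ¬ Σ (ℕ → X) λ f → (∀ i → i ℕ.≤ m → P i (f i)) × (∀ i → i ℕ.< m → Q i (f i) (f (suc i)))
dependent-choice {X} start step m = start >>= λ { (x , p) → go step m x p >>= λ { (f , _ , h) → return (f , h) } }
  where
  -- Double negation passes through finitely many choices, not through an infinite sequence of them.
  -- So choices are made up to `m`, and the sequence is constant afterwards.
  go : {P : ℕ → X → Set} {Q : ℕ → X → X → Set} →
    (∀ i x → P i x → ¬ ¬ Σ X λ y → P (suc i) y × Q i x y) → ∀ m x → P 0 x →
    ¬ ¬ Σ (ℕ → X) λ f → f 0 ≡ x × (∀ i → i ℕ.≤ m → P i (f i)) × (∀ i → i ℕ.< m → Q i (f i) (f (suc i)))
  go step zero x p = return ((λ _ → x) , refl , (λ { zero _ → p }) , (λ _ ()))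
  go {P} {Q} step (suc m) x p = step 0 x p >>= λ { (y , py , q) → go (step ∘ suc) m y py >>= λ { (f , f0 , hp , hq) →
    return ((λ { zero → x ; (suc i) → f i }) , refl
      , (λ { zero _ → p ; (suc i) (ℕ.s≤s le) → hp i le })
      , (λ { zero _ → subst (Q 0 x) (sym f0) q ; (suc i) (ℕ.s≤s le) → hq i le })) } }

choice : {X : Set} {P : ℕ → X → Set} → (∀ i → ¬ ¬ Σ X (P i)) → ∀ m → ¬ ¬ Σ (ℕ → X) λ f → ∀ i → i ℕ.≤ m → P i (f i)
choice {P = P} h m = dependent-choice {P = P} {Q = λ _ _ _ → 0 ≡ 0} (h 0) (λ i _ _ → h (suc i) >>= λ { (y , p) → return (y , p , refl) }) m
  >>= λ { (f , p , _) → return (f , p) }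

ascend : ∀ {ℓ a} {A : Set a} (P : ℕ → A → Set ℓ) m → (∀ i → i ℕ.< m → ∀ x → P i x → P (suc i) x) →
  ∀ {i j} → i ℕ.≤ j → j ℕ.≤ m → ∀ x → P i x → P j x
ascend P m step i≤j = go (ℕ.≤⇒≤′ i≤j)
  where
  go : ∀ {i j} → i ℕ.≤′ j → j ℕ.≤ m → ∀ x → P i x → P j x
  go ℕ.≤′-refl _ x p = p
  go (ℕ.≤′-step le) j<m x p = step _ j<m x (go le (ℕ.<⇒≤ j<m) x p)

-- If all inclusions up to index `N` were strict, the dimension at `m` would be at least `m` for
-- every `m` up to `suc N`, which exceeds the dimension of the whole space.
stationary : ∀ {N} {P : ℕ → E N → Set} → (∀ j → IsSubspace (P j)) → (∀ j x → P j x → P (suc j) x) →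
  ¬ ¬ ∃ λ j → j ℕ.≤ N × (∀ x → P (suc j) x → P j x)
stationary {N} {P} sub inc = choice {P = λ j → Basis (P j)} (λ j → basis (sub j)) (suc N) >>= λ { (d , b) → return (search d b) }
  where
  Stationary = ∃ λ j → j ℕ.≤ N × (∀ x → P (suc j) x → P j x)
  search : (d : ℕ → ℕ) → (∀ j → j ℕ.≤ suc N → Basis (P j) (d j)) → Stationary
  search d b with go (suc N) ℕ.≤-refl
    where
    go : ∀ m → m ℕ.≤ suc N → Stationary ⊎ m ℕ.≤ d m
    go zero _ = inj₂ ℕ.z≤n
    go (suc m) m<N@(ℕ.s≤s m≤N) with go m (ℕ.<⇒≤ m<N)
    ... | inj₁ r = inj₁ r
    ... | inj₂ le with d m ℕ.≟ d (suc m)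
    ...   | yes e = inj₁ (m , m≤N , basis-≡ (sub m) (sub (suc m)) (inc m) (b m (ℕ.<⇒≤ m<N)) (subst (Basis _) (sym e) (b (suc m) m<N)))
    ...   | no ne = inj₂ (ℕ.≤-<-trans le (ℕ.≤∧≢⇒< (basis-≤ (inc m) (b m (ℕ.<⇒≤ m<N)) (b (suc m) m<N)) ne))
  ... | inj₁ r = r
  ... | inj₂ le = ⊥-elim (ℕ.<⇒≱ le (orthogonal-≤N (vec-orthogonal (b (suc N) ℕ.≤-refl))))

-- Maximal commutative star subalgebras

module Commuting (n : ℕ) where
  open Matrices n

  record IsCommuting (A : M → Set) {k} (c : Family (n ℕ.* n) k) : Set where
    field
      family∈ : ∀ i → A (c i)
      symmetric : ∀ i → c i ᵀ ≡ c i ⊎ c i ᵀ ≡ -1F ∙ c i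
      commute : ∀ i j → Commute (c i) (c j)
      isOrthogonal : IsOrthogonal c
  open IsCommuting

  Centralizer : (M → Set) → ∀ {k} → Family (n ℕ.* n) k → M → Set
  Centralizer A c X = A X × (∀ i → Commute (c i) X)

  module _ {A} (starA : IsStarAlgebra A) {k} {c : Family (n ℕ.* n) k} where
    open IsStarAlgebra starA

    centralizer-subspace : IsSubspace (Centralizer A c)
    centralizer-subspace = record
      { 0∈ = 0∈ , λ i → Commute-0 _
      ; ⊕∈ = λ x y → ⊕∈ (proj₁ x) (proj₁ y) , λ i → Commute-⊕ (proj₂ x i) (proj₂ y i)
      ; ∙∈ = λ s x → ∙∈ s (proj₁ x) , λ i → Commute-∙ s (proj₂ x i) }

    module _ (com : IsCommuting A c) where
      private
        ᵀ-commute : ∀ i {X} → Commute (c i) X → Commute (c i ᵀ) X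
        ᵀ-commute i {X} p with symmetric com i
        ... | inj₁ e = subst (λ Y → Commute Y X) (sym e) p
        ... | inj₂ e = subst (λ Y → Commute Y X) (sym e) (sym (Commute-∙ -1F (sym p)))

        ᵀ-⊥ : ∀ i {X} → ⟨ X , c i ⟩ ≡ 0F → ⟨ X ᵀ , c i ⟩ ≡ 0F
        ᵀ-⊥ i {X} p with symmetric com i
        ... | inj₁ e = trans (cong (λ Y → ⟨ X ᵀ , Y ⟩) (sym e)) (trans (⟨⟩-ᵀ X (c i)) p)
        ... | inj₂ e = *-cancelˡ-0 -1≢0 (trans (sym (⟨⟩-∙ʳ -1F _ _)) (trans (cong (λ Y → ⟨ X ᵀ , Y ⟩) (sym e)) (trans (⟨⟩-ᵀ X (c i)) p)))
          where
          -1≢0 : -1F ≢ 0F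
          -1≢0 e′ = 1≢0 (trans (sym (+-identityʳ 1F)) (trans (+-congˡ (trans (sym (trans (*-congʳ e′) (zeroˡ 1F))) refl)) (-1*-cancelʳ 1F)))

      centralizer-ᵀ : ∀ {X} → Centralizer A c X → Centralizer A c (X ᵀ)
      centralizer-ᵀ (X∈ , p) = ᵀ∈ X∈ , λ i → Commute-ᵀ (ᵀ-commute i (p i))

      extend : ∀ {X} → Centralizer A c X → (X ᵀ ≡ X ⊎ X ᵀ ≡ -1F ∙ X) → (∀ i → ⟨ X , c i ⟩ ≡ 0F) →
        ⟨ X , X ⟩ ≢ 0F → IsCommuting A (X ◂ c)
      extend {X} (X∈ , p) s X⊥ X≢0 = record
        { family∈ = λ { zero → X∈ ; (suc i) → family∈ com i }
        ; symmetric = λ { zero → s ; (suc i) → symmetric com i }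
        ; commute = λ { zero zero → refl ; zero (suc j) → sym (p j) ; (suc i) zero → p i ; (suc i) (suc j) → commute com i j }
        ; isOrthogonal = ◂-orthogonal (isOrthogonal com) X≢0 X⊥ }

      -- A residual X orthogonal to c splits as symmetric plus skew part, and neither can extend a maximal family.
      centralizer-expand : (∀ X → ¬ IsCommuting A (X ◂ c)) → ∀ {X} → Centralizer A c X → X ≡ proj c X
      centralizer-expand max {X} X∈ = ⊖≡0⇒≡ R≡0
        where
        R = X ⊖ proj c X
        c∈ : ∀ i → Centralizer A c (c i)
        c∈ i = family∈ com i , λ j → commute com j i
        R∈ : Centralizer A c R
        R∈ = IsSubspace.⊖∈ centralizer-subspace X∈ (IsSubspace.proj∈ centralizer-subspace c∈ X)
        vanish : ∀ {Y} → Centralizer A c Y → (Y ᵀ ≡ Y ⊎ Y ᵀ ≡ -1F ∙ Y) → (∀ i → ⟨ Y , c i ⟩ ≡ 0F) → Y ≡ 0ᴱ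
        vanish {Y} Y∈ s Y⊥ with ⟨ Y , Y ⟩ ≟ 0F
        ... | yes e = ⟨⟩≡0⇒≡0 e
        ... | no ne = ⊥-elim (max Y (extend Y∈ s Y⊥ ne))
        R⊥ : ∀ i → ⟨ R , c i ⟩ ≡ 0F
        R⊥ = ⟨⟩-⊖-proj (isOrthogonal com) X
        R⊕Rᵀ≡0 : R ⊕ R ᵀ ≡ 0ᴱ
        R⊕Rᵀ≡0 = vanish (IsSubspace.⊕∈ centralizer-subspace R∈ (centralizer-ᵀ R∈))
          (inj₁ (trans (ᵀ-⊕ _ _) (trans (cong (R ᵀ ⊕_) (ᵀᵀ R)) (⊕-comm _ _))))
          (λ i → trans (⟨⟩-⊕ˡ _ _ _) (trans (cong₂ _+_ (R⊥ i) (ᵀ-⊥ i (R⊥ i))) (+-identityˡ 0F)))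
        R≡0 : R ≡ 0ᴱ
        R≡0 = vanish R∈ (inj₂ (neg-unique R⊕Rᵀ≡0)) R⊥

  Extends : ∀ {k l} → Family (n ℕ.* n) k → Family (n ℕ.* n) l → Set
  Extends c c′ = ∀ i → ∃ λ j → c′ j ≡ c i

  MaximalCommuting : (M → Set) → Σ ℕ (Family (n ℕ.* n)) → Set
  MaximalCommuting A (k , c) = IsCommuting A c × (∀ X → ¬ IsCommuting A (X ◂ c))

  maximalCommuting : ∀ {A k} {c : Family (n ℕ.* n) k} → IsCommuting A c →
    ¬ ¬ Σ (Σ ℕ (Family (n ℕ.* n))) λ c′ → MaximalCommuting A c′ × Extends c (proj₂ c′)
  maximalCommuting {A} {k} {c} com = maximal P (λ _ p → orthogonal-≤N (isOrthogonal (proj₁ (proj₂ p)))) (c , com , λ i → i , refl)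
    >>= λ { (l , (c′ , com′ , c⊆) , max) → return ((l , c′) , (com′ , λ X p → max (X ◂ c′ , p , λ i → suc (proj₁ (c⊆ i)) , proj₂ (c⊆ i))) , c⊆) }
    where
    P : ℕ → Set
    P l = Σ (Family (n ℕ.* n) l) λ c′ → IsCommuting A c′ × Extends c c′

  IsCommuting-⊆ : ∀ {A B : M → Set} {k} {c : Family (n ℕ.* n) k} → (∀ X → A X → B X) → IsCommuting A c → IsCommuting B c
  IsCommuting-⊆ A⊆B com = record
    { family∈ = λ i → A⊆B _ (family∈ com i) ; symmetric = symmetric com ; commute = commute com ; isOrthogonal = isOrthogonal com }

  empty-commuting : ∀ {A} → IsCommuting A {0} (λ ())
  empty-commuting = record
    { family∈ = λ () ; symmetric = λ () ; commute = λ () ; isOrthogonal = record { orthogonal = λ () ; nonzero = λ () } }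

  record IsTorus (T : M → Set) : Set where
    field
      isSubspace : IsSubspace T
      one∈ : T one
      ᵀ∈ : ∀ {X} → T X → T (X ᵀ)
      commutes : ∀ {X Y} → T X → T Y → Commute X Y
    open IsSubspace isSubspace public

  Commute-proj : ∀ {X k} {c : Family (n ℕ.* n) k} → (∀ i → Commute X (c i)) → ∀ Y → Commute X (proj c Y)
  Commute-proj {X} {c = c} h Y = IsSubspace.proj∈ {P = Commute X} record
    { 0∈ = Commute-0 X ; ⊕∈ = Commute-⊕ ; ∙∈ = λ s → Commute-∙ s } {c = c} h Y

  centralizer-torus : ∀ {A k c} → IsStarAlgebra A → MaximalCommuting A (k , c) → IsTorus (Centralizer A c)
  centralizer-torus {c = c} starA (com , max) = record
    { isSubspace = centralizer-subspace starA
    ; one∈ = IsStarAlgebra.one∈ starA , λ i → Commute-one _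
    ; ᵀ∈ = centralizer-ᵀ starA com
    -- By maximality `Y` is a combination of the family, and `X` commutes with each member.
    ; commutes = λ {X} {Y} X∈ Y∈ → subst (Commute X) (sym (centralizer-expand starA com max Y∈))
        (Commute-proj {c = c} (λ i → sym (proj₂ X∈ i)) Y) }

  -- A separating vector is a sum of a maximal family of vectors generating mutually orthogonal T-submodules.
  separating-vector : ∀ {T} → IsTorus T → ¬ ¬ Σ V λ v → ∀ {X} → T X → app X v ≡ 0ᴱ → X ≡ 0ᴱ
  separating-vector {T} torus = maximal P (λ _ p → orthogonal-≤N (orth p)) empty >>= λ { (k , p , max) →
    return (Σᴱ (proj₁ p) , λ {X} X∈ e → annihilator k p max X∈ e) }
    where
    open IsTorus torus
    P : ℕ → Set
    P k = Σ (Family n k) λ v → (∀ i j → i ≢ j → ∀ {X Y} → T X → T Y → ⟨ app X (v i) , app Y (v j) ⟩ ≡ 0F) × (∀ i → ⟨ v i , v i ⟩ ≢ 0F)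
    empty : P 0
    empty = (λ ()) , (λ ()) , λ ()
    orth : ∀ {k} (p : P k) → IsOrthogonal (proj₁ p)
    orth (v , v⊥ , nz) = record
      { orthogonal = λ i j i≢j → trans (sym (cong₂ ⟨_,_⟩ (app-one _) (app-one _))) (v⊥ i j i≢j one∈ one∈) ; nonzero = nz }
    -- If `X` kills the sum, orthogonality of the submodules makes it kill every `v i`. Then, for
    -- any `w`, the submodule generated by `app (X ᵀ) w` is orthogonal to all the others, so
    -- maximality forces this vector to be zero.
    annihilator : ∀ k (p : P k) → ¬ P (suc k) → ∀ {X} → T X → app X (Σᴱ (proj₁ p)) ≡ 0ᴱ → X ≡ 0ᴱ
    annihilator k (v , v⊥ , nz) max {X} X∈ e = ᵀ-injective (trans (app-unit≡0⇒≡0 λ j → image (unit j)) (sym ᵀ-zero))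
      where
      open ≡-Reasoning
      Xv≡0 : ∀ i → app X (v i) ≡ 0ᴱ
      Xv≡0 i = ⟨⟩≡0⇒≡0 (begin
        ⟨ app X (v i) , app X (v i) ⟩ ≡⟨ Σ-single (λ j → ⟨ app X (v i) , app X (v j) ⟩) i (λ j j≢i → v⊥ i j (j≢i ∘ sym) X∈ X∈) ⟨
        Σꟳ (λ j → ⟨ app X (v i) , app X (v j) ⟩) ≡⟨ ⟨⟩-Σʳ _ _ ⟨
        ⟨ app X (v i) , Σᴱ (λ j → app X (v j)) ⟩ ≡⟨ cong (λ w → ⟨ app X (v i) , w ⟩) (trans (sym (app-Σ X v)) e) ⟩
        ⟨ app X (v i) , 0ᴱ ⟩ ≡⟨ ⟨⟩-0ʳ _ ⟩
        0F ∎)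
      image-⊥ : ∀ w j {Y Z} → T Y → T Z → ⟨ app Y (app (X ᵀ) w) , app Z (v j) ⟩ ≡ 0F
      image-⊥ w j {Y} {Z} Y∈ Z∈ = begin
        ⟨ app Y (app (X ᵀ) w) , app Z (v j) ⟩ ≡⟨ trans (⟨⟩-app Y _ _) (⟨⟩-app (X ᵀ) _ _) ⟩
        ⟨ w , app (X ᵀ ᵀ) (app (Y ᵀ) (app Z (v j))) ⟩ ≡⟨ cong (λ u → ⟨ w , u ⟩) (begin
          app (X ᵀ ᵀ) (app (Y ᵀ) (app Z (v j))) ≡⟨ cong (λ W → app W _) (ᵀᵀ X) ⟩
          app X (app (Y ᵀ) (app Z (v j))) ≡⟨ swap X (Y ᵀ) (commutes X∈ (ᵀ∈ Y∈)) _ ⟩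
          app (Y ᵀ) (app X (app Z (v j))) ≡⟨ cong (app (Y ᵀ)) (swap X Z (commutes X∈ Z∈) _) ⟩
          app (Y ᵀ) (app Z (app X (v j))) ≡⟨ cong (λ u → app (Y ᵀ) (app Z u)) (Xv≡0 j) ⟩
          app (Y ᵀ) (app Z 0ᴱ) ≡⟨ trans (cong (app (Y ᵀ)) (app-zeroʳ Z)) (app-zeroʳ _) ⟩
          0ᴱ ∎) ⟩
        ⟨ w , 0ᴱ ⟩ ≡⟨ ⟨⟩-0ʳ w ⟩
        0F ∎
        where
        swap : ∀ Y Z → Commute Y Z → ∀ u → app Y (app Z u) ≡ app Z (app Y u)
        swap Y Z p u = trans (sym (app-⊙ Y Z u)) (trans (cong (λ W → app W u) p) (app-⊙ Z Y u))
      image : ∀ w → app (X ᵀ) w ≡ 0ᴱ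
      image w with ⟨ app (X ᵀ) w , app (X ᵀ) w ⟩ ≟ 0F
      ... | yes e′ = ⟨⟩≡0⇒≡0 e′
      ... | no ne = ⊥-elim (max (app (X ᵀ) w ◂ v , ⊥′ , λ { zero → ne ; (suc i) → nz i }))
        where
        ⊥′ : ∀ i j → i ≢ j → ∀ {Y Z} → T Y → T Z → ⟨ app Y ((app (X ᵀ) w ◂ v) i) , app Z ((app (X ᵀ) w ◂ v) j) ⟩ ≡ 0F
        ⊥′ zero zero i≢j _ _ = ⊥-elim (i≢j refl)
        ⊥′ zero (suc j) _ Y∈ Z∈ = image-⊥ w j Y∈ Z∈
        ⊥′ (suc i) zero _ Y∈ Z∈ = trans (⟨⟩-comm _ _) (image-⊥ w i Z∈ Y∈)
        ⊥′ (suc i) (suc j) i≢j Y∈ Z∈ = v⊥ i j (i≢j ∘ cong suc) Y∈ Z∈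

  -- When `v` separates `T`, acting on `v` is injective, so the dimension of `T` can be measured
  -- inside the n-dimensional space `V`. Counting among matrices would give only n².
  Orbit : (M → Set) → V → V → Set
  Orbit T v x = Σ M λ X → T X × x ≡ app X v

  orbit-subspace : ∀ {T} → IsSubspace T → ∀ v → IsSubspace (Orbit T v)
  orbit-subspace sub v = record
    { 0∈ = 0ᴱ , 0∈ , sym (app-zeroˡ v)
    ; ⊕∈ = λ { (X , X∈ , refl) (Y , Y∈ , refl) → X ⊕ Y , ⊕∈ X∈ Y∈ , sym (app-⊕ X Y v) }
    ; ∙∈ = λ { s (X , X∈ , refl) → s ∙ X , ∙∈ s X∈ , sym (app-∙ s X v) } }
    where open IsSubspace sub

-- As long as no coincidence occurs, every step raises the potential d k + e m − e (m ∸ k), which starts at 1 or more and is at most 2 n.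
coincidence : ∀ {n} (d e : ℕ → ℕ) (m : ℕ) → n ℕ.+ n ℕ.≤ m →
  (∀ i → i ℕ.≤ m → 1 ℕ.≤ d i) → (∀ i → i ℕ.≤ m → d i ℕ.≤ n) → (∀ i → i ℕ.≤ m → e i ℕ.≤ n) →
  (∀ i → i ℕ.< m → d i ℕ.≤ d (suc i)) → (∀ i → i ℕ.< m → e i ℕ.≤ e (suc i)) →
  ∃ λ i → i ℕ.< m × d i ≡ d (suc i) × e (m ℕ.∸ suc i) ≡ e (suc (m ℕ.∸ suc i))
coincidence {n} d e m 2n≤m 1≤d d≤n e≤n d↑ e↑ with go m ℕ.≤-refl
  where
  Coincidence = ∃ λ i → i ℕ.< m × d i ≡ d (suc i) × e (m ℕ.∸ suc i) ≡ e (suc (m ℕ.∸ suc i))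
  ∸-suc : ∀ {k} → k ℕ.< m → m ℕ.∸ k ≡ suc (m ℕ.∸ suc k)
  ∸-suc k<m = ℕ.+-∸-assoc 1 k<m
  m∸<m : ∀ {k} → k ℕ.< m → m ℕ.∸ suc k ℕ.< m
  m∸<m {k} k<m = subst (ℕ._≤ m) (∸-suc k<m) (ℕ.m∸n≤m m k)
  -- The right alternative says without subtraction that the potential is at least `suc k`; the
  -- initial surplus comes from `1 ≤ d 0`.
  go : ∀ k → k ℕ.≤ m → Coincidence ⊎ suc k ℕ.+ e (m ℕ.∸ k) ℕ.≤ d k ℕ.+ e m
  go zero _ = inj₂ (ℕ.+-monoˡ-≤ (e m) (1≤d 0 ℕ.z≤n))
  go (suc k) k<m with go k (ℕ.<⇒≤ k<m)
  ... | inj₁ r = inj₁ r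
  ... | inj₂ le with d k ℕ.≟ d (suc k) | e (m ℕ.∸ suc k) ℕ.≟ e (suc (m ℕ.∸ suc k))
  ...   | yes p | yes q = inj₁ (k , k<m , p , q)
  ...   | no p | _ = inj₂ (begin
    suc (suc k) ℕ.+ e (m ℕ.∸ suc k) ≤⟨ ℕ.+-monoʳ-≤ (suc (suc k)) (e↑ _ (m∸<m k<m)) ⟩
    suc (suc k) ℕ.+ e (suc (m ℕ.∸ suc k)) ≡⟨ cong (λ j → suc (suc k) ℕ.+ e j) (∸-suc k<m) ⟨
    suc (suc k ℕ.+ e (m ℕ.∸ k)) ≤⟨ ℕ.s≤s le ⟩
    suc (d k) ℕ.+ e m ≤⟨ ℕ.+-monoˡ-≤ (e m) (ℕ.≤∧≢⇒< (d↑ k k<m) p) ⟩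
    d (suc k) ℕ.+ e m ∎)
    where open ℕ.≤-Reasoning
  ...   | yes p | no q = inj₂ (begin
    suc (suc k) ℕ.+ e (m ℕ.∸ suc k) ≡⟨ ℕ.+-suc (suc k) _ ⟨
    suc k ℕ.+ suc (e (m ℕ.∸ suc k)) ≤⟨ ℕ.+-monoʳ-≤ (suc k) (ℕ.≤∧≢⇒< (e↑ _ (m∸<m k<m)) q) ⟩
    suc k ℕ.+ e (suc (m ℕ.∸ suc k)) ≡⟨ cong (λ j → suc k ℕ.+ e j) (∸-suc k<m) ⟨
    suc k ℕ.+ e (m ℕ.∸ k) ≤⟨ le ⟩
    d k ℕ.+ e m ≡⟨ cong (ℕ._+ e m) p ⟩
    d (suc k) ℕ.+ e m ∎)
    where open ℕ.≤-Reasoning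
... | inj₁ r = r
... | inj₂ le = ⊥-elim (ℕ.<-irrefl refl (begin-strict
    m ≤⟨ ℕ.m≤m+n m _ ⟩
    m ℕ.+ e (m ℕ.∸ m) <⟨ le ⟩
    d m ℕ.+ e m ≤⟨ ℕ.+-mono-≤ (d≤n m ℕ.≤-refl) (e≤n m ℕ.≤-refl) ⟩
    n ℕ.+ n ≤⟨ 2n≤m ⟩
    m ∎))
    where open ℕ.≤-Reasoning

-- Increasing chains of star algebras

module StarChains (n : ℕ) where
  open Matrices n
  open Casimir n
  open Commuting n
  open IsCommuting

  -- What the counting argument asks of one chain. It is instantiated twice, with the algebras and
  -- with their commutants; the last field is the gain from two equal dimensions.
  record Dimensions (A : ℕ → M → Set) (m : ℕ) : Set where
    field
      dim : ℕ → ℕ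
      1≤dim : ∀ i → i ℕ.≤ m → 1 ℕ.≤ dim i
      dim≤n : ∀ i → i ℕ.≤ m → dim i ℕ.≤ n
      dim-mono : ∀ i → i ℕ.< m → dim i ℕ.≤ dim (suc i)
      relative-commutant : ∀ i → i ℕ.< m → dim i ≡ dim (suc i) → ∀ X → A (suc i) X → Commutant (A i) X → A i X

  -- dim i is the dimension of T i · v, for an increasing sequence of maximal commutative
  -- star subalgebras T i ⊆ A i and a vector v separating the largest of them.
  dimensions : Fin n → (A : ℕ → M → Set) → (∀ i → IsStarAlgebra (A i)) → (∀ i X → A i X → A (suc i) X) →
    ∀ m → ¬ ¬ Dimensions A m
  dimensions i₀ A star A↑ m =
    dependent-choice {P = λ i → MaximalCommuting (A i)} {Q = λ i c c′ → Extends (proj₂ c) (proj₂ c′)}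
      (maximalCommuting empty-commuting >>= λ { (c , max , _) → return (c , max) })
      (λ { i (k , c) (com , _) → maximalCommuting (IsCommuting-⊆ (A↑ i) com) }) m >>= λ { (c , max , ext) →
    separating-vector (centralizer-torus {c = proj₂ (c m)} (star m) (max m ℕ.≤-refl)) >>= λ { (v , separating) →
    choice {P = λ i → Basis (Orbit (Centralizer (A i) (proj₂ (c i))) v)} (λ i → basis (orbit-subspace (centralizer-subspace (star i) {c = proj₂ (c i)}) v)) m >>= λ { (d , b) →
    return (build c max ext v separating d b) } } }
    where
    build : (c : ℕ → Σ ℕ (Family (n ℕ.* n))) (max : ∀ i → i ℕ.≤ m → MaximalCommuting (A i) (c i))
      (extends : ∀ i → i ℕ.< m → Extends (proj₂ (c i)) (proj₂ (c (suc i)))) (v : V)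
      (separating : ∀ {X} → Centralizer (A m) (proj₂ (c m)) X → app X v ≡ 0ᴱ → X ≡ 0ᴱ) (d : ℕ → ℕ)
      (b : ∀ i → i ℕ.≤ m → Basis (Orbit (Centralizer (A i) (proj₂ (c i))) v) (d i)) → Dimensions A m
    build c max extends v separating d b = record
      { dim = d
      ; 1≤dim = λ i i≤m → positive i (b i i≤m)
      ; dim≤n = λ i i≤m → orthogonal-≤N (vec-orthogonal (b i i≤m))
      ; dim-mono = λ i i<m → basis-≤ (orbit↑ i i<m) (b i (ℕ.<⇒≤ i<m)) (b (suc i) i<m)
      -- Equal dimensions give `T (suc i)` inside `T i`, so the generators of `T (suc i)` lie in
      -- `A i` and `X` commutes with them. Hence `X` is in `T (suc i)`, and so in `T i`.
      ; relative-commutant = λ i i<m e X X∈ Xc → proj₁ (T↓ i i<m e X (X∈ , λ j →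
          Xc _ (proj₁ (T↓ i i<m e _ (c∈ (suc i) i<m j))))) }
      where
      T : ℕ → M → Set
      T i = Centralizer (A i) (proj₂ (c i))
      subT : ∀ i → IsSubspace (T i)
      subT i = centralizer-subspace (star i)
      c∈ : ∀ i (i≤m : i ℕ.≤ m) j → T i (proj₂ (c i) j)
      c∈ i i≤m j = family∈ (proj₁ (max i i≤m)) j , λ l → commute (proj₁ (max i i≤m)) l j
      -- Maximality makes `X` a combination of the family at `i`, whose members all reappear in the
      -- commuting family at `suc i`.
      T↑ : ∀ i → i ℕ.< m → ∀ X → T i X → T (suc i) X
      T↑ i i<m X X∈ = A↑ i X (proj₁ X∈) , λ l →
        subst (Commute _) (sym (centralizer-expand (star i) (proj₁ (max i i≤m)) (proj₂ (max i i≤m)) X∈))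
          (Commute-proj {c = proj₂ (c i)} (λ j → subst (Commute _) (proj₂ (extends i i<m j))
            (commute (proj₁ (max (suc i) i<m)) l (proj₁ (extends i i<m j)))) X)
        where i≤m = ℕ.<⇒≤ i<m
      orbit↑ : ∀ i → i ℕ.< m → ∀ x → Orbit (T i) v x → Orbit (T (suc i)) v x
      orbit↑ i i<m x (X , X∈ , e) = X , T↑ i i<m X X∈ , e
      -- The vertex `i₀` makes the identity nonzero, so no orbit of the separating vector is
      -- trivial.
      one≢0 : one ≢ 0ᴱ
      one≢0 e = 1≢0 (begin
        1F ≡⟨ δ-refl i₀ ⟨
        δ i₀ i₀ ≡⟨ at-one i₀ i₀ ⟨
        at one i₀ i₀ ≡⟨ cong (λ X → at X i₀ i₀) (trans e (sym (∙-zeroˡ one))) ⟩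
        at (0F ∙ one) i₀ i₀ ≡⟨ trans (at-∙ _ _ _ _) (zeroˡ _) ⟩
        0F ∎)
        where open ≡-Reasoning
      positive : ∀ {k} i → Basis (Orbit (T i) v) k → 1 ℕ.≤ k
      positive {suc k} i _ = ℕ.s≤s ℕ.z≤n
      positive {zero} i bas = ⊥-elim (one≢0 (separating one∈T (trans (expand bas (one , one∈ᵢ , refl)) (Σᴱ-zero λ ()))))
        where
        one∈ᵢ : T i one
        one∈ᵢ = IsStarAlgebra.one∈ (star i) , λ _ → Commute-one _
        one∈T : T m one
        one∈T = IsStarAlgebra.one∈ (star m) , λ _ → Commute-one _
      -- Equal dimensions make the two orbits equal, so some `Y` in `T i` acts on `v` as `X` does.
      -- The difference lies in `T m`, for which `v` is separating.
      T↓ : ∀ i → i ℕ.< m → d i ≡ d (suc i) → ∀ X → T (suc i) X → T i X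
      T↓ i i<m e X X∈ with basis-≡ (orbit-subspace (subT i) v) (orbit-subspace (subT (suc i)) v) (orbit↑ i i<m)
        (b i (ℕ.<⇒≤ i<m)) (subst (Basis _) (sym e) (b (suc i) i<m)) (app X v) (X , X∈ , refl)
      ... | Y , Y∈ , Xv≡Yv = subst (T i) (sym (⊖≡0⇒≡ (separating diff∈ diff-v))) Y∈
        where
        diff∈ : T m (X ⊖ Y)
        diff∈ = ascend T m T↑ i<m ℕ.≤-refl _ (IsSubspace.⊖∈ (subT (suc i)) X∈ (T↑ i i<m Y Y∈))
        diff-v : app (X ⊖ Y) v ≡ 0ᴱ
        diff-v = trans (app-⊕ X _ v) (trans (cong₂ _⊕_ Xv≡Yv (app-∙ -1F Y v)) (⊖-self (app Y v)))

  starAlgebra-stationary : Fin n → (A : ℕ → M → Set) → (∀ i → IsStarAlgebra (A i)) → (∀ i X → A i X → A (suc i) X) →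
    ∀ m → n ℕ.+ n ℕ.≤ m → ¬ ¬ ∃ λ i → i ℕ.< m × (∀ X → A (suc i) X → A i X)
  starAlgebra-stationary i₀ A star A↑ m 2n≤m =
    dimensions i₀ A star A↑ m >>= λ D →
    dimensions i₀ A′ (λ i → commutant-starAlgebra (IsStarAlgebra.ᵀ∈ (star _))) A′↑ m >>= λ D′ →
    conclude D D′
    where
    A′ : ℕ → M → Set
    -- Reversing the index turns the decreasing commutants into an increasing chain, to which
    -- `dimensions` applies.
    A′ i = Commutant (A (m ℕ.∸ i))
    A-mono : ∀ {i j} → i ℕ.≤ j → ∀ X → A i X → A j X
    A-mono {j = j} i≤j = ascend A j (λ i _ → A↑ i) i≤j ℕ.≤-refl
    A′↑ : ∀ i X → A′ i X → A′ (suc i) X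
    A′↑ i X X∈ Y Y∈ = X∈ Y (A-mono (ℕ.∸-monoʳ-≤ m (ℕ.n≤1+n i)) Y Y∈)
    conclude : Dimensions A m → Dimensions A′ m → ¬ ¬ ∃ λ i → i ℕ.< m × (∀ X → A (suc i) X → A i X)
    conclude D D′ with coincidence D.dim D′.dim m 2n≤m D.1≤dim D.dim≤n D′.dim≤n D.dim-mono D′.dim-mono
      where
      module D = Dimensions D
      module D′ = Dimensions D′
    ... | i , i<m , p , q =
      basis (star i .IsStarAlgebra.isSubspace) >>= λ { (k , basisA) →
      basis (∩-subspace (star i .IsStarAlgebra.isSubspace) (commutant-subspace (A i))) >>= λ { (l , basisZ) →
      return (i , i<m , relative-commutant⇒⊆ (star i) basisA basisZ (star (suc i)) (A↑ i) bicommutant) } }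
      where
      module D = Dimensions D
      module D′ = Dimensions D′
      m∸suc<m : m ℕ.∸ suc i ℕ.< m
      m∸suc<m = subst (ℕ._≤ m) (ℕ.+-∸-assoc 1 i<m) (ℕ.m∸n≤m m i)
      -- A′ at m ∸ suc i and its successor are the commutants of A (suc i) and A i.
      lower : m ℕ.∸ (m ℕ.∸ suc i) ≡ suc i
      lower = ℕ.m∸[m∸n]≡n i<m
      upper : m ℕ.∸ suc (m ℕ.∸ suc i) ≡ i
      upper = trans (cong (m ℕ.∸_) (sym (ℕ.+-∸-assoc 1 i<m))) (ℕ.m∸[m∸n]≡n (ℕ.<⇒≤ i<m))
      bicommutant : ∀ X → A (suc i) X → Commutant (A i) X → A i X × Commutant (A (suc i)) X
      -- `X` lies in the commutant of `A i` and, as an element of `A (suc i)`, commutes with the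
      -- commutant of `A (suc i)`. The coincidence `q` in the second chain then puts it into that
      -- smaller commutant.
      bicommutant X X∈ Xc = X∈Aᵢ , subst (λ j → Commutant (A j) X) lower
        (D′.relative-commutant (m ℕ.∸ suc i) m∸suc<m q X (subst (λ j → Commutant (A j) X) (sym upper) Xc)
          (λ Y Yc → sym (subst (λ j → Commutant (A j) Y) lower Yc X (A↑ i X X∈Aᵢ))))
        where
        X∈Aᵢ : A i X
        X∈Aᵢ = D.relative-commutant i i<m p X X∈ Xc

-- Indicators and matchings from equal counts

indicator : ∀ {p} {P : Set p} → Dec P → F
indicator (yes _) = 1F
indicator (no _) = 0F

module _ {p q} {P : Set p} {Q : Set q} where
  indicator-cong : (P? : Dec P) (Q? : Dec Q) → (P → Q) → (Q → P) → indicator P? ≡ indicator Q?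
  indicator-cong (yes _) (yes _) _ _ = refl
  indicator-cong (yes p) (no ¬q) f _ = ⊥-elim (¬q (f p))
  indicator-cong (no ¬p) (yes q) _ g = ⊥-elim (¬p (g q))
  indicator-cong (no _) (no _) _ _ = refl

  indicator-× : (P? : Dec P) (Q? : Dec Q) → indicator P? * indicator Q? ≡ indicator (P? ×-dec Q?)
  indicator-× (yes _) (yes _) = *-identityˡ 1F
  indicator-× (yes _) (no _) = *-identityˡ 0F
  indicator-× (no _) (yes _) = zeroˡ 1F
  indicator-× (no _) (no _) = zeroˡ 0F

indicator-yes : ∀ {p} {P : Set p} (P? : Dec P) → P → indicator P? ≡ 1F
indicator-yes (yes _) _ = refl
indicator-yes (no ¬p) p = ⊥-elim (¬p p)

indicator-no : ∀ {p} {P : Set p} (P? : Dec P) → ¬ P → indicator P? ≡ 0F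
indicator-no (yes p) ¬p = ⊥-elim (¬p p)
indicator-no (no _) _ = refl

indicator-nonneg : ∀ {p} {P : Set p} (P? : Dec P) → 0F ≤ indicator P?
indicator-nonneg (yes _) = subst (0F ≤_) (*-identityˡ 1F) (square-nonneg 1F)
indicator-nonneg (no _) = ≤-refl

+-cancelˡ : ∀ p {q r} → p + q ≡ p + r → q ≡ r
+-cancelˡ p {q} {r} e = begin
  q ≡⟨ drop q ⟨
  -1F * p + (p + q) ≡⟨ +-congˡ e ⟩
  -1F * p + (p + r) ≡⟨ drop r ⟩
  r ∎
  where
  open ≡-Reasoning
  drop : ∀ s → -1F * p + (p + s) ≡ s
  drop s = trans (sym (+-assoc _ p s)) (trans (+-congʳ (-1*-cancelˡ p)) (+-identityˡ s))

module Matching {D : Set} (_~_ : D → D → Set) (_~?_ : ∀ x y → Dec (x ~ y))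
  (~-refl : ∀ {x} → x ~ x) (~-sym : ∀ {x y} → x ~ y → y ~ x) (~-trans : ∀ {x y z} → x ~ y → y ~ z → x ~ z) where

  count : ∀ {k} → (Fin k → D) → D → F
  count f d = Σꟳ λ i → indicator (f i ~? d)

  -- Match `f zero` with some `g j` of its class, delete both, and recurse. Counts are scalars
  -- because they arrive as matrix entries.
  count⇒permutation : ∀ {k} (f g : Fin k → D) → (∀ d → count f d ≡ count g d) →
    Σ (Permutation k k) λ π → ∀ i → f i ~ g (π ⟨$⟩ʳ i)
  count⇒permutation {zero} f g h = Perm.id , λ ()
  count⇒permutation {suc k} f g h with Fin.any? (λ j → g j ~? f zero)
  -- Without a partner, the class of `f zero` would have positive count in `f` and count 0 in `g`.
  ... | no none = ⊥-elim (1≢0 (+≡0⇒≡0 0≤1 (Σ-nonneg λ i → indicator-nonneg (f (suc i) ~? f zero)) (begin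
      1F + Σꟳ (λ i → indicator (f (suc i) ~? f zero)) ≡⟨ +-congʳ (indicator-yes (f zero ~? f zero) ~-refl) ⟨
      indicator (f zero ~? f zero) + Σꟳ (λ i → indicator (f (suc i) ~? f zero)) ≡⟨ Σ-suc _ ⟨
      count f (f zero) ≡⟨ h (f zero) ⟩
      count g (f zero) ≡⟨ (Σ-zero λ j → indicator-no (g j ~? f zero) (λ p → none (j , p))) ⟩
      0F ∎)))
    where
    open ≡-Reasoning
    0≤1 : 0F ≤ 1F
    0≤1 = indicator-nonneg (yes tt)
  ... | yes (j , gj~f0) with count⇒permutation (f ∘ suc) (g ∘ Fin.punchIn j) rest
    where
    open ≡-Reasoning
    rest : ∀ d → count (f ∘ suc) d ≡ count (g ∘ Fin.punchIn j) d
    rest d = +-cancelˡ (indicator (f zero ~? d)) (begin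
      indicator (f zero ~? d) + count (f ∘ suc) d ≡⟨ Σ-suc _ ⟨
      count f d ≡⟨ h d ⟩
      count g d ≡⟨ Σ-punchIn j _ ⟩
      indicator (g j ~? d) + count (g ∘ Fin.punchIn j) d ≡⟨ +-congʳ (indicator-cong (g j ~? d) (f zero ~? d) (~-trans (~-sym gj~f0)) (~-trans gj~f0)) ⟩
      indicator (f zero ~? d) + count (g ∘ Fin.punchIn j) d ∎)
  ...   | π , p = Perm.insert zero j π , λ { zero → ~-sym gj~f0
                                           ; (suc i) → subst (λ l → f (suc i) ~ g l) (sym (Perm.insert-punchIn zero j π i)) (p i) }

-- Tuples of vertices and sums over them

module _ {n : ℕ} where
  encode : ∀ m → Vec (Fin n) m → Fin (n ℕ.^ m)
  encode zero [] = zero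
  encode (suc m) (w ∷ ws) = combine w (encode m ws)

  decode : ∀ m → Fin (n ℕ.^ m) → Vec (Fin n) m
  decode zero _ = []
  decode (suc m) i = proj₁ (remQuot {n} (n ℕ.^ m) i) ∷ decode m (proj₂ (remQuot {n} (n ℕ.^ m) i))

  encode-decode : ∀ m i → encode m (decode m i) ≡ i
  encode-decode zero zero = refl
  encode-decode (suc m) i = trans (cong (combine {n} _) (encode-decode m _)) (Fin.combine-remQuot {n} (n ℕ.^ m) i)

  decode-encode : ∀ m ws → decode m (encode m ws) ≡ ws
  decode-encode zero [] = refl
  decode-encode (suc m) (w ∷ ws) = trans
    (cong (λ r → proj₁ r ∷ decode m (proj₂ r)) (Fin.remQuot-combine {n} {n ℕ.^ m} w (encode m ws)))
    (cong (w ∷_) (decode-encode m ws))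

  encoding : ∀ m → Vec (Fin n) m ↔ Fin (n ℕ.^ m)
  encoding m = mk↔ₛ′ (encode m) (decode m) (encode-decode m) (decode-encode m)

  -- Summing one coordinate at a time follows the recursion of matrix products; `Σⱽ-decode` flattens
  -- the sum when whole tuples are permuted.
  Σⱽ : ∀ m → (Vec (Fin n) m → F) → F
  Σⱽ zero f = f []
  Σⱽ (suc m) f = Σꟳ λ w → Σⱽ m λ ws → f (w ∷ ws)

  Σⱽ-cong : ∀ m {f g : Vec (Fin n) m → F} → (∀ ws → f ws ≡ g ws) → Σⱽ m f ≡ Σⱽ m g
  Σⱽ-cong zero h = h []
  Σⱽ-cong (suc m) h = Σ-cong λ w → Σⱽ-cong m λ ws → h (w ∷ ws)

  Σⱽ-+ : ∀ m (f g : Vec (Fin n) m → F) → Σⱽ m (λ ws → f ws + g ws) ≡ Σⱽ m f + Σⱽ m g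
  Σⱽ-+ zero f g = refl
  Σⱽ-+ (suc m) f g = trans (Σ-cong λ w → Σⱽ-+ m _ _) (Σ-+ _ _)

  *-Σⱽ : ∀ m p (f : Vec (Fin n) m → F) → p * Σⱽ m f ≡ Σⱽ m (λ ws → p * f ws)
  *-Σⱽ zero p f = refl
  *-Σⱽ (suc m) p f = trans (*-Σ p _) (Σ-cong λ w → *-Σⱽ m p _)

  Σⱽ-decode : ∀ m (f : Vec (Fin n) m → F) → Σⱽ m f ≡ Σꟳ (λ i → f (decode m i))
  Σⱽ-decode zero f = sym (trans (Σ-suc _) (trans (+-congˡ (Σ-nil _)) (+-identityʳ _)))
  Σⱽ-decode (suc m) f = begin
    Σꟳ (λ w → Σⱽ m (λ ws → f (w ∷ ws))) ≡⟨ (Σ-cong λ w → Σⱽ-decode m _) ⟩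
    Σꟳ (λ w → Σꟳ (λ i → f (w ∷ decode m i))) ≡⟨ (Σ-cong λ w → Σ-cong λ i →
      cong (λ r → f (proj₁ r ∷ decode m (proj₂ r))) (Fin.remQuot-combine {n} {n ℕ.^ m} w i)) ⟨
    Σꟳ (λ w → Σꟳ (λ i → f (decode (suc m) (combine w i)))) ≡⟨ Σ-combine n _ ⟨
    Σꟳ (λ i → f (decode (suc m) i)) ∎
    where open ≡-Reasoning

  Σⱽ-permute : ∀ m (π : Vec (Fin n) m ↔ Vec (Fin n) m) (f : Vec (Fin n) m → F) → Σⱽ m f ≡ Σⱽ m (λ ws → f (Inverse.to π ws))
  Σⱽ-permute m π f = begin
    Σⱽ m f ≡⟨ Σⱽ-decode m f ⟩
    Σꟳ (λ i → f (decode m i)) ≡⟨ Σ-permute _ (encoding m ↔-∘ (π ↔-∘ ↔-sym (encoding m))) ⟩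
    Σꟳ (λ i → f (decode m (encode m (Inverse.to π (decode m i))))) ≡⟨ (Σ-cong λ i → cong f (decode-encode m _)) ⟩
    Σꟳ (λ i → f (Inverse.to π (decode m i))) ≡⟨ Σⱽ-decode m _ ⟨
    Σⱽ m (λ ws → f (Inverse.to π ws)) ∎
    where open ≡-Reasoning

  all-vec? : ∀ m {P : Vec (Fin n) m → Set} → (∀ ws → Dec (P ws)) → Dec (∀ ws → P ws)
  all-vec? m {P} P? = map′ (λ h ws → subst P (decode-encode m ws) (h (encode m ws))) (λ h i → h (decode m i))
    (Fin.all? (λ i → P? (decode m i)))

  SameSeq-map : ∀ {R S : Col n} → R ⊑ S → ∀ {m} (xs ys : Vec (Fin n) m) → SameSeq R xs ys → SameSeq S xs ys
  SameSeq-map R⊑S [] [] _ = tt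
  SameSeq-map R⊑S (_ ∷ []) (_ ∷ []) _ = tt
  SameSeq-map R⊑S (x ∷ x′ ∷ xs) (y ∷ y′ ∷ ys) (r , h) = R⊑S _ _ _ _ r , SameSeq-map R⊑S (x′ ∷ xs) (y′ ∷ ys) h

  WalkRef-mono : ∀ k {R S : Col n} → R ⊑ S → WalkRef k R ⊑ WalkRef k S
  WalkRef-mono k R⊑S _ _ _ _ (π , h) = π , λ ws → SameSeq-map R⊑S _ _ (h ws)

-- An invariant of walk refinement (`walkRef-admissible`). Loops provide the identity matrix,
-- converses the transposes, and decidability the indicator matrices of the colours.
record IsAdmissible {n} (R : Col n) : Set where
  field
    R? : ∀ u v u′ v′ → Dec (R u v u′ v′)
    R-refl : ∀ {u v} → R u v u v
    R-sym : ∀ {u v u′ v′} → R u v u′ v′ → R u′ v′ u v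
    R-trans : ∀ {u v u′ v′ u″ v″} → R u v u′ v′ → R u′ v′ u″ v″ → R u v u″ v″
    R-loop : ∀ {u v w} → R u u v w → v ≡ w
    R-converse : ∀ {u v u′ v′} → R u v u′ v′ → R v u v′ u′

-- The algebra generated by a colouring

module WalkAlgebra (n : ℕ) where
  open Matrices n
  open StarChains n

  Invariant : Col n → M → Set
  Invariant R X = ∀ u v u′ v′ → R u v u′ v′ → at X u v ≡ at X u′ v′

  -- Index m: products of m + 1 invariant matrices, corresponding to walks with m inner vertices.
  data Words (R : Col n) : ℕ → M → Set where
    gen : ∀ {X} → Invariant R X → Words R zero X
    mul : ∀ {m X Y} → Invariant R X → Words R m Y → Words R (suc m) (X ⊙ Y)
    add : ∀ {m X Y} → Words R m X → Words R m Y → Words R m (X ⊕ Y)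
    scale : ∀ {m} c {X} → Words R m X → Words R m (c ∙ X)

  walk : ∀ {m} → Fin n → Vec (Fin n) m → Fin n → Vec (Fin n) (suc m ℕ.+ 1)
  walk u ws v = (u ∷ ws) ++ [ v ]

  -- Entries are sums over walks whose summands depend only on the colour sequence, so a
  -- colour-preserving bijection between walks preserves the entries.
  record WalkSum (R : Col n) (m : ℕ) (X : M) : Set where
    field
      weight : Vec (Fin n) (suc m ℕ.+ 1) → F
      weight-cong : ∀ s s′ → SameSeq R s s′ → weight s ≡ weight s′
      at-weight : ∀ u v → at X u v ≡ Σⱽ m λ ws → weight (walk u ws v)

  walkSum : ∀ {R m X} → Words R m X → WalkSum R m X
  walkSum (gen {X} X∈) = record
    { weight = λ { (u ∷ v ∷ []) → at X u v }
    ; weight-cong = λ { (u ∷ v ∷ []) (u′ ∷ v′ ∷ []) (r , _) → X∈ u v u′ v′ r }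
    ; at-weight = λ u v → refl }
  walkSum (mul {m} {X} {Y} X∈ Y∈) = record
    { weight = λ { (u ∷ w ∷ s) → at X u w * weight (w ∷ s) }
    ; weight-cong = λ { (u ∷ w ∷ s) (u′ ∷ w′ ∷ s′) (r , h) → cong₂ _*_ (X∈ u w u′ w′ r) (weight-cong (w ∷ s) (w′ ∷ s′) h) }
    ; at-weight = λ u v → trans (at-⊙ X Y u v) (Σ-cong λ w → trans (*-congˡ (at-weight w v)) (*-Σⱽ m _ _)) }
    where open WalkSum (walkSum Y∈)
  walkSum (add {m} {X} {Y} X∈ Y∈) = record
    { weight = λ s → SX.weight s + SY.weight s
    ; weight-cong = λ s s′ h → cong₂ _+_ (SX.weight-cong s s′ h) (SY.weight-cong s s′ h)
    ; at-weight = λ u v → trans (at-⊕ X Y u v) (trans (cong₂ _+_ (SX.at-weight u v) (SY.at-weight u v)) (sym (Σⱽ-+ m _ _))) }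
    where
    module SX = WalkSum (walkSum X∈)
    module SY = WalkSum (walkSum Y∈)
  walkSum (scale {m} c {X} X∈) = record
    { weight = λ s → c * weight s
    ; weight-cong = λ s s′ h → *-congˡ (weight-cong s s′ h)
    ; at-weight = λ u v → trans (at-∙ c X u v) (trans (*-congˡ (at-weight u v)) (*-Σⱽ m c _)) }
    where open WalkSum (walkSum X∈)

  walkRef⇒invariant : ∀ {R m X} → Words R m X → Invariant (WalkRef (suc m) R) X
  walkRef⇒invariant {R} {m} {X} X∈ u v u′ v′ (π , h) = begin
    at X u v ≡⟨ at-weight u v ⟩
    Σⱽ m (λ ws → weight (walk u ws v)) ≡⟨ (Σⱽ-cong m λ ws → weight-cong _ _ (h ws)) ⟩
    Σⱽ m (λ ws → weight (walk u′ (Inverse.to π ws) v′)) ≡⟨ Σⱽ-permute m π (λ ws → weight (walk u′ ws v′)) ⟨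
    Σⱽ m (λ ws → weight (walk u′ ws v′)) ≡⟨ at-weight u′ v′ ⟨
    at X u′ v′ ∎
    where
    open ≡-Reasoning
    open WalkSum (walkSum X∈)

  -- `mul` prepends a factor while transposition reverses products, so factors must also be
  -- appended.
  words-append : ∀ {R m X Y} → Words R m Y → Invariant R X → Words R (suc m) (Y ⊙ X)
  words-append (gen p) x = mul p (gen x)
  words-append (mul p y) x = subst (Words _ _) (sym (⊙-assoc _ _ _)) (mul p (words-append y x))
  words-append (add y z) x = subst (Words _ _) (sym (⊙-distribʳ _ _ _)) (add (words-append y x) (words-append z x))
  words-append (scale c y) x = subst (Words _ _) (sym (⊙-∙ˡ c _ _)) (scale c (words-append y x))

  words-⊙ : ∀ {R m k X Y} → Words R m X → Words R k Y → Words R (suc (m ℕ.+ k)) (X ⊙ Y)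
  words-⊙ (gen p) y = mul p y
  words-⊙ (mul p x) y = subst (Words _ _) (sym (⊙-assoc _ _ _)) (mul p (words-⊙ x y))
  words-⊙ (add x z) y = subst (Words _ _) (sym (⊙-distribʳ _ _ _)) (add (words-⊙ x y) (words-⊙ z y))
  words-⊙ (scale c x) y = subst (Words _ _) (sym (⊙-∙ˡ c _ _)) (scale c (words-⊙ x y))

  module _ {R : Col n} (adm : IsAdmissible R) where
    open IsAdmissible adm

    one-invariant : Invariant R one
    one-invariant u v u′ v′ r = trans (at-one u v) (trans (δ-cong u v u′ v′ r) (sym (at-one u′ v′)))
      where
      δ-cong : ∀ u v u′ v′ → R u v u′ v′ → δ u v ≡ δ u′ v′
      δ-cong u v u′ v′ r with u Fin.≟ v | u′ Fin.≟ v′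
      ... | yes _ | yes _ = refl
      ... | no _ | no _ = refl
      ... | yes refl | no ne = ⊥-elim (ne (R-loop r))
      ... | no ne | yes refl = ⊥-elim (ne (R-loop (R-sym r)))

    -- Loops have colours of their own, so the identity is invariant and can pad a product.
    words-suc : ∀ m X → Words R m X → Words R (suc m) X
    words-suc m X x = subst (Words R (suc m)) (one-⊙ X) (mul one-invariant x)

    one-words : ∀ m → Words R m one
    one-words zero = gen one-invariant
    one-words (suc m) = words-suc m one (one-words m)

    words-subspace : ∀ m → IsSubspace (Words R m)
    words-subspace m = record
      { 0∈ = subst (Words R m) (∙-zeroˡ one) (scale 0F (one-words m)) ; ⊕∈ = add ; ∙∈ = scale }

    words-ᵀ : ∀ {m X} → Words R m X → Words R m (X ᵀ)
    words-ᵀ (gen x) = gen λ u v u′ v′ r → trans (at-ᵀ _ u v) (trans (x v u v′ u′ (R-converse r)) (sym (at-ᵀ _ u′ v′)))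
    words-ᵀ (mul x y) = subst (Words R _) (sym (ᵀ-⊙ _ _)) (words-append (words-ᵀ y) λ u v u′ v′ r →
      trans (at-ᵀ _ u v) (trans (x v u v′ u′ (R-converse r)) (sym (at-ᵀ _ u′ v′))))
    words-ᵀ (add x y) = subst (Words R _) (sym (ᵀ-⊕ _ _)) (add (words-ᵀ x) (words-ᵀ y))
    words-ᵀ (scale c x) = subst (Words R _) (sym (ᵀ-∙ c _)) (scale c (words-ᵀ x))

    words-mono : ∀ {m k} → m ℕ.≤ k → ∀ X → Words R m X → Words R k X
    words-mono {k = k} m≤k = ascend (Words R) k (λ i _ → words-suc i) m≤k ℕ.≤-refl

    -- Leading factors are peeled off until a tail of index `suc s` remains, which `h` shortens.
    words-stable : ∀ {s} → (∀ X → Words R (suc s) X → Words R s X) → ∀ k X → Words R (k ℕ.+ s) X → Words R s X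
    words-stable {s} h zero X x = x
    words-stable {s} h (suc k) X x = words-stable h k X (shrink k x)
      where
      shrink : ∀ k {X} → Words R (suc (k ℕ.+ s)) X → Words R (k ℕ.+ s) X
      shrink zero x = h _ x
      shrink (suc k) (mul p x) = mul p (shrink k x)
      shrink (suc k) (add x y) = add (shrink (suc k) x) (shrink (suc k) y)
      shrink (suc k) (scale c x) = scale c (shrink (suc k) x)

    -- The spans increase inside a space of dimension n², so some inclusion among the first n² + 1
    -- is an equality. This is the origin of the walk length.
    words-bounded : ∀ {m k} → n ℕ.* n ℕ.≤ m → ∀ {X} → Words R k X → ¬ ¬ Words R m X
    words-bounded {m} {k} n²≤m {X} x = stationary words-subspace words-suc >>= λ { (s , s≤ , h) →
      return (words-mono (ℕ.≤-trans s≤ n²≤m) X (words-stable h k X (words-mono (ℕ.m≤m+n k s) X x))) }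

    Generated : M → Set
    Generated X = ∃ λ m → Words R m X

    generated-starAlgebra : IsStarAlgebra Generated
    generated-starAlgebra = record
      { isSubspace = record
        { 0∈ = 0 , IsSubspace.0∈ (words-subspace 0)
        ; ⊕∈ = λ { (m , x) (k , y) → m ℕ.⊔ k , add (words-mono (ℕ.m≤m⊔n m k) _ x) (words-mono (ℕ.m≤n⊔m m k) _ y) }
        ; ∙∈ = λ { c (m , x) → m , scale c x } }
      ; one∈ = 0 , one-words 0
      ; ⊙∈ = λ { (m , x) (k , y) → _ , words-⊙ x y }
      ; ᵀ∈ = λ { (m , x) → m , words-ᵀ x } }

    generated-invariant : ∀ {m} → n ℕ.* n ℕ.≤ m → ∀ {X} → Generated X → Invariant (WalkRef (suc m) R) X
    generated-invariant n²≤m (k , x) u v u′ v′ r = decidable-stable (_ ≟ _)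
      (words-bounded n²≤m x >>= λ x′ → return (walkRef⇒invariant x′ u v u′ v′ r))

    sameSeq-refl : ∀ {m} (s : Vec (Fin n) m) → SameSeq R s s
    sameSeq-refl [] = tt
    sameSeq-refl (_ ∷ []) = tt
    sameSeq-refl (_ ∷ y ∷ s) = R-refl , sameSeq-refl (y ∷ s)

    sameSeq-sym : ∀ {m} (s t : Vec (Fin n) m) → SameSeq R s t → SameSeq R t s
    sameSeq-sym [] [] _ = tt
    sameSeq-sym (_ ∷ []) (_ ∷ []) _ = tt
    sameSeq-sym (_ ∷ x ∷ s) (_ ∷ y ∷ t) (r , h) = R-sym r , sameSeq-sym (x ∷ s) (y ∷ t) h

    sameSeq-trans : ∀ {m} (s t q : Vec (Fin n) m) → SameSeq R s t → SameSeq R t q → SameSeq R s q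
    sameSeq-trans [] [] [] _ _ = tt
    sameSeq-trans (_ ∷ []) (_ ∷ []) (_ ∷ []) _ _ = tt
    sameSeq-trans (_ ∷ x ∷ s) (_ ∷ y ∷ t) (_ ∷ z ∷ q) (r , h) (r′ , h′) = R-trans r r′ , sameSeq-trans (x ∷ s) (y ∷ t) (z ∷ q) h h′

    sameSeq? : ∀ {m} (s t : Vec (Fin n) m) → Dec (SameSeq R s t)
    sameSeq? [] [] = yes tt
    sameSeq? (_ ∷ []) (_ ∷ []) = yes tt
    sameSeq? (u ∷ v ∷ s) (u′ ∷ v′ ∷ t) = R? u v u′ v′ ×-dec sameSeq? (v ∷ s) (v′ ∷ t)

    -- Adjacency matrix of the colour class of the pair `a`, `b`: pairs of vertices serve as names
    -- for colours.
    colour : Fin n → Fin n → M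
    colour a b = mat λ u v → indicator (R? u v a b)

    colour-invariant : ∀ a b → Invariant R (colour a b)
    colour-invariant a b u v u′ v′ r = trans (at-mat _ u v) (trans
      (indicator-cong (R? u v a b) (R? u′ v′ a b) (R-trans (R-sym r)) (R-trans r)) (sym (at-mat _ u′ v′)))

    word : ∀ m → Vec (Fin n) (suc m ℕ.+ 1) → M
    word zero (a ∷ b ∷ []) = colour a b
    word (suc m) (a ∷ b ∷ s) = colour a b ⊙ word m (b ∷ s)

    word∈ : ∀ m s → Words R m (word m s)
    word∈ zero (a ∷ b ∷ []) = gen (colour-invariant a b)
    word∈ (suc m) (a ∷ b ∷ s) = mul (colour-invariant a b) (word∈ m (b ∷ s))

    at-word : ∀ m s u v → at (word m s) u v ≡ Σⱽ m λ ws → indicator (sameSeq? (walk u ws v) s)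
    at-word zero (a ∷ b ∷ []) u v = trans (at-mat _ u v) (indicator-cong (R? u v a b) (sameSeq? (walk u [] v) (a ∷ b ∷ [])) (λ r → r , tt) proj₁)
    at-word (suc m) (a ∷ b ∷ s) u v = trans (at-⊙ _ _ u v) (Σ-cong λ w → trans
      (cong₂ _*_ (at-mat _ u w) (at-word m (b ∷ s) w v)) (trans (*-Σⱽ m _ _) (Σⱽ-cong m λ ws → indicator-× (R? u w a b) _)))

    -- The entries count walks by colour sequence, so agreement yields equal counts and hence a
    -- matching of walks. Vertex sequences suffice as patterns, since a pattern that occurs is that
    -- of a walk.
    word-agreement⇒walkRef : ∀ m {u v u′ v′} → (∀ s → at (word m s) u v ≡ at (word m s) u′ v′) → WalkRef (suc m) R u v u′ v′
    word-agreement⇒walkRef m {u} {v} {u′} {v′} h = ↔-sym (encoding m) ↔-∘ (π ↔-∘ encoding m) ,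
      λ ws → subst (λ xs → SameSeq R (walk u xs v) (walk u′ (decode m (π ⟨$⟩ʳ encode m ws)) v′)) (decode-encode m ws) (proj₂ matching (encode m ws))
      where
      open Matching (SameSeq {m = suc m ℕ.+ 1} R) sameSeq? (λ {s} → sameSeq-refl s) (λ {s} {t} → sameSeq-sym s t) (λ {s} {t} {q} → sameSeq-trans s t q)
      matching = count⇒permutation (λ i → walk u (decode m i) v) (λ i → walk u′ (decode m i) v′)
        (λ s → trans (sym (trans (at-word m s u v) (Σⱽ-decode m _))) (trans (h s) (trans (at-word m s u′ v′) (Σⱽ-decode m _))))
      π = proj₁ matching

    words-agreement⇒walkRef : ∀ m {u v u′ v′} → (∀ X → Words R m X → at X u v ≡ at X u′ v′) → WalkRef (suc m) R u v u′ v′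
    words-agreement⇒walkRef m h = word-agreement⇒walkRef m (λ s → h _ (word∈ m s))

    -- The refinement is agreement of matrix entries on all words of index `m`, which turns the laws
    -- into equations; the finitely many matrices `word m s` decide it.
    walkRef-admissible : ∀ m → IsAdmissible (WalkRef (suc m) R)
    walkRef-admissible m = record
      { R? = λ u v u′ v′ → map′ (word-agreement⇒walkRef m) (λ r s → walkRef⇒invariant (word∈ m s) u v u′ v′ r)
          (all-vec? (suc m ℕ.+ 1) λ s → at (word m s) u v ≟ at (word m s) u′ v′)
      ; R-refl = words-agreement⇒walkRef m (λ _ _ → refl)
      ; R-sym = λ r → words-agreement⇒walkRef m (λ _ x → sym (walkRef⇒invariant x _ _ _ _ r))
      ; R-trans = λ r r′ → words-agreement⇒walkRef m (λ _ x → trans (walkRef⇒invariant x _ _ _ _ r) (walkRef⇒invariant x _ _ _ _ r′))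
      ; R-loop = λ {u} {v} {w} r → loop v w (trans (sym (trans (at-one u u) (δ-refl u)))
          (trans (walkRef⇒invariant (one-words m) u u v w r) (at-one v w)))
      ; R-converse = λ r → words-agreement⇒walkRef m (λ X x → trans (sym (at-ᵀ X _ _))
          (trans (walkRef⇒invariant (words-ᵀ x) _ _ _ _ r) (at-ᵀ X _ _))) }
      where
      loop : ∀ v w → 1F ≡ δ v w → v ≡ w
      loop v w e with v Fin.≟ w
      ... | yes p = p
      ... | no _ = ⊥-elim (1≢0 e)

Iterate : ∀ {n} → ℕ → Col n → ℕ → Col n
Iterate k R zero = R
Iterate k R (suc i) = WalkRef k (Iterate k R i)

admissible-stable : ∀ {n m} {R : Col n} → IsAdmissible R → n ℕ.* n ℕ.≤ m →
  Iterate (suc m) R (n ℕ.+ n) ⊑ Iterate (suc m) R (suc (n ℕ.+ n))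
admissible-stable {n} {m} {R} adm n²≤m u v u′ v′ r = decidable-stable (IsAdmissible.R? (admissible (suc (n ℕ.+ n))) u v u′ v′)
  (starAlgebra-stationary u A (λ i → generated-starAlgebra (admissible i)) A↑ (n ℕ.+ n) ℕ.≤-refl >>= λ { (i , i<2n , A↓) →
   -- Stability at `suc i`, an index of at most 2n, is carried up to 2n by monotonicity of
   -- refinement.
   return (ascend (λ j (_ : ⊤) → Rᵢ j ⊑ Rᵢ (suc j)) (n ℕ.+ n) (λ j _ _ → WalkRef-mono (suc m)) i<2n ℕ.≤-refl tt (step i A↓) u v u′ v′ r) })
  where
  open Matrices n
  open StarChains n
  open WalkAlgebra n
  Rᵢ : ℕ → Col n
  Rᵢ = Iterate (suc m) R
  admissible : ∀ i → IsAdmissible (Rᵢ i)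
  admissible zero = adm
  admissible (suc i) = walkRef-admissible (admissible i) m
  A : ℕ → M → Set
  A i = Generated (admissible i)
  A↑ : ∀ i X → A i X → A (suc i) X
  A↑ i X x = 0 , gen (generated-invariant (admissible i) n²≤m x)
  step : ∀ i → (∀ X → A (suc i) X → A i X) → Rᵢ (suc i) ⊑ Rᵢ (suc (suc i))
  -- Words over the colouring at `suc i` lie in `A (suc i)`, hence in `A i`, whose elements are
  -- already constant on the classes of that colouring.
  step i A↓ u v u′ v′ r = words-agreement⇒walkRef (admissible (suc i)) m
    (λ X x → generated-invariant (admissible i) n²≤m (A↓ X (m , x)) u v u′ v′ r)

-- Reduction to decidable colourings

module _ {n : ℕ} where
  Edge : Set
  Edge = Fin n × Fin n

  _≟ᴱ_ : (e e′ : Edge) → Dec (e ≡ e′)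
  _≟ᴱ_ = Product.≡-dec Fin._≟_ Fin._≟_

  flip : Edge × Edge → Edge × Edge
  flip ((u , v) , (u′ , v′)) = (v , u) , (v′ , u′)

  Holds : Col n → Edge × Edge → Set
  Holds R ((u , v) , (u′ , v′)) = R u v u′ v′

  -- Iterated walk refinement is positive in the colouring, so each instance of it
  -- already follows from finitely many coincidences of colours.
  Supported : Col n → (Col n → Set) → Set₁
  Supported R Φ = Σ (List (Edge × Edge)) λ es → All (Holds R) es × (∀ S → All (Holds S) es → Φ S)

  supported-all : ∀ {R k} {Φ : Fin k → Col n → Set} → (∀ i → Supported R (Φ i)) → Supported R (λ S → ∀ i → Φ i S)
  supported-all {k = zero} h = List.[] , All.[] , λ _ _ ()
  supported-all {k = suc k} h with h zero | supported-all (h ∘ suc)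
  ... | es , p , f | es′ , p′ , f′ = es List.++ es′ , All.++⁺ p p′ , λ S q →
    λ { zero → f S (All.++⁻ˡ es q) ; (suc i) → f′ S (All.++⁻ʳ es q) i }

  supported-all-vec : ∀ {R} m {Φ : Vec (Fin n) m → Col n → Set} → (∀ ws → Supported R (Φ ws)) → Supported R (λ S → ∀ ws → Φ ws S)
  supported-all-vec m {Φ} h with supported-all (λ i → h (decode m i))
  ... | es , p , f = es , p , λ S q ws → subst (λ xs → Φ xs S) (decode-encode m ws) (f S q (encode m ws))

  supported-sameSeq : ∀ {R} {X : Col n → Col n} → (∀ u v u′ v′ → X R u v u′ v′ → Supported R (λ S → X S u v u′ v′)) →
    ∀ {m} (s t : Vec (Fin n) m) → SameSeq (X R) s t → Supported R (λ S → SameSeq (X S) s t)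
  supported-sameSeq h [] [] _ = List.[] , All.[] , λ _ _ → tt
  supported-sameSeq h (_ ∷ []) (_ ∷ []) _ = List.[] , All.[] , λ _ _ → tt
  supported-sameSeq h (u ∷ v ∷ s) (u′ ∷ v′ ∷ t) (r , rs) with h u v u′ v′ r | supported-sameSeq h (v ∷ s) (v′ ∷ t) rs
  ... | es , p , f | es′ , p′ , f′ = es List.++ es′ , All.++⁺ p p′ , λ S q → f S (All.++⁻ˡ es q) , f′ S (All.++⁻ʳ es q)

  supported-iterate : ∀ k {R} i u v u′ v′ → Iterate k R i u v u′ v′ → Supported R (λ S → Iterate k S i u v u′ v′)
  supported-iterate k zero u v u′ v′ r = ((u , v) , (u′ , v′)) List.∷ List.[] , r All.∷ All.[] , λ _ → All.head
  supported-iterate k {R} (suc i) u v u′ v′ (π , h) with supported-all-vec _ (λ ws →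
    supported-sameSeq {R} {λ S → Iterate k S i} (supported-iterate k i) _ _ (h ws))
  -- The same bijection serves every `S`; what is recorded are the coincidences along its finitely
  -- many walks.
  ... | es , p , f = es , p , λ S q → π , f S q

  Iterate-mono : ∀ k {R S : Col n} → R ⊑ S → ∀ i → Iterate k R i ⊑ Iterate k S i
  Iterate-mono k R⊑S zero = R⊑S
  Iterate-mono k R⊑S (suc i) = WalkRef-mono k (Iterate-mono k R⊑S i)

  module _ {C : Set} (χ : Edge → C) where
    Agrees : (Edge → Edge) → Edge × Edge → Set
    Agrees r (e , e′) = r e ≡ r e′

    -- `C` has no decidable equality, so colours are replaced by representative edges, and each
    -- listed coincidence merges two representatives. Representatives keep their colour, so the new
    -- colouring is at least as fine as `χ`.
    identify : ∀ es → All (λ p → χ (proj₁ p) ≡ χ (proj₂ p)) es →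
      Σ (Edge → Edge) λ r → (∀ e → χ (r e) ≡ χ e) × All (Agrees r) es
    identify List.[] All.[] = id , (λ _ → refl) , All.[]
    identify ((a , b) List.∷ es) (χa≡χb All.∷ h) with identify es h
    ... | r , χr , agree = merge ∘ r , (λ e → trans (χ-merge (r e)) (χr e)) ,
      trans merge-a (sym merge-b) All.∷ All.map (cong merge) agree
      where
      merge : Edge → Edge
      merge x with x ≟ᴱ r b
      ... | yes _ = r a
      ... | no _ = x
      χ-merge : ∀ x → χ (merge x) ≡ χ x
      χ-merge x with x ≟ᴱ r b
      ... | yes refl = trans (χr a) (trans χa≡χb (sym (χr b)))
      ... | no _ = refl
      merge-a : merge (r a) ≡ r a
      merge-a with r a ≟ᴱ r b
      ... | yes _ = refl
      ... | no _ = refl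
      merge-b : merge (r b) ≡ r a
      merge-b with r b ≟ᴱ r b
      ... | yes _ = refl
      ... | no ne = ⊥-elim (ne refl)

  -- Both directions are recorded because a `Col` is an arbitrary relation, with no symmetry built
  -- in.
  DeterminesLoops : Col n → Set
  DeterminesLoops R = ∀ u v w → (R u u v w → v ≡ w) × (R v w u u → v ≡ w)

  DeterminesLoops-⊑ : ∀ {R S} → R ⊑ S → DeterminesLoops S → DeterminesLoops R
  DeterminesLoops-⊑ R⊑S h u v w = (λ r → proj₁ (h u v w) (R⊑S _ _ _ _ r)) , (λ r → proj₂ (h u v w) (R⊑S _ _ _ _ r))

  head-tail : ∀ {m} (xs : Vec (Fin n) (suc m)) → xs ≡ Vec.head xs ∷ Vec.tail xs
  head-tail (_ ∷ _) = refl

  -- Prepending a loop at the start vertex turns (k − 1)-walks into k-walks, and loops are recognised by their colour.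
  WalkRef-suc-⊑ : ∀ m {R} → DeterminesLoops R → WalkRef (suc (suc m)) R ⊑ WalkRef (suc m) R
  WalkRef-suc-⊑ m {R} loops u v u′ v′ (π , h) = mk↔ₛ′ to from to-from from-to , λ ws →
    proj₂ (subst (λ xs → SameSeq R ((u ∷ u ∷ ws) ++ [ v ]) ((u′ ∷ xs) ++ [ v′ ])) (π-loop ws) (h (u ∷ ws)))
    where
    open Inverse π using () renaming (to to π⟨_⟩; from to π⁻¹⟨_⟩; strictlyInverseˡ to ππ⁻¹; strictlyInverseʳ to π⁻¹π)
    to from : Vec (Fin n) m → Vec (Fin n) m
    to ws = Vec.tail (π⟨ u ∷ ws ⟩)
    from ws = Vec.tail (π⁻¹⟨ u′ ∷ ws ⟩)
    π-loop : ∀ ws → π⟨ u ∷ ws ⟩ ≡ u′ ∷ to ws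
    π-loop ws = trans (head-tail _) (cong (_∷ to ws) (sym (proj₁ (loops u u′ _)
      (proj₁ (subst (λ xs → SameSeq R ((u ∷ u ∷ ws) ++ [ v ]) ((u′ ∷ xs) ++ [ v′ ])) (head-tail π⟨ u ∷ ws ⟩) (h (u ∷ ws)))))))
    -- Now the loop stands on the right of the relation, which calls for the second half of
    -- `DeterminesLoops`.
    π⁻¹-loop : ∀ ws → π⁻¹⟨ u′ ∷ ws ⟩ ≡ u ∷ from ws
    π⁻¹-loop ws = trans (head-tail _) (cong (_∷ from ws) (sym (proj₂ (loops u′ u _)
      (proj₁ (subst₂ (λ xs ys → SameSeq R ((u ∷ xs) ++ [ v ]) ((u′ ∷ ys) ++ [ v′ ])) (head-tail π⁻¹⟨ u′ ∷ ws ⟩) (ππ⁻¹ (u′ ∷ ws))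
        (h π⁻¹⟨ u′ ∷ ws ⟩))))))
    to-from : ∀ ws → to (from ws) ≡ ws
    to-from ws = cong Vec.tail (trans (cong π⟨_⟩ (sym (π⁻¹-loop ws))) (ππ⁻¹ (u′ ∷ ws)))
    from-to : ∀ ws → from (to ws) ≡ ws
    from-to ws = cong Vec.tail (trans (cong π⁻¹⟨_⟩ (sym (π-loop ws))) (π⁻¹π (u ∷ ws)))

  WalkRef-antitone : ∀ {m k R} → DeterminesLoops R → m ℕ.≤ k → WalkRef (suc k) R ⊑ WalkRef (suc m) R
  WalkRef-antitone {m} {k} {R} loops m≤k = go (ℕ.≤⇒≤′ m≤k)
    where
    go : ∀ {k} → m ℕ.≤′ k → WalkRef (suc k) R ⊑ WalkRef (suc m) R
    go ℕ.≤′-refl _ _ _ _ r = r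
    go (ℕ.≤′-step le) _ _ _ _ r = go le _ _ _ _ (WalkRef-suc-⊑ _ loops _ _ _ _ r)

  WalkRef-⊑ : ∀ m {R} → DeterminesLoops R → WalkRef (suc m) R ⊑ R
  -- A walk of length 1 has no inner vertices, so refinement at that length compares just the
  -- colours of the two pairs.
  WalkRef-⊑ m {R} loops u v u′ v′ r with WalkRef-antitone {zero} {m} {R} loops ℕ.z≤n u v u′ v′ r
  ... | π , h with Inverse.to π [] | h []
  ...   | [] | (p , _) = p

  module _ (m : ℕ) {R : Col n} (loops : DeterminesLoops R) where
    Iterate-⊑ : ∀ i → Iterate (suc m) R i ⊑ R
    Iterate-loops : ∀ i → DeterminesLoops (Iterate (suc m) R i)
    Iterate-loops i = DeterminesLoops-⊑ (Iterate-⊑ i) loops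
    Iterate-⊑ zero _ _ _ _ r = r
    Iterate-⊑ (suc i) _ _ _ _ r = Iterate-⊑ i _ _ _ _ (WalkRef-⊑ m (Iterate-loops i) _ _ _ _ r)

module _ {n : ℕ} {C : Set} (χ : Fin n → Fin n → C) (distinct : LoopsDistinct χ) (converse : RespectsConverse χ) where
  kernel-loops : DeterminesLoops (kernel χ)
  kernel-loops u v w = (λ r → decidable-stable (v Fin.≟ w) λ ne → distinct u v w ne r)
    , (λ r → decidable-stable (v Fin.≟ w) λ ne → distinct u v w ne (sym r))

  -- Keep only the finitely many coincidences used: this makes the colouring decidable.
  kernel-stable : ∀ {m} → n ℕ.* n ℕ.≤ m → Iterate (suc m) (kernel χ) (n ℕ.+ n) ⊑ Iterate (suc m) (kernel χ) (suc (n ℕ.+ n))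
  kernel-stable {m} n²≤m u v u′ v′ r with supported-iterate (suc m) (n ℕ.+ n) u v u′ v′ r
  -- The flipped coincidences are added because `S` also compares the reversed edges.
  ... | es , p , f with identify (uncurry χ) (es List.++ List.map flip es) (All.++⁺ p (All.map⁺ (All.map (λ {e} → converse _ _ _ _) p)))
  ...   | rep , χrep , agree = Iterate-mono (suc m) S⊑χ (suc (n ℕ.+ n)) u v u′ v′
      (admissible-stable admissible n²≤m u v u′ v′ (f S (All.zipWith id (All.++⁻ˡ es agree , All.map⁻ (All.++⁻ʳ es agree)))))
    where
    -- Pairing an edge with its reverse makes this colouring respect converses by construction.
    S : Col n
    S u v u′ v′ = rep (u , v) ≡ rep (u′ , v′) × rep (v , u) ≡ rep (v′ , u′)
    S⊑χ : S ⊑ kernel χ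
    S⊑χ u v u′ v′ (e , _) = trans (sym (χrep (u , v))) (trans (cong (uncurry χ) e) (χrep (u′ , v′)))
    admissible : IsAdmissible S
    admissible = record
      { R? = λ u v u′ v′ → (rep (u , v) ≟ᴱ rep (u′ , v′)) ×-dec (rep (v , u) ≟ᴱ rep (v′ , u′))
      ; R-refl = refl , refl
      ; R-sym = λ { (p , q) → sym p , sym q }
      ; R-trans = λ { (p , q) (p′ , q′) → trans p p′ , trans q q′ }
      ; R-loop = λ {u} {v} {w} s → proj₁ (kernel-loops u v w) (S⊑χ u u v w s)
      ; R-converse = λ { (p , q) → q , p } }

-- Passing to a common walk length

supremum : (ℕ → ℕ) → ℕ → ℕ
supremum f zero = f zero
supremum f (suc i) = supremum f i ℕ.⊔ f (suc i)

≤-supremum : ∀ f m {i} → i ℕ.≤ m → f i ℕ.≤ supremum f m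
≤-supremum f zero ℕ.z≤n = ℕ.≤-refl
≤-supremum f (suc m) {i} i≤ with i ℕ.≟ suc m
... | yes refl = ℕ.m≤n⊔m (supremum f m) _
... | no ne = ℕ.≤-trans (≤-supremum f m (ℕ.≤-pred (ℕ.≤∧≢⇒< i≤ ne))) (ℕ.m≤m⊔n _ _)

theorem11 : (n : ℕ) (C : Set) (χ : Fin n → Fin n → C)
    → LoopsDistinct χ → RespectsConverse χ
    → (Rs : ℕ → Col n) → IsWalkIteration (kernel χ) Rs
    → Σ ℕ λ m → m ℕ.≤ 2 ℕ.* n × (Rs m ≡ᶜ Rs (suc m))
theorem11 n C χ distinct converse Rs (Rs₀ , Rs₊) = 2n , ℕ.≤-reflexive (cong (n ℕ.+_) (sym (ℕ.+-identityʳ n))) , λ u v u′ v′ →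
  (λ r → from-iterate (suc 2n) ℕ.≤-refl u v u′ v′
    (kernel-stable χ distinct converse n²≤m u v u′ v′ (to-iterate 2n (ℕ.n≤1+n 2n) u v u′ v′ r))) ,
  (λ r → from-iterate 2n (ℕ.n≤1+n 2n) u v u′ v′
    (WalkRef-⊑ m (Iterate-loops m loops 2n) u v u′ v′ (to-iterate (suc 2n) ℕ.≤-refl u v u′ v′ r)))
  where
  2n = n ℕ.+ n
  loops = kernel-loops χ distinct converse
  k : ℕ → ℕ
  k i = proj₁ (Rs₊ i)
  -- One common walk length that dominates all those chosen by the refinement steps.
  m = suc (n ℕ.* n) ℕ.⊔ supremum k 2n
  n²≤m : n ℕ.* n ℕ.≤ m
  n²≤m = ℕ.≤-trans (ℕ.n≤1+n _) (ℕ.m≤m⊔n (suc (n ℕ.* n)) (supremum k 2n))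
  -- The finest refinement is compared with lengths of at least 2, and the common length is `suc m`.
  1≤m : 1 ℕ.≤ m
  1≤m = ℕ.≤-trans (ℕ.s≤s ℕ.z≤n) (ℕ.m≤m⊔n (suc (n ℕ.* n)) (supremum k 2n))
  I : ℕ → Col n
  I = Iterate (suc m) (kernel χ)
  restrict : ∀ {k R} → 2 ℕ.≤ k → k ℕ.≤ m → DeterminesLoops R → WalkRef (suc m) R ⊑ WalkRef k R
  restrict {suc k} {R} 2≤k k≤m loops = WalkRef-antitone {R = R} loops (ℕ.<⇒≤ k≤m)
  -- The two sequences induce the same partitions: the refinement at the chosen length is finest, so
  -- at least as fine as that at the common length, and conversely longer walks refine at least as
  -- much by `restrict`.
  to-iterate : ∀ i → i ℕ.≤ suc 2n → Rs i ⊑ I i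
  from-iterate : ∀ i → i ℕ.≤ suc 2n → I i ⊑ Rs i
  to-iterate zero _ u v u′ v′ r = proj₁ (Rs₀ u v u′ v′) r
  to-iterate (suc i) (ℕ.s≤s i≤) u v u′ v′ r with Rs₊ i
  ... | _ , _ , finest , same , _ = WalkRef-mono (suc m) (to-iterate i (ℕ.m≤n⇒m≤1+n i≤)) u v u′ v′
    (finest (suc m) (ℕ.s≤s 1≤m) u v u′ v′ (proj₁ (same u v u′ v′) r))
  from-iterate zero _ u v u′ v′ r = proj₂ (Rs₀ u v u′ v′) r
  from-iterate (suc i) (ℕ.s≤s i≤) u v u′ v′ r = proj₂ (proj₁ (proj₂ (proj₂ (proj₂ (Rs₊ i)))) u v u′ v′)
    (restrict (proj₁ (proj₂ (Rs₊ i))) (ℕ.≤-trans (≤-supremum k 2n i≤) (ℕ.m≤n⊔m (suc (n ℕ.* n)) _))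
      (DeterminesLoops-⊑ (to-iterate i (ℕ.m≤n⇒m≤1+n i≤)) (Iterate-loops m loops i)) u v u′ v′
      (WalkRef-mono (suc m) (from-iterate i (ℕ.m≤n⇒m≤1+n i≤)) u v u′ v′ r))
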